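{- Let $G$ be a $48$-edge-connected bipartite graph such that $|E(G)|$ is divisible by $5$. Then $G$ admits a $P_5$-decomposition, i.e. $E(G)$ can be partitioned into sets each of which is the edge set of a subgraph of $G$ isomorphic to $P_5$, the path with $5$ edges.
   Context: Graphs are finite and have no loops or multiple edges. $P_5$ denotes the path of length $5$ (five edges, six vertices). A decomposition of $G$ into copies of $H$ is a set of pairwise edge-disjoint subgraphs of $G$, each isomorphic to $H$, whose union is $G$. -}

module Defs where

open import Data.Nat using (ℕ; zero; suc; _<_; _<ᵇ_)
open import Data.Bool using (Bool; true; false; T; _∧_; if_then_else_)
open import Data.Fin using (Fin; toℕ; inject₁) renaming (suc to fsuc)
open import Data.Product using (_×_; _,_; ∃; Σ)
open import Data.List using (List; []; _∷_; length; concatMap; map; allFin; filterᵇ)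
open import Data.List.Membership.Propositional using (_∉_)
open import Data.List.Relation.Binary.Permutation.Propositional using (_↭_)
open import Relation.Binary.PropositionalEquality using (_≡_; _≢_)
open import Relation.Binary.Construct.Closure.ReflexiveTransitive using (Star)
open import Function.Definitions using (Injective)

record Graph (n : ℕ) : Set where
  field
    adj     : Fin n → Fin n → Bool
    adj-sym : ∀ u v → adj u v ≡ adj v u
    irrefl  : ∀ u → adj u u ≡ false
open Graph public

allPairs : (n : ℕ) → List (Fin n × Fin n)
allPairs n = concatMap (λ i → map (λ j → (i , j)) (allFin n)) (allFin n)

edges : {n : ℕ} → Graph n → List (Fin n × Fin n)
edges {n} G = filterᵇ (λ { (u , v) → (toℕ u <ᵇ toℕ v) ∧ adj G u v }) (allPairs n)

∣E∣ : {n : ℕ} → Graph n → ℕ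
∣E∣ G = length (edges G)

Connected : {n : ℕ} → (Fin n → Fin n → Set) → Set
Connected {n} R = ∀ (u v : Fin n) → Star R u v

AdjMinus : {n : ℕ} → Graph n → List (Fin n × Fin n) → Fin n → Fin n → Set
AdjMinus G F u v = T (adj G u v) × (u , v) ∉ F × (v , u) ∉ F

-- k-edge-connected (Diestel): |V(G)| > 1 and G − F is connected for every
-- set F of fewer than k edges.  (A set of < k edges is given as a list of
-- length < k; lists of arbitrary pairs remove at most that many edges.)
EdgeConnected : (k : ℕ) → {n : ℕ} → Graph n → Set
EdgeConnected k {n} G =
  1 < n × (∀ (F : List (Fin n × Fin n)) → length F < k → Connected (AdjMinus G F))

Bipartite : {n : ℕ} → Graph n → Set
Bipartite {n} G = Σ (Fin n → Bool) λ c → ∀ u v → T (adj G u v) → c u ≢ c v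

record P5 (n : ℕ) : Set where
  field
    vert : Fin 6 → Fin n
    inj  : Injective _≡_ _≡_ vert
open P5 public

norm : {n : ℕ} → Fin n × Fin n → Fin n × Fin n
norm (u , v) = if toℕ u <ᵇ toℕ v then (u , v) else (v , u)

pathEdges : {n : ℕ} → P5 n → List (Fin n × Fin n)
pathEdges p = map (λ (i : Fin 5) → norm (vert p (inject₁ i) , vert p (fsuc i))) (allFin 5)

-- A P₅-decomposition of G: a list of P₅ copies whose edge sets partition
-- E(G) (the multiset union of their edge sets is exactly E(G); this forces
-- every path edge to be an edge of G and the paths to be edge-disjoint).
P5Decomposition : {n : ℕ} → Graph n → Set
P5Decomposition {n} G =
  Σ (List (P5 n)) λ ps → concatMap pathEdges ps ↭ edges G

{-# OPTIONS --safe #-}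
module Submission where

-- Let A and B be the colour classes.  Divide the edges at every vertex of A into groups of at most three.  Since every
-- cut has at least 48 edges, it meets so many groups that eight copies of G glued at a vertex have a spanning tree using
-- each group in at most one copy and for at most one edge.  This gives eight edge-disjoint spanning trees of G which
-- together use at most (d(a) + 2) / 3 edges at each a in A.
--
-- Two pairs of these trees yield Eulerian subgraphs whose circuits are cut at B into hops b-a-b′; exchanging ab for ab′
-- along connected hops corrects degree parities in B and leaves degrees in A fixed.  So E splits as W, P and R, where
-- W has degree 4q(a) at a and even degrees, P has degree q(a) at a, and R is even and contains a spanning tree.  Now W
-- decomposes into trails of length 4 with ends in A, which can be oriented so that q(a) of them end at a, and these are
-- prolonged by the edges of P at a.  Finally R is a single circuit, of length divisible by 5, and is cut into trails of
-- length 5.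
--
-- A trail x0 x1 x2 x3 x4 x5 of length 5 is a path unless x0 = x4 or x1 = x5.  Every vertex of A is x4 in two trails and
-- every vertex of B is x1 or x3 in two, which suffices to remove these coincidences by exchanging ends of trails.

open import Defs
open import Data.Nat using (ℕ)
open import Data.Nat.Divisibility using (_∣_)

open import Data.Nat hiding (_≟_; parity)
open import Data.Nat.Properties hiding (_≟_)
open import Data.Nat.Properties using () renaming (_≟_ to _≟ⁿ_)
open import Data.Nat.Divisibility using (divides; ∣m+n∣m⇒∣n)
open import Data.Nat.Tactic.RingSolver using (solve-∀)
import Data.Bool as Bool
open import Data.Bool using (Bool; true; false; not; _xor_; _∧_; _∨_; if_then_else_)
open import Data.Bool.Properties using (xor-assoc; xor-comm; xor-identityʳ; xor-same; not-involutive; ¬-not; T-∧; T-≡) renaming (_≟_ to _≟ᵇ_)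
open import Data.Empty using (⊥; ⊥-elim)
open import Data.Fin using (Fin; toℕ; fromℕ<; punchOut; punchIn; combine; remQuot) renaming (zero to fz; suc to fs)
open import Data.Fin.Patterns
open import Data.Fin.Properties using (_≟_; toℕ-injective; toℕ<n; fromℕ<-toℕ; toℕ-fromℕ<; punchOut-punchIn; punchInᵢ≢i; punchOut-injective; punchOut-cong; any?; all?; remQuot-combine; combine-remQuot)
open import Data.List using (List; []; _∷_; _++_; map; concatMap; length; lookup; allFin; filterᵇ; cartesianProduct; [_])
open import Data.List.Membership.Propositional using (_∈_; find; lose)
open import Data.List.Membership.Propositional.Properties
open import Data.List.Properties using (map-++; ++-assoc; ++-identityʳ; length-++; length-map; length-tabulate; map-id; map-∘; map-cong-local; concatMap-map; map-tabulate; tabulate-lookup; concatMap-++)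
open import Data.List.Relation.Binary.Permutation.Propositional
  using (_↭_; refl; prep; ↭-sym; ↭-trans; ↭-reflexive; ↭⇒↭ₛ) renaming (trans to ptrans; swap to pswap)
open import Data.List.Relation.Binary.Permutation.Propositional.Properties
  using (∈-resp-↭; ↭-length; shift; ++⁺; ++⁺ˡ; ++⁺ʳ; ++-comm; map⁺)
open import Data.List.Relation.Binary.Permutation.Setoid.Properties using (Unique-resp-↭)
open import Data.List.Relation.Unary.All using ([]; _∷_)
import Data.List.Relation.Unary.All as All
import Data.List.Relation.Unary.All.Properties as All
open import Data.List.Relation.Unary.AllPairs using ([]; _∷_)
import Data.List.Relation.Unary.AllPairs as AllPairs
import Data.List.Relation.Unary.AllPairs.Properties as AllPairs
open import Data.List.Relation.Unary.Any using (here; there)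
open import Data.List.Relation.Unary.Unique.Propositional using (Unique)
open import Data.List.Relation.Unary.Unique.Propositional.Properties using (allFin⁺; cartesianProduct⁺) renaming (filter⁺ to unique-filter)
open import Data.Maybe using (Maybe; just; nothing; is-just; to-witness-T)
open import Data.Product using (∃; ∃₂; _×_; _,_; proj₁; proj₂)
open import Data.Sum using (_⊎_; inj₁; inj₂)
import Data.Sum as Sum
open import Data.Unit using (⊤; tt)
open import Data.Vec using (Vec; _[_]≔_; replicate) renaming ([] to []ᵛ; _∷_ to _∷ᵛ_; lookup to lookupᵛ)
open import Data.Vec.Properties using (lookup∘update; lookup∘update′)
open import Data.Vec.Relation.Unary.All using ([]; _∷_)
open import Data.Vec.Relation.Unary.AllPairs using ([]; _∷_)
open import Data.Vec.Relation.Unary.Unique.Propositional using () renaming (Unique to Distinct)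
open import Data.Vec.Relation.Unary.Unique.Propositional.Properties using (lookup-injective)
open import Function using (_∘_; id; case_of_)
open import Function.Bundles using (Equivalence)
open import Relation.Binary.Construct.Closure.ReflexiveTransitive using (Star; ε; _◅_)
open import Relation.Binary.Definitions using (tri<; tri≈; tri>)
open import Relation.Binary.PropositionalEquality hiding ([_])
open import Relation.Nullary

-- The number 48 is 8 · 2 · 3. Partition the vertices of the glued copies. In one copy every class
-- not containing the glued vertex is left by at least 48 edges, an edge leaves at most two classes
-- and a group has at most three edges, so h such classes force at least 8h crossing groups;
-- averaging over the eight copies gives one crossing group for every class but the glued one. The
-- trees are eight as 1 + 2 + 2 + 3: one connects R, each of the two exchange networks consumes a
-- pair, and three go into W, so that each vertex of B has degree at least 3, hence at least 4, in
-- W. Groups of three leave about two thirds of the edges at a vertex of A outside the trees; the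
-- degrees 4q(a) and q(a) are filled up from these. Only the two named coincidences can occur in a
-- trail: vertices at odd distance differ in colour, and those at distance two differ because the
-- edges do. The obstacle in removing a coincidence is that the partner of an exchange may become
-- closed in turn. Such a sequence is finite because it keeps one vertex fixed and marks a new
-- neighbour of it each time.

-- Parities, sums over lists, permutations

ind : Bool → ℕ
ind true  = 1
ind false = 0

odd : ℕ → Bool
odd zero    = false
odd (suc n) = not (odd n)

odd-+ : ∀ m n → odd (m + n) ≡ odd m xor odd n
odd-+ zero    n = refl
odd-+ (suc m) n rewrite odd-+ m n with odd m | odd n
... | true  | true  = refl
... | true  | false = refl
... | false | true  = refl
... | false | false = refl

odd-double : ∀ m → odd (m + m) ≡ false
odd-double m = trans (odd-+ m m) (xor-same (odd m))

xor-mid : ∀ x a b c → (x xor (a xor b)) xor (b xor c) ≡ x xor (a xor c)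
xor-mid true true true true = refl
xor-mid true true true false = refl
xor-mid true true false true = refl
xor-mid true true false false = refl
xor-mid true false true true = refl
xor-mid true false true false = refl
xor-mid true false false true = refl
xor-mid true false false false = refl
xor-mid false true true true = refl
xor-mid false true true false = refl
xor-mid false true false true = refl
xor-mid false true false false = refl
xor-mid false false true true = refl
xor-mid false false true false = refl
xor-mid false false false true = refl
xor-mid false false false false = refl

xor-move : ∀ {x} a {y} → x ≡ a xor y → y ≡ a xor x
xor-move true  {true}  refl = refl
xor-move true  {false} refl = refl
xor-move false refl = refl

module _ {A : Set} where

  sm : (A → ℕ) → List A → ℕ
  sm f []       = 0
  sm f (x ∷ xs) = f x + sm f xs

  sm-++ : ∀ (f : A → ℕ) xs ys → sm f (xs ++ ys) ≡ sm f xs + sm f ys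
  sm-++ f []       ys = refl
  sm-++ f (x ∷ xs) ys rewrite sm-++ f xs ys = sym (+-assoc (f x) _ _)

  sm-↭ : ∀ (f : A → ℕ) {xs ys} → xs ↭ ys → sm f xs ≡ sm f ys
  sm-↭ f refl = refl
  sm-↭ f (prep x p) = cong (f x +_) (sm-↭ f p)
  sm-↭ f {ys = _ ∷ _ ∷ ys} (pswap x y p) rewrite sm-↭ f p =
    trans (sym (+-assoc (f x) (f y) _)) (trans (cong (_+ sm f ys) (+-comm (f x) (f y))) (+-assoc (f y) (f x) _))
  sm-↭ f (ptrans p q) = trans (sm-↭ f p) (sm-↭ f q)

  sm-cong : ∀ {f g : A → ℕ} → (∀ x → f x ≡ g x) → ∀ xs → sm f xs ≡ sm g xs
  sm-cong h []       = refl
  sm-cong h (x ∷ xs) = cong₂ _+_ (h x) (sm-cong h xs)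

  sm-mono : ∀ {f g : A → ℕ} xs → (∀ x → x ∈ xs → f x ≤ g x) → sm f xs ≤ sm g xs
  sm-mono []       h = z≤n
  sm-mono (x ∷ xs) h = +-mono-≤ (h x (here refl)) (sm-mono xs (λ y m → h y (there m)))

  sm-+ : ∀ (f g : A → ℕ) xs → sm (λ x → f x + g x) xs ≡ sm f xs + sm g xs
  sm-+ f g []       = refl
  sm-+ f g (x ∷ xs) rewrite sm-+ f g xs = lem (f x) (g x) _ _
    where
    lem : ∀ a b c d → a + b + (c + d) ≡ a + c + (b + d)
    lem = solve-∀

  sm-*ˡ : ∀ k (f : A → ℕ) xs → sm (λ x → k * f x) xs ≡ k * sm f xs
  sm-*ˡ k f []       = sym (*-zeroʳ k)
  sm-*ˡ k f (x ∷ xs) rewrite sm-*ˡ k f xs = sym (*-distribˡ-+ k (f x) _)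

  sm-0 : ∀ {f : A → ℕ} xs → (∀ x → x ∈ xs → f x ≡ 0) → sm f xs ≡ 0
  sm-0 []       h = refl
  sm-0 (x ∷ xs) h = cong₂ _+_ (h x (here refl)) (sm-0 xs (λ y m → h y (there m)))

  sm-const : ∀ k xs → sm (λ _ → k) xs ≡ length xs * k
  sm-const k []       = refl
  sm-const k (x ∷ xs) = cong (k +_) (sm-const k xs)

  sm-∈ : ∀ (f : A → ℕ) {x xs} → x ∈ xs → f x ≤ sm f xs
  sm-∈ f {xs = y ∷ ys} (here refl) = m≤m+n (f y) _
  sm-∈ f {xs = y ∷ ys} (there m)   = ≤-trans (sm-∈ f m) (m≤n+m _ (f y))

  sm-pos : ∀ (f : A → ℕ) xs → 1 ≤ sm f xs → ∃ λ x → x ∈ xs × 1 ≤ f x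
  sm-pos f (x ∷ xs) p with f x in eq
  ... | suc k = x , here refl , subst (1 ≤_) (sym eq) (s≤s z≤n)
  ... | zero with sm-pos f xs p
  ... | y , m , q = y , there m , q

  odd-sm-cong : ∀ {f g : A → ℕ} xs → (∀ x → odd (f x) ≡ odd (g x)) → odd (sm f xs) ≡ odd (sm g xs)
  odd-sm-cong []       h = refl
  odd-sm-cong {f} {g} (x ∷ xs) h =
    trans (odd-+ (f x) _) (trans (cong₂ _xor_ (h x) (odd-sm-cong xs h)) (sym (odd-+ (g x) _)))

  ∈⇒↭ : ∀ {x : A} {xs} → x ∈ xs → ∃ λ ys → xs ↭ x ∷ ys
  ∈⇒↭ {x} m with ∈-∃++ m
  ... | as , bs , refl = as ++ bs , shift x as bs

module _ {A B : Set} where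

  sm-map : ∀ (f : B → ℕ) (g : A → B) xs → sm f (map g xs) ≡ sm (f ∘ g) xs
  sm-map f g []       = refl
  sm-map f g (x ∷ xs) = cong (f (g x) +_) (sm-map f g xs)

  sm-concatMap : ∀ (f : B → ℕ) (g : A → List B) xs → sm f (concatMap g xs) ≡ sm (λ x → sm f (g x)) xs
  sm-concatMap f g []       = refl
  sm-concatMap f g (x ∷ xs) = trans (sm-++ f (g x) _) (cong (sm f (g x) +_) (sm-concatMap f g xs))

  sm-swap : ∀ (f : A → B → ℕ) xs ys → sm (λ x → sm (f x) ys) xs ≡ sm (λ y → sm (λ x → f x y) xs) ys
  sm-swap f [] ys = sym (sm-0 ys (λ _ _ → refl))
  sm-swap f (x ∷ xs) ys = trans (cong (sm (f x) ys +_) (sm-swap f xs ys)) (sym (sm-+ (f x) _ ys))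

concatMap⁺ : ∀ {A B : Set} (f : A → List B) {xs ys} → xs ↭ ys → concatMap f xs ↭ concatMap f ys
concatMap⁺ f refl = refl
concatMap⁺ f (prep x p) = ++⁺ˡ (f x) (concatMap⁺ f p)
concatMap⁺ f (pswap {xs} {ys} x y p) = ↭-trans (↭-reflexive (sym (++-assoc (f x) (f y) (concatMap f xs))))
  (↭-trans (++⁺ (++-comm (f x) (f y)) (concatMap⁺ f p)) (↭-reflexive (++-assoc (f y) (f x) (concatMap f ys))))
concatMap⁺ f (ptrans p q) = ↭-trans (concatMap⁺ f p) (concatMap⁺ f q)

-- A solver for permutations of concatenated blocks, each block being named by its index in ρ.
module Rearrange {A : Set} where

  infixr 5 _⊕_

  data Blocks : Set where
    ∅   : Blocks
    #_  : ℕ → Blocks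
    _⊕_ : Blocks → Blocks → Blocks

  at : List (List A) → ℕ → List A
  at []       _       = []
  at (x ∷ _)  zero    = x
  at (_ ∷ xs) (suc k) = at xs k

  eval : List (List A) → Blocks → List A
  eval ρ ∅       = []
  eval ρ (# i)   = at ρ i
  eval ρ (s ⊕ t) = eval ρ s ++ eval ρ t

  flat : Blocks → List ℕ
  flat ∅       = []
  flat (# i)   = i ∷ []
  flat (s ⊕ t) = flat s ++ flat t

  eval-flat : ∀ ρ s → eval ρ s ≡ concatMap (at ρ) (flat s)
  eval-flat ρ ∅       = refl
  eval-flat ρ (# i)   = sym (++-identityʳ (at ρ i))
  eval-flat ρ (s ⊕ t) = trans (cong₂ _++_ (eval-flat ρ s) (eval-flat ρ t)) (sym (concatMap-++ (at ρ) (flat s) (flat t)))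

  extract : (i : ℕ) (js : List ℕ) → Maybe (∃ λ js′ → js ↭ i ∷ js′)
  extract i [] = nothing
  extract i (j ∷ js) with i ≟ⁿ j
  ... | yes refl = just (js , refl)
  ... | no _ with extract i js
  ... | nothing = nothing
  ... | just (js′ , p) = just (j ∷ js′ , ptrans (prep j p) (pswap j i refl))

  same? : (is js : List ℕ) → Maybe (is ↭ js)
  same? [] [] = just refl
  same? [] (_ ∷ _) = nothing
  same? (i ∷ is) js with extract i js
  ... | nothing = nothing
  ... | just (js′ , p) with same? is js′
  ... | nothing = nothing
  ... | just q = just (ptrans (prep i q) (↭-sym p))

  rearrange : (ρ : List (List A)) (s t : Blocks) {_ : Bool.T (is-just (same? (flat s) (flat t)))} → eval ρ s ↭ eval ρ t
  rearrange ρ s t {ok} = ↭-trans (↭-reflexive (eval-flat ρ s))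
    (↭-trans (concatMap⁺ (at ρ) (to-witness-T (same? (flat s) (flat t)) ok)) (↭-reflexive (sym (eval-flat ρ t))))

  row : List ℕ → Blocks
  row []           = ∅
  row (i ∷ [])     = # i
  row (i ∷ j ∷ is) = # i ⊕ row (j ∷ is)

  shuffle : (ρ : List (List A)) (is js : List ℕ) {_ : Bool.T (is-just (same? (flat (row is)) (flat (row js))))} → eval ρ (row is) ↭ eval ρ (row js)
  shuffle ρ is js {ok} = rearrange ρ (row is) (row js) {ok}

-- The Kronecker delta

δ : ∀ {n} → Fin n → Fin n → ℕ
δ u v = ind ⌊ u ≟ v ⌋

δ-refl : ∀ {n} (u : Fin n) → δ u u ≡ 1
δ-refl u with u ≟ u
... | yes _ = refl
... | no  p = ⊥-elim (p refl)

δ-≡ : ∀ {n} {u v : Fin n} → u ≡ v → δ u v ≡ 1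
δ-≡ refl = δ-refl _

δ-≢ : ∀ {n} {u v : Fin n} → u ≢ v → δ u v ≡ 0
δ-≢ {u = u} {v} p with u ≟ v
... | yes q = ⊥-elim (p q)
... | no  _ = refl

δ-pos : ∀ {n} {u v : Fin n} → 1 ≤ δ u v → u ≡ v
δ-pos {u = u} {v} p with u ≟ v
... | yes q = q

odd-δ : ∀ {n} {u v : Fin n} → odd (δ u v) ≡ true → u ≡ v
odd-δ {u = u} {v} p with u ≟ v
... | yes q = q

δ-suc : ∀ {n} (u v : Fin n) → δ (fs u) (fs v) ≡ δ u v
δ-suc u v with u ≟ v
... | yes _ = refl
... | no  _ = refl

sm-allFin-suc : ∀ {n} (f : Fin (suc n) → ℕ) → sm f (allFin (suc n)) ≡ f fz + sm (f ∘ fs) (allFin n)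
sm-allFin-suc {n} f = cong (f fz +_) (trans (cong (sm f) (sym (map-tabulate id fs))) (sm-map f fs (allFin n)))

sm-δ : ∀ {n} (r : Fin n) (f : Fin n → ℕ) → sm (λ z → δ r z * f z) (allFin n) ≡ f r
sm-δ {suc n} fz f = trans (sm-allFin-suc (λ z → δ fz z * f z))
  (trans (cong₂ _+_ (*-identityˡ (f fz)) (sm-0 (allFin n) (λ _ _ → refl))) (+-identityʳ _))
sm-δ {suc n} (fs r) f = trans (sm-allFin-suc (λ z → δ (fs r) z * f z))
  (trans (sm-cong (λ z → cong (_* f (fs z)) (δ-suc r z)) (allFin n)) (sm-δ r (f ∘ fs)))

sm-δ1 : ∀ {n} (r : Fin n) → sm (δ r) (allFin n) ≡ 1
sm-δ1 r = trans (sm-cong (λ z → sym (*-identityʳ (δ r z))) (allFin _)) (sm-δ r (λ _ → 1))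

-- T-joins and Euler circuits

module Multigraph {n : ℕ} {E : Set} (s t : E → Fin n) where

  -- A loop counts twice. Loops do occur: later the edges of a multigraph are trails of length 4
  -- joining their two ends, and these may be closed.
  inc : E → Fin n → ℕ
  inc e v = δ (s e) v + δ (t e) v

  deg : List E → Fin n → ℕ
  deg L v = sm (λ e → inc e v) L

  Even : List E → Set
  Even L = ∀ v → odd (deg L v) ≡ false

  Joins : E → Fin n → Fin n → Set
  Joins e u v = (s e ≡ u × t e ≡ v) ⊎ (s e ≡ v × t e ≡ u)

  joins-inc : ∀ {e u v} → Joins e u v → ∀ z → inc e z ≡ δ u z + δ v z
  joins-inc (inj₁ (refl , refl)) z = refl
  joins-inc {e} (inj₂ (refl , refl)) z = +-comm (δ (s e) z) _

  joins-odd : ∀ {e u v} → Joins e u v → ∀ z → odd (inc e z) ≡ odd (δ u z) xor odd (δ v z)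
  joins-odd {e} {u} {v} j z = trans (cong odd (joins-inc {e} j z)) (odd-+ (δ u z) _)

  joins-sym : ∀ {e u v} → Joins e u v → Joins e v u
  joins-sym (inj₁ p) = inj₂ p
  joins-sym (inj₂ p) = inj₁ p

  deg-↭ : ∀ {L K} → L ↭ K → ∀ v → deg L v ≡ deg K v
  deg-↭ p v = sm-↭ _ p

  deg-++ : ∀ L K v → deg (L ++ K) v ≡ deg L v + deg K v
  deg-++ L K v = sm-++ _ L K

  odd-deg-++ : ∀ {L J K} → L ↭ J ++ K → ∀ v → odd (deg L v) ≡ odd (deg J v) xor odd (deg K v)
  odd-deg-++ {L} {J} {K} p v = trans (cong odd (trans (deg-↭ p v) (deg-++ J K v))) (odd-+ (deg J v) _)

  data Path (P : E → Set) : Fin n → Fin n → Set where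
    []   : ∀ {u} → Path P u u
    step : ∀ {u w v} e → P e → Joins e u w → Path P w v → Path P u v

  path-trans : ∀ {P u v w} → Path P u v → Path P v w → Path P u w
  path-trans []             q = q
  path-trans (step e p j r) q = step e p j (path-trans r q)

  path-sym : ∀ {P u v} → Path P u v → Path P v u
  path-sym []             = []
  path-sym (step e p j r) = path-trans (path-sym r) (step e p (joins-sym j) [])

  path-map : ∀ {P Q u v} → (∀ e → P e → Q e) → Path P u v → Path Q u v
  path-map f []             = []
  path-map f (step e p j r) = step e (f e p) j (path-map f r)

  path-bind : ∀ {P Q u v} → (∀ e → P e → Path Q (s e) (t e)) → Path P u v → Path Q u v
  path-bind f [] = []
  path-bind f (step e p (inj₁ (refl , refl)) r) = path-trans (f e p) (path-bind f r)
  path-bind f (step e p (inj₂ (refl , refl)) r) = path-trans (path-sym (f e p)) (path-bind f r)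

  -- Whichever side of the split holds `e`, moving it to the other side adds it to `J` modulo 2.
  toggle : ∀ {L J K e} → L ↭ J ++ K → e ∈ L →
    ∃₂ λ J′ K′ → L ↭ J′ ++ K′ × (∀ z → odd (deg J′ z) ≡ odd (deg J z) xor odd (inc e z))
  toggle {L} {J} {K} {e} p m with ∈-++⁻ J (∈-resp-↭ p m)
  ... | inj₁ q with ∈⇒↭ q
  ... | J′ , r = J′ , e ∷ K , ↭-trans p (↭-trans (++⁺ʳ K r) (↭-sym (shift e J′ K))) ,
        λ z → trans (xor-move (odd (inc e z)) (trans (cong odd (deg-↭ r z)) (odd-+ (inc e z) (deg J′ z)))) (xor-comm _ (odd (deg J z)))
  toggle {L} {J} {K} {e} p m | inj₂ q with ∈⇒↭ q
  ... | K′ , r = e ∷ J , K′ , ↭-trans p (↭-trans (++⁺ˡ J r) (shift e J K′)) ,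
        λ z → trans (odd-+ (inc e z) (deg J z)) (xor-comm (odd (inc e z)) _)

  -- Inner vertices cancel. A path may repeat an edge, which then moves back and forth; this is
  -- harmless modulo 2.
  togglePath : ∀ {L J K u v} → L ↭ J ++ K → Path (_∈ L) u v →
    ∃₂ λ J′ K′ → L ↭ J′ ++ K′ × (∀ z → odd (deg J′ z) ≡ odd (deg J z) xor (odd (δ u z) xor odd (δ v z)))
  togglePath {J = J} {K} {u} p [] = J , K , p ,
    λ z → sym (trans (cong (odd (deg J z) xor_) (xor-same (odd (δ u z)))) (xor-identityʳ _))
  togglePath {J = J} {K} {u = u} p (step {w = w} e m j r) with toggle {J = J} {K} p m
  ... | J₁ , K₁ , p₁ , h₁ with togglePath {J = J₁} {K₁} p₁ r
  ... | J₂ , K₂ , p₂ , h₂ = J₂ , K₂ , p₂ ,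
    λ z → trans (h₂ z) (trans (cong (_xor _) (trans (h₁ z) (cong (odd (deg J z) xor_) (joins-odd {e} j z))))
      (xor-mid (odd (deg J z)) (odd (δ u z)) (odd (δ w z)) _))

  -- The vertices are corrected in turn by toggling a path to `r`, which alters no other parity than
  -- those of its two ends; `r` absorbs all the errors. The first alternative admits vertices that
  -- `L` does not touch.
  tjoin : ∀ L (r : Fin n) (π : Fin n → Bool) →
    (∀ v → (π v ≡ false × deg L v ≡ 0) ⊎ Path (_∈ L) v r) →
    ∃₂ λ J K → L ↭ J ++ K × (∀ z → z ≢ r → odd (deg J z) ≡ π z)
  tjoin L r π conn with go n ≤-refl
    where
    Good : ℕ → Set
    Good k = ∃₂ λ J K → L ↭ J ++ K × (∀ z → toℕ z < k → z ≢ r → odd (deg J z) ≡ π z)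
    go : ∀ k → k ≤ n → Good k
    go zero    _ = [] , L , refl , λ z ()
    go (suc k) k<n with go k (<⇒≤ k<n)
    ... | J , K , p , h = fix
      where
      i = fromℕ< k<n
      old : ∀ z → toℕ z < suc k → z ≢ i → toℕ z < k
      old z (s≤s z≤k) z≢i = ≤∧≢⇒< z≤k (λ eq → z≢i (trans (sym (fromℕ<-toℕ z (toℕ<n z))) (lem eq)))
        where
        lem : toℕ z ≡ k → fromℕ< (toℕ<n z) ≡ i
        lem eq = toℕ-injective (trans (toℕ-fromℕ< _) (trans eq (sym (toℕ-fromℕ< k<n))))
      done : odd (deg J i) ≡ π i → Good (suc k)
      done eq = J , K , p , λ z z<k z≢r → case z ≟ i of λ where
        (yes refl) → eq
        (no z≢i) → h z (old z z<k z≢i) z≢r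
      fix : Good (suc k)
      fix with odd (deg J i) ≟ᵇ π i | conn i | i ≟ r
      ... | yes eq | _ | _ = done eq
      ... | no neq | inj₁ (π0 , d0) | _ = ⊥-elim (neq (trans (cong odd (m+n≡0⇒m≡0 (deg J i) (trans (sym (trans (deg-↭ p i) (deg-++ J K i))) d0))) (sym π0)))
      ... | no neq | inj₂ q | yes i≡r = J , K , p , λ z z<k z≢r → h z (old z z<k (λ e → z≢r (trans e i≡r))) z≢r
      ... | no neq | inj₂ q | no i≢r with togglePath {J = J} {K} p q
      ... | J′ , K′ , p′ , h′ = J′ , K′ , p′ , λ z z<k z≢r → trans (h′ z) (case z ≟ i of λ where
        (yes refl) → trans (cong₂ (λ a b → odd (deg J i) xor (odd a xor odd b)) (δ-refl i) (δ-≢ (i≢r ∘ sym)))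
                       (trans (xor-comm (odd (deg J i)) true) (sym (¬-not (neq ∘ sym))))
        (no z≢i) → trans (cong₂ (λ a b → odd (deg J z) xor (odd a xor odd b)) (δ-≢ (z≢i ∘ sym)) (δ-≢ (z≢r ∘ sym)))
                     (trans (xor-identityʳ _) (h z (old z z<k z≢i) z≢r)))
  ... | J , K , p , h = J , K , p , λ z → h z (toℕ<n z)

  handshake : ∀ L → sm (deg L) (allFin n) ≡ length L + length L
  handshake L = trans (sm-swap (λ v e → inc e v) (allFin n) L)
    (trans (sm-cong {g = λ _ → 2} (λ e → trans (sm-+ (δ (s e)) (δ (t e)) (allFin n)) (cong₂ _+_ (sm-δ1 (s e)) (sm-δ1 (t e)))) L)
      (trans (sm-const 2 L) (lem (length L))))
    where
    lem : ∀ m → m * 2 ≡ m + m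
    lem = solve-∀

  -- The sum of all degrees is even, which forces the last parity. This is why `tjoin` may leave the
  -- parity at `r` open.
  even-root : ∀ L r → (∀ v → v ≢ r → odd (deg L v) ≡ false) → Even L
  even-root L r h v with v ≟ r
  ... | no p = h v p
  ... | yes refl = trans (cong odd (sym (sm-δ r (deg L)))) (trans (odd-sm-cong (allFin n) same)
          (trans (cong odd (handshake L)) (odd-double (length L))))
    where
    same : ∀ z → odd (δ r z * deg L z) ≡ odd (deg L z)
    same z with r ≟ z
    ... | yes refl = cong odd (+-identityʳ (deg L r))
    ... | no q = sym (h z (q ∘ sym))

  data Walk : Fin n → Fin n → List E → Set where
    []   : ∀ {u} → Walk u u []
    step : ∀ {u w v e es} → Joins e u w → Walk w v es → Walk u v (e ∷ es)

  walk-++ : ∀ {u v w es fs} → Walk u v es → Walk v w fs → Walk u w (es ++ fs)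
  walk-++ []         q = q
  walk-++ (step j p) q = step j (walk-++ p q)

  pick : ∀ u L → (∃₂ λ e w → ∃ λ L′ → L ↭ e ∷ L′ × Joins e u w) ⊎ deg L u ≡ 0
  pick u [] = inj₂ refl
  pick u (e ∷ L) with s e ≟ u
  ... | yes p = inj₁ (e , t e , L , refl , inj₁ (p , refl))
  ... | no _ with t e ≟ u
  ... | yes p = inj₁ (e , s e , L , refl , inj₂ (refl , p))
  ... | no _ with pick u L
  ... | inj₁ (f , w , L′ , p , j) = inj₁ (f , w , e ∷ L′ , ptrans (prep e p) (pswap e f refl) , j)
  ... | inj₂ d = inj₂ d

  -- The parity condition survives when the current vertex moves along an edge. The trail stops only
  -- at a vertex with no edges left, and there the condition forces `u` to be `r`.
  trail : ∀ k L u r → length L ≤ k → (∀ z → odd (deg L z) ≡ odd (δ u z) xor odd (δ r z)) →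
    ∃₂ λ es L′ → Walk u r es × L ↭ es ++ L′ × Even L′ × deg L′ r ≡ 0
  trail k L u r len par with pick u L
  trail k L u r len par | inj₂ d with odd-δ {u = r} {u} (lem (odd (δ r u)) (trans (sym (par u)) (cong odd d)))
    where
    lem : ∀ b → odd (δ u u) xor b ≡ false → b ≡ true
    lem b rewrite δ-refl u with b
    ... | true  = λ _ → refl
    ... | false = λ ()
  ... | refl = [] , L , [] , refl , (λ z → trans (par z) (xor-same (odd (δ u z)))) , d
  trail zero L u r len par | inj₁ (e , w , L′ , p , j) with subst (_≤ 0) (↭-length p) len
  ... | ()
  trail (suc k) L u r len par | inj₁ (e , w , L′ , p , j)
    with trail k L′ w r (s≤s⁻¹ (subst (_≤ suc k) (↭-length p) len)) par′
    where
    lem : ∀ a b c x → a xor c ≡ (a xor b) xor x → x ≡ b xor c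
    lem true  true  c x q = sym q
    lem true  false c x q = not-inj q
      where
      not-inj : ∀ {a b} → not a ≡ not b → b ≡ a
      not-inj {true}  {true}  _ = refl
      not-inj {false} {false} _ = refl
    lem false true  c x q = trans (nn x) (cong not (sym q))
      where
      nn : ∀ x → x ≡ not (not x)
      nn true = refl
      nn false = refl
    lem false false c x q = sym q
    par′ : ∀ z → odd (deg L′ z) ≡ odd (δ w z) xor odd (δ r z)
    par′ z = lem (odd (δ u z)) (odd (δ w z)) (odd (δ r z)) _
      (trans (sym (par z)) (trans (cong odd (deg-↭ p z)) (trans (odd-+ (inc e z) (deg L′ z)) (cong (_xor odd (deg L′ z)) (joins-odd {e} j z)))))
  ... | es , L″ , wk , q , ev , d0 = e ∷ es , L″ , step j wk , ↭-trans p (prep e q) , ev , d0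

  closedTrail : ∀ L → Even L → ∀ u → ∃₂ λ es L′ → Walk u u es × L ↭ es ++ L′ × Even L′ × deg L′ u ≡ 0
  closedTrail L ev u = trail (length L) L u u ≤-refl (λ z → trans (ev z) (sym (xor-same (odd (δ u z)))))

  joins-pos : ∀ {e u v} → Joins e u v → 1 ≤ inc e u
  joins-pos {e} {u} {v} j rewrite joins-inc {e} j u | δ-refl u = s≤s z≤n

  shrinks : ∀ {L es L′ u e v} → L ↭ es ++ L′ → e ∈ L → Joins e u v → deg L′ u ≡ 0 → length L′ < length L
  shrinks {L} {[]} {L′} {u} {e} p m j d0 = ⊥-elim (1+n≰n (≤-trans (joins-pos {e} j) (≤-trans (sm-∈ (λ e → inc e u) m) (≤-reflexive (trans (deg-↭ p u) d0)))))
  shrinks {L} {x ∷ es} {L′} p m j d0 rewrite ↭-length p | length-++ es {L′} = s≤s (m≤n+m _ _)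

  ClosedWalk : Set
  ClosedWalk = ∃₂ λ u es → Walk u u es

  edgesOf : ClosedWalk → List E
  edgesOf (_ , es , _) = es

  -- The last component fixes where the closed walks start: in A, once edges are written with their
  -- end in A as source.
  cycles : ∀ L → Even L → ∃ λ cs → L ↭ concatMap edgesOf cs × (∀ c → c ∈ cs → ∃ λ e → e ∈ L × s e ≡ proj₁ c)
  cycles L = go (length L) L ≤-refl
    where
    go : ∀ k L → length L ≤ k → Even L → ∃ λ cs → L ↭ concatMap edgesOf cs × (∀ c → c ∈ cs → ∃ λ e → e ∈ L × s e ≡ proj₁ c)
    go k [] len ev = [] , refl , λ _ ()
    go (suc k) (e ∷ L) len ev with closedTrail (e ∷ L) ev (s e)
    ... | es , L′ , wk , p , ev′ , d0 with go k L′ (s≤s⁻¹ (≤-trans (shrinks {es = es} {e = e} p (here refl) (inj₁ (refl , refl)) d0) len)) ev′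
    ... | cs , q , st = (s e , es , wk) ∷ cs , ↭-trans p (++⁺ˡ es q) , λ where
      _ (here refl) → e , here refl , refl
      c (there m) → case st c m of λ (f , fm , eq) → f , ∈-resp-↭ (↭-sym p) (∈-++⁺ʳ es fm) , eq

  Visits : Fin n → List E → Fin n → Set
  Visits r es p = ∃₂ λ es₁ es₂ → es ≡ es₁ ++ es₂ × Walk r p es₁ × Walk p r es₂

  visits-end : ∀ {r v es e x y} → Walk r v es → e ∈ es → Joins e x y →
    ∃₂ λ es₁ es₂ → es ≡ es₁ ++ es₂ × Walk r x es₁ × Walk x v es₂
  visits-end {e = e} (step (inj₁ (refl , refl)) wk) (here refl) (inj₁ (refl , refl)) = [] , _ , refl , [] , step (inj₁ (refl , refl)) wk
  visits-end {e = e} (step (inj₁ (refl , refl)) wk) (here refl) (inj₂ (refl , refl)) = e ∷ [] , _ , refl , step (inj₁ (refl , refl)) [] , wk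
  visits-end {e = e} (step (inj₂ (refl , refl)) wk) (here refl) (inj₁ (refl , refl)) = e ∷ [] , _ , refl , step (inj₂ (refl , refl)) [] , wk
  visits-end {e = e} (step (inj₂ (refl , refl)) wk) (here refl) (inj₂ (refl , refl)) = [] , _ , refl , [] , step (inj₂ (refl , refl)) wk
  visits-end (step {e = f} j wk) (there m) j′ with visits-end wk m j′
  ... | es₁ , es₂ , refl , w₁ , w₂ = f ∷ es₁ , es₂ , refl , step j w₁ , w₂

  euler : ∀ L → Even L → ∀ r → (∀ e → e ∈ L → Path (_∈ L) r (s e)) → ∃ λ es → Walk r r es × L ↭ es
  euler L ev r conn = go (length L) [] L ≤-refl [] refl ev
    where
    find-exit : ∀ {es L′ p} → L ↭ es ++ L′ → Walk r r es → Visits r es p → ∀ {e₀} → e₀ ∈ L′ → Path (_∈ L) p (s e₀) →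
      ∃₂ λ p′ e → ∃ λ w → e ∈ L′ × Joins e p′ w × Visits r es p′
    find-exit q wk vis {e₀} m [] = s e₀ , e₀ , t e₀ , m , inj₁ (refl , refl) , vis
    find-exit {es} {L′} q wk vis m (step e e∈ j path) with ∈-++⁻ es (∈-resp-↭ q e∈)
    ... | inj₂ e∈L′ = _ , e , _ , e∈L′ , j , vis
    ... | inj₁ e∈es = find-exit q wk (visits-end wk e∈es (joins-sym {e} j)) m path
    go : ∀ k es L′ → length L′ ≤ k → Walk r r es → L ↭ es ++ L′ → Even L′ → ∃ λ es → Walk r r es × L ↭ es
    go k es [] len wk p ev = es , wk , ↭-trans p (↭-reflexive (++-identityʳ es))
    go (suc k) es L′@(e₀ ∷ _) len wk p ev
      with find-exit p wk ([] , es , refl , [] , wk) (here refl) (conn e₀ (∈-resp-↭ (↭-sym p) (∈-++⁺ʳ es (here refl))))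
    ... | p′ , e , w , e∈ , j , es₁ , es₂ , refl , w₁ , w₂ with closedTrail L′ ev p′
    ... | es₃ , L″ , w₃ , q , ev″ , d0 =
      go k (es₁ ++ es₃ ++ es₂) L″ (s≤s⁻¹ (≤-trans (shrinks {es = es₃} {e = e} q e∈ j d0) len))
         (walk-++ w₁ (walk-++ w₃ w₂)) perm ev″
      where
      perm : L ↭ (es₁ ++ es₃ ++ es₂) ++ L″
      perm = ↭-trans p (↭-trans (++⁺ˡ (es₁ ++ es₂) q) (↭-trans (↭-reflexive (++-assoc es₁ es₂ (es₃ ++ L″)))
        (↭-trans (++⁺ˡ es₁ (↭-trans (↭-reflexive (sym (++-assoc es₂ es₃ L″)))
           (↭-trans (++⁺ʳ L″ (++-comm es₂ es₃)) refl)))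
           (↭-reflexive (sym (++-assoc es₁ (es₃ ++ es₂) L″))))))

  tail head : E × Bool → Fin n
  tail (e , true)  = s e
  tail (e , false) = t e
  head (e , true)  = t e
  head (e , false) = s e

  walk-directed : ∀ {u v es} → Walk u v es → ∃ λ ds → map proj₁ ds ≡ es ×
    (∀ z → δ u z + sm (λ d → δ (head d) z) ds ≡ sm (λ d → δ (tail d) z) ds + δ v z)
  walk-directed [] = [] , refl , λ z → +-identityʳ _
  walk-directed {u} {v} (step {w = w} {e = e} j wk) with walk-directed wk
  ... | ds , refl , h = (e , b j) ∷ ds , refl , λ z →
      trans (cong (δ u z +_) (trans (cong (λ x → δ x z + _) (hd j)) (h z)))
        (trans (sym (+-assoc (δ u z) _ _)) (cong (λ x → δ x z + _ + _) (sym (tl j))))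
    where
    b : Joins e u w → Bool
    b (inj₁ _) = true
    b (inj₂ _) = false
    hd : ∀ j → head (e , b j) ≡ w
    hd (inj₁ (_ , p)) = p
    hd (inj₂ (p , _)) = p
    tl : ∀ j → tail (e , b j) ≡ u
    tl (inj₁ (p , _)) = p
    tl (inj₂ (_ , p)) = p

  -- An Eulerian orientation: every closed walk is directed along itself.
  balanced : ∀ L → Even L → ∃ λ ds → L ↭ map proj₁ ds ×
    (∀ z → sm (λ d → δ (head d) z) ds ≡ sm (λ d → δ (tail d) z) ds)
  balanced L ev with cycles L ev
  ... | cs , p , _ with go cs
    where
    go : ∀ cs → ∃ λ ds → concatMap edgesOf cs ≡ map proj₁ ds ×
      (∀ z → sm (λ d → δ (head d) z) ds ≡ sm (λ d → δ (tail d) z) ds)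
    go [] = [] , refl , λ _ → refl
    go ((u , es , wk) ∷ cs) with walk-directed wk | go cs
    ... | ds , refl , h | ds′ , q , h′ = ds ++ ds′ , trans (cong (map proj₁ ds ++_) q) (sym (map-++ proj₁ ds ds′)) ,
      λ z → trans (sm-++ _ ds ds′) (trans (cong₂ _+_ (+-cancelˡ-≡ (δ u z) _ _ (trans (h z) (+-comm _ (δ u z)))) (h′ z)) (sym (sm-++ _ ds ds′)))
  ... | ds , q , h = ds , ↭-trans p (↭-reflexive q) , h

-- Rainbow spanning trees

¬¬-Fin : ∀ {m} {P : Fin m → Set} → (∀ i → ¬ ¬ P i) → ¬ ¬ (∀ i → P i)
¬¬-Fin {zero}  h k = k λ ()
¬¬-Fin {suc m} h k = h fz λ p → ¬¬-Fin (λ i → h (fs i)) λ q → k λ where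
  fz     → p
  (fs i) → q i

searchVec : ∀ {K} g {P : Vec (Fin K) g → Set} → (∀ σ → Dec (P σ)) → Dec (∃ P)
searchVec zero dec = map′ ([]ᵛ ,_) (λ where ([]ᵛ , p) → p) (dec []ᵛ)
searchVec (suc g) dec = map′ (λ (i , σ , p) → i ∷ᵛ σ , p) (λ where (i ∷ᵛ σ , p) → i , σ , p)
  (any? λ i → searchVec g λ σ → dec (i ∷ᵛ σ))

module _ {N : ℕ} where
  open Multigraph {N} {Fin N × Fin N} proj₁ proj₂

  -- Keep the part before the first and the part after the last use of the edge `(p , q)`; if these
  -- meet at the same end, the edge can be left out.
  path-cut : ∀ {P Q : Fin N × Fin N → Set} {p q} → (∀ e → Q e → P e ⊎ e ≡ (p , q)) → ∀ {x y} → Path Q x y →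
    Path P x y ⊎ (Path P x p × Path P q y) ⊎ (Path P x q × Path P p y)
  path-cut h [] = inj₁ []
  path-cut h (step e m j r) with h e m | path-cut h r
  ... | inj₁ pe | inj₁ a              = inj₁ (step e pe j a)
  ... | inj₁ pe | inj₂ (inj₁ (a , b)) = inj₂ (inj₁ (step e pe j a , b))
  ... | inj₁ pe | inj₂ (inj₂ (a , b)) = inj₂ (inj₂ (step e pe j a , b))
  path-cut h (step _ m (inj₁ (refl , refl)) r) | inj₂ refl | inj₁ a              = inj₂ (inj₁ ([] , a))
  path-cut h (step _ m (inj₁ (refl , refl)) r) | inj₂ refl | inj₂ (inj₁ (_ , b)) = inj₂ (inj₁ ([] , b))
  path-cut h (step _ m (inj₁ (refl , refl)) r) | inj₂ refl | inj₂ (inj₂ (_ , b)) = inj₁ b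
  path-cut h (step _ m (inj₂ (refl , refl)) r) | inj₂ refl | inj₁ a              = inj₂ (inj₂ ([] , a))
  path-cut h (step _ m (inj₂ (refl , refl)) r) | inj₂ refl | inj₂ (inj₁ (_ , b)) = inj₁ b
  path-cut h (step _ m (inj₂ (refl , refl)) r) | inj₂ refl | inj₂ (inj₂ (_ , b)) = inj₂ (inj₂ ([] , b))

  -- A numbering of the connected components of the graph with edge set `P`; by `surj`, `p` is their
  -- exact number.
  record Labelling (P : Fin N × Fin N → Set) (p : ℕ) : Set where
    field
      label : Fin N → Fin p
      surj  : ∀ ℓ → ∃ λ v → label v ≡ ℓ
      sound : ∀ {u v} → label u ≡ label v → Path P u v
      edge  : ∀ e → P e → label (proj₁ e) ≡ label (proj₂ e)

    along : ∀ {u v} → Path P u v → label u ≡ label v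
    along [] = refl
    along (step e m (inj₁ (refl , refl)) r) = trans (edge e m) (along r)
    along (step e m (inj₂ (refl , refl)) r) = trans (sym (edge e m)) (along r)

  open Labelling

  labelling-resp : ∀ {P Q p} → (∀ e → P e → Path Q (proj₁ e) (proj₂ e)) → (∀ e → Q e → Path P (proj₁ e) (proj₂ e)) →
    Labelling P p → Labelling Q p
  labelling-resp f g l = record
    { label = label l ; surj = surj l ; sound = λ eq → path-bind f (sound l eq) ; edge = λ e q → along l (g e q) }

  edge-path : ∀ {P : Fin N × Fin N → Set} e → P e → Path P (proj₁ e) (proj₂ e)
  edge-path e m = step e m (inj₁ (refl , refl)) []

  same : ∀ {P p x y} (l : Labelling P p) → label l x ≡ label l y → Labelling (λ e → P e ⊎ e ≡ (x , y)) p
  same l eq = record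
    { label = label l ; surj = surj l ; sound = λ q → path-map (λ _ → inj₁) (sound l q)
    ; edge = λ where e (inj₁ m) → edge l e m
                     _ (inj₂ refl) → eq }

  merge : ∀ {P p x y} (l : Labelling P (suc p)) → label l x ≢ label l y → Labelling (λ e → P e ⊎ e ≡ (x , y)) p
  merge {P} {p} {x} {y} l x≢y = record { label = g ∘ f ; surj = sj ; sound = λ {u} {v} → sd u v ; edge = ed }
    where
    f = label l
    y≢x : f y ≢ f x
    y≢x = x≢y ∘ sym
    -- The class of `y` takes over the label of `x`, and the label `f y` thus vacated is punched
    -- out.
    g : Fin (suc p) → Fin p
    g ℓ with f y ≟ ℓ
    ... | yes _ = punchOut y≢x
    ... | no ne = punchOut ne
    sj : ∀ ℓ → ∃ λ v → g (f v) ≡ ℓ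
    sj ℓ with surj l (punchIn (f y) ℓ)
    ... | v , eq = v , help
      where
      help : g (f v) ≡ ℓ
      help rewrite eq with f y ≟ punchIn (f y) ℓ
      ... | yes e = ⊥-elim (punchInᵢ≢i (f y) ℓ (sym e))
      ... | no ne = punchOut-punchIn (f y)
    new : Path (λ e → P e ⊎ e ≡ (x , y)) x y
    new = edge-path (x , y) (inj₂ refl)
    up : ∀ {u v} → f u ≡ f v → Path (λ e → P e ⊎ e ≡ (x , y)) u v
    up q = path-map (λ _ → inj₁) (sound l q)
    sd : ∀ u v → g (f u) ≡ g (f v) → Path (λ e → P e ⊎ e ≡ (x , y)) u v
    sd u v q with f y ≟ f u | f y ≟ f v
    ... | yes a | yes b = up (trans (sym a) b)
    ... | yes a | no b  = path-trans (up (sym a)) (path-trans (path-sym new) (up (punchOut-injective y≢x b q)))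
    ... | no a  | yes b = path-trans (up (punchOut-injective a y≢x q)) (path-trans new (up b))
    ... | no a  | no b  = up (punchOut-injective a b q)
    ed : ∀ e → P e ⊎ e ≡ (x , y) → g (f (proj₁ e)) ≡ g (f (proj₂ e))
    ed e (inj₁ m) = cong g (edge l e m)
    ed _ (inj₂ refl) with f y ≟ f x | f y ≟ f y
    ... | yes a | _     = ⊥-elim (y≢x a)
    ... | no a  | yes _ = punchOut-cong (f y) refl
    ... | no a  | no b  = ⊥-elim (b refl)

  labelling : ∀ L → ∃ λ p → Labelling (_∈ L) p
  labelling [] = N , record { label = id ; surj = λ ℓ → ℓ , refl ; sound = (λ where refl → []) ; edge = λ _ () }
  labelling ((x , y) ∷ L) with labelling L
  ... | p , l = ext p l
    where
    swp : ∀ {p} → Labelling (λ e → e ∈ L ⊎ e ≡ (x , y)) p → Labelling (_∈ (x , y) ∷ L) p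
    swp = labelling-resp (λ where e (inj₁ m) → edge-path e (there m)
                                  e (inj₂ refl) → edge-path e (here refl))
                         (λ where e (here refl) → edge-path e (inj₂ refl)
                                  e (there m) → edge-path e (inj₁ m))
    ext : ∀ p → Labelling (_∈ L) p → ∃ λ p → Labelling (_∈ (x , y) ∷ L) p
    ext zero l with label l x
    ... | ()
    ext (suc p) l with label l x ≟ label l y
    ... | yes eq = suc p , swp (same l eq)
    ... | no ne  = p , swp (merge l ne)

  -- One option is to be selected from every group so that the selected edges connect all vertices.
  -- `rich` is the partition condition of the rainbow spanning tree theorem: `p` classes need
  -- `p - 1` groups with a crossing option. `X` may be any set containing these groups.
  module Rainbow {g K : ℕ} (opt : Fin g → Fin K → Fin N × Fin N)
    (rich : ∀ p (f : Fin N → Fin p) → (∀ ℓ → ∃ λ v → f v ≡ ℓ) → (X : Fin g → Bool) →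
      (∀ γ → X γ ≡ false → ∀ k → f (proj₁ (opt γ k)) ≡ f (proj₂ (opt γ k))) → p ≤ suc (sm (ind ∘ X) (allFin g))) where

    Sel : Set
    Sel = Vec (Fin K) g

    cur : Sel → Fin g → Fin N × Fin N
    cur σ γ = opt γ (lookupᵛ σ γ)

    -- A selected edge remembers its group: two groups may select equal edges, and leaving out one
    -- group must not remove the edge of the other.
    record Chosen (σ : Sel) (Q : Fin g → Set) (e : Fin N × Fin N) : Set where
      constructor chosen
      field
        group  : Fin g
        ok     : Q group
        picked : cur σ group ≡ e

    Conn : Sel → (Fin g → Set) → Fin N → Fin N → Set
    Conn σ Q = Path (Chosen σ Q)

    Full : Fin g → Set
    Full _ = ⊤

    Ends : (Fin N → Fin N → Set) → Fin N × Fin N → Set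
    Ends R e = R (proj₁ e) (proj₂ e)

    -- The chosen edge of a free group is not a bridge, so exchanging it disconnects nothing.
    Free : Sel → Fin g → Set
    Free σ γ = Ends (Conn σ (_≢ γ)) (cur σ γ)

    -- Exchanges that keep the components: the edge given up is not a bridge and the new one joins
    -- vertices already connected.
    data Reach (σ₀ : Sel) : Sel → Set where
      base : Reach σ₀ σ₀
      next : ∀ {σ} γ k → Reach σ₀ σ → Free σ γ → Ends (Conn σ Full) (opt γ k) → Reach σ₀ (σ [ γ ]≔ k)

    weaken : ∀ {σ Q Q′ u v} → (∀ γ → Q γ → Q′ γ) → Conn σ Q u v → Conn σ Q′ u v
    weaken h = path-map λ e (chosen γ q eq) → chosen γ (h γ q) eq

    bind : ∀ {σ Q R u v} → (∀ γ → Q γ → Ends (Path R) (cur σ γ)) → Conn σ Q u v → Path R u v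
    bind h = path-bind λ where _ (chosen γ q refl) → h γ q

    single : ∀ {σ Q} γ → Q γ → Ends (Conn σ Q) (cur σ γ)
    single γ q = edge-path _ (chosen γ q refl)

    updated : ∀ σ γ k → cur (σ [ γ ]≔ k) γ ≡ opt γ k
    updated σ γ k = cong (opt γ) (lookup∘update γ σ k)

    other : ∀ σ {γ γ′} k → γ′ ≢ γ → cur (σ [ γ ]≔ k) γ′ ≡ cur σ γ′
    other σ k ne = cong (opt _) (lookup∘update′ ne σ k)

    keep : ∀ {σ γ Q u v} k → (∀ γ′ → Q γ′ → γ′ ≢ γ) → Conn σ Q u v → Conn (σ [ γ ]≔ k) Q u v
    keep {σ} k h = path-map λ e (chosen γ′ q eq) → chosen γ′ q (trans (other σ k (h γ′ q)) eq)

    unkeep : ∀ {σ γ Q u v} k → (∀ γ′ → Q γ′ → γ′ ≢ γ) → Conn (σ [ γ ]≔ k) Q u v → Conn σ Q u v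
    unkeep {σ} k h = path-map λ e (chosen γ′ q eq) → chosen γ′ q (trans (sym (other σ k (h γ′ q))) eq)

    avoid : ∀ {σ γ u v} → Free σ γ → Conn σ Full u v → Conn σ (_≢ γ) u v
    avoid {σ} {γ} fr = bind h
      where
      h : ∀ γ′ → ⊤ → Ends (Conn σ (_≢ γ)) (cur σ γ′)
      h γ′ _ with γ′ ≟ γ
      ... | yes refl = fr
      ... | no ne = single γ′ ne

    reach→ : ∀ {σ₀ σ u v} → Reach σ₀ σ → Conn σ₀ Full u v → Conn σ Full u v
    reach→ base c = c
    reach→ (next γ k r fr en) c = weaken (λ _ _ → tt) (keep k (λ _ ne → ne) (avoid fr (reach→ r c)))

    reach← : ∀ {σ₀ σ u v} → Reach σ₀ σ → Conn σ Full u v → Conn σ₀ Full u v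
    reach← base c = c
    reach← (next {σ} γ k r fr en) c = reach← r (bind h c)
      where
      h : ∀ γ′ → ⊤ → Ends (Conn σ Full) (cur (σ [ γ ]≔ k) γ′)
      h γ′ _ with γ′ ≟ γ
      ... | yes refl = subst (Ends (Conn σ Full)) (sym (updated σ γ k)) en
      ... | no ne = subst (Ends (Conn σ Full)) (sym (other σ k ne)) (single γ′ tt)

    -- The options of the groups in F form p classes, p ≤ 1 + #(groups outside F) by richness; the chosen edge of a group
    -- outside F is a bridge of every reachable selection, hence merges two classes, so that at most one class remains.
    module Stuck (σ₀ : Sel) (F : Fin g → Bool)
      (complete : ∀ γ → F γ ≡ false → ∀ σ → Reach σ₀ σ → ¬ Free σ γ)
      (witness : ∀ γ → F γ ≡ true → ∃ λ σ → Reach σ₀ σ × Free σ γ)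
      (none : ∀ σ → Reach σ₀ σ → ∀ γ → Free σ γ → ∀ k → Ends (Conn σ Full) (opt γ k)) where

      InF : Fin g → Set
      InF γ = F γ ≡ true

      F-but : Fin g → Fin g → Set
      F-but γ γ′ = InF γ′ × γ′ ≢ γ

      free⇒F : ∀ {σ γ} → Reach σ₀ σ → Free σ γ → InF γ
      free⇒F {σ} {γ} r fr with F γ in eq
      ... | true = refl
      ... | false = ⊥-elim (complete γ eq σ r fr)

      -- Groups outside `F` are removed from the connection one at a time, in the order of their
      -- indices. If the edge of such a group were indispensable, the rest of the connection and the
      -- edge of `γ` would close a cycle through it, and it would be free.
      viaFree : ∀ {σ γ} → Reach σ₀ σ → Free σ γ → Ends (Conn σ (F-but γ)) (cur σ γ)
      viaFree {σ} {γ} r fr = weaken (λ γ′ → λ where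
          (inj₁ f , ne) → f , ne
          (inj₂ b , ne) → ⊥-elim (<⇒≱ (toℕ<n γ′) b)) (go g ≤-refl)
        where
        Upto : ℕ → Fin g → Set
        Upto j γ′ = (InF γ′ ⊎ j ≤ toℕ γ′) × γ′ ≢ γ
        go : ∀ j → j ≤ g → Ends (Conn σ (Upto j)) (cur σ γ)
        go zero _ = weaken (λ _ ne → inj₂ z≤n , ne) fr
        go (suc j) j<g = goal
          where
          γⱼ = fromℕ< j<g
          prev : Ends (Conn σ (Upto j)) (cur σ γ)
          prev = go j (<⇒≤ j<g)
          bigger : ∀ γ′ → γ′ ≢ γⱼ → j ≤ toℕ γ′ → suc j ≤ toℕ γ′
          bigger γ′ ne le = ≤∧≢⇒< le λ eq → ne (toℕ-injective (trans (sym eq) (sym (toℕ-fromℕ< j<g))))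
          goal : Ends (Conn σ (Upto (suc j))) (cur σ γ)
          goal with F γⱼ in eqF
          ... | true = weaken h prev
            where
            h : ∀ γ′ → Upto j γ′ → Upto (suc j) γ′
            h γ′ (inj₁ f , ne) = inj₁ f , ne
            h γ′ (inj₂ le , ne) with γ′ ≟ γⱼ
            ... | yes refl = inj₁ eqF , ne
            ... | no n = inj₂ (bigger γ′ n le) , ne
          ... | false with path-cut h prev
            where
            h : ∀ e → Chosen σ (Upto j) e → Chosen σ (Upto (suc j)) e ⊎ e ≡ cur σ γⱼ
            h e (chosen γ′ (inj₁ f , ne) eq) = inj₁ (chosen γ′ (inj₁ f , ne) eq)
            h e (chosen γ′ (inj₂ le , ne) eq) with γ′ ≟ γⱼ
            ... | yes refl = inj₂ (sym eq)
            ... | no n = inj₁ (chosen γ′ (inj₂ (bigger γ′ n le) , ne) eq)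
          ... | inj₁ c = c
          ... | inj₂ d = ⊥-elim (complete γⱼ eqF σ r (around d))
            where
            notj : ∀ γ′ → Upto (suc j) γ′ → γ′ ≢ γⱼ
            notj γ′ (inj₁ f , _) refl with trans (sym f) eqF
            ... | ()
            notj γ′ (inj₂ le , _) refl = <⇒≢ le (sym (toℕ-fromℕ< j<g))
            here-γ : Ends (Conn σ (_≢ γⱼ)) (cur σ γ)
            here-γ = single γ λ eq → case trans (sym (free⇒F r fr)) (trans (cong F eq) eqF) of λ ()
            around : _ → Free σ γⱼ
            around (inj₁ (a , b)) = path-trans (path-sym (weaken notj a)) (path-trans here-γ (path-sym (weaken notj b)))
            around (inj₂ (a , b)) = path-trans (weaken notj b) (path-trans (path-sym here-γ) (weaken notj a))

      still-free : ∀ {σ} γ k → Free σ γ → Ends (Conn σ Full) (opt γ k) → Free (σ [ γ ]≔ k) γ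
      still-free {σ} γ k fr en = subst (Ends (Conn (σ [ γ ]≔ k) (_≢ γ))) (sym (updated σ γ k)) (keep k (λ _ ne → ne) (avoid fr en))

      -- Undo the last exchange: the new edge of `γ` is still not a bridge, so by `viaFree` its ends
      -- are joined by groups of `F` other than `γ`, and the exchange did not touch these.
      to₀ : ∀ {σ u v} → Reach σ₀ σ → Conn σ InF u v → Conn σ₀ InF u v
      to₀ base c = c
      to₀ (next {σ} γ k r fr en) c = to₀ r (bind h c)
        where
        h : ∀ γ′ → InF γ′ → Ends (Conn σ InF) (cur (σ [ γ ]≔ k) γ′)
        h γ′ f with γ′ ≟ γ
        ... | yes refl = weaken (λ _ → proj₁) (unkeep k (λ _ → proj₂) (viaFree (next γ k r fr en) (still-free γ k fr en)))
        ... | no ne = subst (Ends (Conn σ InF)) (sym (other σ k ne)) (single γ′ f)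

      -- At a reachable selection where `γ` is free, exchange its edge for option `k` and pull the
      -- connection of the new ends back to `σ₀`. Hence no group of `F` has an option between
      -- different classes, as `rich` requires.
      option : ∀ γ → InF γ → ∀ k → Ends (Conn σ₀ InF) (opt γ k)
      option γ f k with witness γ f
      ... | σ , r , fr = to₀ r′ (subst (Ends (Conn _ InF)) (updated σ γ k) (weaken (λ _ → proj₁) (viaFree r′ (still-free γ k fr en))))
        where
        en = none σ r γ fr k
        r′ = next γ k r fr en

      FreeOptions : List (Fin N × Fin N)
      FreeOptions = concatMap (λ γ → if F γ then map (opt γ) (allFin K) else []) (allFin g)

      freeOption⁺ : ∀ γ k → InF γ → opt γ k ∈ FreeOptions
      freeOption⁺ γ k f = ∈-concatMap⁺ _ (lose (∈-allFin γ) (subst (λ b → opt γ k ∈ (if b then map (opt γ) (allFin K) else [])) (sym f) (∈-map⁺ (opt γ) (∈-allFin k))))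

      freeOption⁻ : ∀ e → e ∈ FreeOptions → Ends (Conn σ₀ InF) e
      freeOption⁻ e m with find (∈-concatMap⁻ (λ γ → if F γ then map (opt γ) (allFin K) else []) {xs = allFin g} m)
      ... | γ , _ , q with F γ in eq
      ... | true with ∈-map⁻ (opt γ) q
      ... | k , _ , refl = option γ eq k

      Rigid : List (Fin g) → Fin N × Fin N → Set
      Rigid Γ e = e ∈ FreeOptions ⊎ (∃ λ γ → γ ∈ Γ × F γ ≡ false × cur σ₀ γ ≡ e)

      -- Every edge selected outside `F` merges two classes. Otherwise its ends would be connected
      -- by options of free groups, which selected edges of `F` replace, and by edges of further
      -- groups, so that its group would be free at `σ₀`.
      addRigid : ∀ {p₀} → Labelling (_∈ FreeOptions) p₀ → ∀ Γ → Unique Γ →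
        ∃ λ p → Labelling (Rigid Γ) p × p + sm (ind ∘ not ∘ F) Γ ≡ p₀
      addRigid {p₀} l [] _ = p₀ , labelling-resp (λ e m → edge-path e (inj₁ m)) (λ where e (inj₁ m) → edge-path e m) l , +-identityʳ p₀
      addRigid l (γ ∷ Γ) (fresh ∷ u) with addRigid l Γ u
      ... | p , l′ , eq with F γ in eqF
      ... | true = p , labelling-resp old back l′ , eq
        where
        old : ∀ e → Rigid Γ e → Ends (Path (Rigid (γ ∷ Γ))) e
        old e (inj₁ m) = edge-path e (inj₁ m)
        old e (inj₂ (γ′ , m , q)) = edge-path e (inj₂ (γ′ , there m , q))
        back : ∀ e → Rigid (γ ∷ Γ) e → Ends (Path (Rigid Γ)) e
        back e (inj₁ m) = edge-path e (inj₁ m)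
        back e (inj₂ (γ′ , there m , q)) = edge-path e (inj₂ (γ′ , m , q))
        back e (inj₂ (_ , here refl , q , _)) with trans (sym q) eqF
        ... | ()
      ... | false = addOne p l′ eq
        where
        x = proj₁ (cur σ₀ γ)
        y = proj₂ (cur σ₀ γ)
        old : ∀ e → Rigid Γ e ⊎ e ≡ (x , y) → Ends (Path (Rigid (γ ∷ Γ))) e
        old e (inj₁ (inj₁ m)) = edge-path e (inj₁ m)
        old e (inj₁ (inj₂ (γ′ , m , q))) = edge-path e (inj₂ (γ′ , there m , q))
        old e (inj₂ refl) = edge-path e (inj₂ (γ , here refl , eqF , refl))
        back : ∀ e → Rigid (γ ∷ Γ) e → Ends (Path (λ e → Rigid Γ e ⊎ e ≡ (x , y))) e
        back e (inj₁ m) = edge-path e (inj₁ (inj₁ m))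
        back e (inj₂ (γ′ , there m , q)) = edge-path e (inj₁ (inj₂ (γ′ , m , q)))
        back e (inj₂ (_ , here refl , _ , q)) = edge-path e (inj₂ (sym q))
        bridge : ¬ Path (Rigid Γ) x y
        bridge c = complete γ eqF σ₀ base (path-bind h c)
          where
          h : ∀ e → Rigid Γ e → Ends (Conn σ₀ (_≢ γ)) e
          h e (inj₁ m) = weaken (λ γ′ f γ≡ → case trans (sym f) (trans (cong F γ≡) eqF) of λ ()) (freeOption⁻ e m)
          h e (inj₂ (γ′ , m , _ , refl)) = single γ′ λ eq → All.lookup fresh m (sym eq)
        addOne : ∀ {p₀} p → Labelling (Rigid Γ) p → p + sm (ind ∘ not ∘ F) Γ ≡ p₀ →
          ∃ λ p → Labelling (Rigid (γ ∷ Γ)) p × p + suc (sm (ind ∘ not ∘ F) Γ) ≡ p₀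
        addOne zero l _ with label l x
        ... | ()
        addOne (suc p) l eq = p , labelling-resp old back (merge l (bridge ∘ sound l)) , trans (+-suc p _) eq

      connected : ∀ u v → Conn σ₀ Full u v
      connected u v with labelling FreeOptions
      ... | p₀ , l with addRigid l (allFin g) (allFin⁺ g)
      ... | p , l′ , eq = path-bind h (sound l′ (unique p≤1 (label l′ u) (label l′ v)))
        where
        p≤1 : p ≤ 1
        p≤1 = +-cancelʳ-≤ (sm (ind ∘ not ∘ F) (allFin g)) p 1 (≤-trans (≤-reflexive eq)
          (rich p₀ (label l) (surj l) (not ∘ F) λ γ x k → edge l _ (freeOption⁺ γ k (not-false x))))
          where
          not-false : ∀ {b} → not b ≡ false → b ≡ true
          not-false {true} _ = refl
        unique : ∀ {p} → p ≤ 1 → (a b : Fin p) → a ≡ b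
        unique (s≤s z≤n) fz fz = refl
        h : ∀ e → Rigid (allFin g) e → Ends (Conn σ₀ Full) e
        h e (inj₁ m) = weaken (λ _ _ → tt) (freeOption⁻ e m)
        h e (inj₂ (γ , _ , _ , refl)) = single γ tt

    Spanning : Sel → Set
    Spanning σ = ∀ u v → Conn σ Full u v

    labelSel : ∀ σ → ∃ λ p → Labelling (Chosen σ Full) p
    labelSel σ with labelling (map (cur σ) (allFin g))
    ... | p , l = p , labelling-resp
      (λ e m → case ∈-map⁻ (cur σ) m of λ where (γ , _ , refl) → single γ tt)
      (λ where _ (chosen γ _ refl) → edge-path _ (∈-map⁺ (cur σ) (∈-allFin γ))) l

    -- If at some reachable selection a free group has an option between two components, taking it
    -- lowers their number. Otherwise `Stuck` applies with `F` the groups that are free at some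
    -- reachable selection; deciding membership in `F` is what calls for the double negation.
    improve : ∀ p σ₀ → Labelling (Chosen σ₀ Full) p → ¬ ¬ ∃ Spanning
    improve zero σ₀ l k = k (σ₀ , λ u v → case label l u of λ ())
    improve (suc p) σ₀ l k = ¬¬-Fin {P = λ γ → Dec (∃ λ σ → Reach σ₀ σ × Free σ γ)} (λ γ → ¬¬-excluded-middle) λ dec →
      k (σ₀ , Stuck.connected σ₀ (λ γ → does (dec γ))
        (λ γ eq σ r fr → no≢ (dec γ) eq (σ , r , fr)) (λ γ eq → yes≡ (dec γ) eq) none)
      where
      no≢ : ∀ {A : Set} (d : Dec A) → does d ≡ false → ¬ A
      no≢ (no n) _ = n
      yes≡ : ∀ {A : Set} (d : Dec A) → does d ≡ true → A
      yes≡ (yes a) _ = a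
      none : ∀ σ → Reach σ₀ σ → ∀ γ → Free σ γ → ∀ i → Ends (Conn σ Full) (opt γ i)
      none σ r γ fr i with label l (proj₁ (opt γ i)) ≟ label l (proj₂ (opt γ i))
      ... | yes eq = reach→ r (sound l eq)
      ... | no ne = ⊥-elim (improve p (σ [ γ ]≔ i) (labelling-resp f b (merge l ne)) k)
        where
        f : ∀ e → Chosen σ₀ Full e ⊎ e ≡ opt γ i → Ends (Conn (σ [ γ ]≔ i) Full) e
        f e (inj₁ m) = weaken (λ _ _ → tt) (keep i (λ _ x → x) (avoid fr (reach→ r (edge-path e m))))
        f e (inj₂ refl) = subst (Ends (Conn _ Full)) (updated σ γ i) (single γ tt)
        b : ∀ e → Chosen (σ [ γ ]≔ i) Full e → Ends (Path (λ e → Chosen σ₀ Full e ⊎ e ≡ opt γ i)) e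
        b e (chosen γ′ _ refl) with γ′ ≟ γ
        ... | yes refl = edge-path _ (inj₂ (updated σ γ i))
        ... | no n = subst (Ends (Path _)) (sym (other σ i n)) (path-map (λ _ → inj₁) (reach← r (single γ′ tt)))

    spanning? : ∀ σ → Dec (Spanning σ)
    spanning? σ with labelSel σ
    ... | p , l = map′ (λ h u v → sound l (h u v)) (λ h u v → along l (h u v)) (all? λ u → all? λ v → label l u ≟ label l v)

    -- The double negation is removed by search: there are finitely many selections and `Spanning`
    -- is decidable. `k₀` only fills the initial selection.
    rainbow : Fin K → ∃ Spanning
    rainbow k₀ = decidable-stable (searchVec g spanning?)
      (improve _ (replicate g k₀) (proj₂ (labelSel (replicate g k₀))))

-- Packing spanning trees with few edges at each vertex of A

concatMap-↭ : ∀ {A B : Set} {f g : A → List B} → (∀ x → f x ↭ g x) → ∀ xs → concatMap f xs ↭ concatMap g xs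
concatMap-↭ h []       = refl
concatMap-↭ h (x ∷ xs) = ++⁺ (h x) (concatMap-↭ h xs)

interleave : ∀ {A : Set} (as bs cs ds : List A) → (as ++ bs) ++ (cs ++ ds) ↭ (as ++ cs) ++ (bs ++ ds)
interleave as bs cs ds = ↭-trans (↭-reflexive (++-assoc as bs (cs ++ ds)))
  (↭-trans (++⁺ˡ as (↭-trans (↭-reflexive (sym (++-assoc bs cs ds)))
    (↭-trans (++⁺ʳ ds (++-comm bs cs)) (↭-reflexive (++-assoc cs bs ds)))))
    (↭-reflexive (sym (++-assoc as cs (bs ++ ds)))))

concatMap-split : ∀ {A B : Set} (f g : A → List B) xs → concatMap (λ x → f x ++ g x) xs ↭ concatMap f xs ++ concatMap g xs
concatMap-split f g []       = refl
concatMap-split f g (x ∷ xs) = ↭-trans (++⁺ˡ (f x ++ g x) (concatMap-split f g xs)) (interleave (f x) (g x) _ _)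

concatMap-[] : ∀ {A B : Set} {f : A → List B} xs → (∀ x → f x ≡ []) → concatMap f xs ≡ []
concatMap-[] []       h = refl
concatMap-[] (x ∷ xs) h rewrite h x = concatMap-[] xs h

concatMap-concatMap : ∀ {A B C : Set} (f : B → List C) (g : A → List B) xs → concatMap f (concatMap g xs) ≡ concatMap (concatMap f ∘ g) xs
concatMap-concatMap f g []       = refl
concatMap-concatMap f g (x ∷ xs) = trans (concatMap-++ f (g x) (concatMap g xs)) (cong (concatMap f (g x) ++_) (concatMap-concatMap f g xs))

concatMap-allFin : ∀ {m} {A : Set} (F : Fin (suc m) → List A) → concatMap F (allFin (suc m)) ≡ F fz ++ concatMap (F ∘ fs) (allFin m)
concatMap-allFin {m} F = cong (F fz ++_) (trans (cong (concatMap F) (sym (map-tabulate id fs))) (concatMap-map F fs (allFin m)))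

at-key : ∀ {m} {A : Set} (k : Fin m) (val : Fin m → A) →
  concatMap (λ i → if ⌊ k ≟ i ⌋ then val i ∷ [] else []) (allFin m) ≡ val k ∷ []
at-key {suc m} fz val = trans (concatMap-allFin (λ i → if ⌊ fz ≟ i ⌋ then val i ∷ [] else []))
  (cong (val fz ∷_) (concatMap-[] {f = λ _ → []} (allFin m) (λ _ → refl)))
at-key {suc m} (fs k) val = trans (concatMap-allFin (λ i → if ⌊ fs k ≟ i ⌋ then val i ∷ [] else []))
  (trans (lem (allFin m)) (at-key k (val ∘ fs)))
  where
  lem : ∀ xs → concatMap (λ i → if ⌊ fs k ≟ fs i ⌋ then val (fs i) ∷ [] else []) xs ≡ concatMap (λ i → if ⌊ k ≟ i ⌋ then val (fs i) ∷ [] else []) xs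
  lem [] = refl
  lem (i ∷ xs) with k ≟ i
  ... | yes _ = cong (val (fs i) ∷_) (lem xs)
  ... | no _ = lem xs

-- `val` receives the index `i` instead of `key x`, so that the entries of bucket `i` mention `i`
-- literally.
bucket : ∀ {m} {X A : Set} (key : X → Fin m) (val : Fin m → X → A) → List X → Fin m → List A
bucket key val xs i = concatMap (λ x → if ⌊ key x ≟ i ⌋ then val i x ∷ [] else []) xs

buckets : ∀ {m} {X A : Set} (key : X → Fin m) (val : Fin m → X → A) xs →
  concatMap (bucket key val xs) (allFin m) ↭ map (λ x → val (key x) x) xs
buckets {m} key val [] = ↭-reflexive (concatMap-[] {f = λ _ → []} (allFin m) (λ _ → refl))
buckets {m} key val (x ∷ xs) = ↭-trans (concatMap-split (λ i → if ⌊ key x ≟ i ⌋ then val i x ∷ [] else []) (bucket key val xs) (allFin m))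
  (++⁺ (↭-reflexive (at-key (key x) (λ i → val i x))) (buckets key val xs))

sm-bucket : ∀ {m} {X A : Set} (key : X → Fin m) (val : Fin m → X → A) xs i → length (bucket key val xs i) ≡ sm (λ x → δ (key x) i) xs
sm-bucket key val [] i = refl
sm-bucket key val (x ∷ xs) i with key x ≟ i
... | yes _ = cong suc (sm-bucket key val xs i)
... | no _ = sm-bucket key val xs i

map-lookup : ∀ {A : Set} (xs : List A) → map (lookup xs) (allFin (length xs)) ≡ xs
map-lookup xs = trans (map-tabulate id (lookup xs)) (tabulate-lookup xs)

module _ {n : ℕ} where

  -- The first component of an edge is its end in A, the second its end in B.
  degA degB : Fin n → List (Fin n × Fin n) → ℕ
  degA a = sm (λ e → δ (proj₁ e) a)
  degB b = sm (λ e → δ (proj₂ e) b)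

  open Multigraph {n} {Fin n × Fin n} proj₁ proj₂ using (Path)

  Spans : List (Fin n × Fin n) → Set
  Spans T = ∀ u v → Path (_∈ T) u v

module Trees {n′ : ℕ} where

  n : ℕ
  n = suc n′

  Edge : Set
  Edge = Fin n × Fin n

  open Multigraph {n} {Edge} proj₁ proj₂ using (Path; []; step)

  data Group : Set where
    one   : (a b : Fin n) → Group
    two   : (a b b′ : Fin n) → Group
    three : (a b b′ b″ : Fin n) → Group

  centre : Group → Fin n
  centre (one a _)       = a
  centre (two a _ _)     = a
  centre (three a _ _ _) = a

  members : Group → List Edge
  members (one a b)         = (a , b) ∷ []
  members (two a b b′)      = (a , b) ∷ (a , b′) ∷ []
  members (three a b b′ b″) = (a , b) ∷ (a , b′) ∷ (a , b″) ∷ []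

  -- Small groups repeat an edge in the surplus slots, which gives every group the same number of
  -- options.
  draw : Group → Fin 3 → Edge × List Edge
  draw (one a b)         _           = (a , b) , []
  draw (two a b b′)      fz          = (a , b) , (a , b′) ∷ []
  draw (two a b b′)      (fs _)      = (a , b′) , (a , b) ∷ []
  draw (three a b b′ b″) fz          = (a , b) , (a , b′) ∷ (a , b″) ∷ []
  draw (three a b b′ b″) (fs fz)     = (a , b′) , (a , b) ∷ (a , b″) ∷ []
  draw (three a b b′ b″) (fs (fs _)) = (a , b″) , (a , b) ∷ (a , b′) ∷ []

  draw-↭ : ∀ γ j → members γ ↭ proj₁ (draw γ j) ∷ proj₂ (draw γ j)
  draw-↭ (one a b) _ = refl
  draw-↭ (two a b b′) fz = refl
  draw-↭ (two a b b′) (fs j) = pswap _ _ refl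
  draw-↭ (three a b b′ b″) fz = refl
  draw-↭ (three a b b′ b″) (fs fz) = pswap _ _ refl
  draw-↭ (three a b b′ b″) (fs (fs j)) = ptrans (prep _ (pswap _ _ refl)) (pswap _ _ refl)

  draw-centre : ∀ γ j → proj₁ (proj₁ (draw γ j)) ≡ centre γ
  draw-centre (one a b) _ = refl
  draw-centre (two a b b′) fz = refl
  draw-centre (two a b b′) (fs j) = refl
  draw-centre (three a b b′ b″) fz = refl
  draw-centre (three a b b′ b″) (fs fz) = refl
  draw-centre (three a b b′ b″) (fs (fs j)) = refl

  chunk : Fin n → List (Fin n) → List Group
  chunk a [] = []
  chunk a (b ∷ []) = one a b ∷ []
  chunk a (b ∷ b′ ∷ []) = two a b b′ ∷ []
  chunk a (b ∷ b′ ∷ b″ ∷ bs) = three a b b′ b″ ∷ chunk a bs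

  chunk-members : ∀ a bs → concatMap members (chunk a bs) ≡ map (a ,_) bs
  chunk-members a [] = refl
  chunk-members a (b ∷ []) = refl
  chunk-members a (b ∷ b′ ∷ []) = refl
  chunk-members a (b ∷ b′ ∷ b″ ∷ bs) = cong (λ z → _ ∷ _ ∷ _ ∷ z) (chunk-members a bs)

  chunk-length : ∀ a bs → 3 * length (chunk a bs) ≤ length bs + 2
  chunk-length a [] = z≤n
  chunk-length a (b ∷ []) = s≤s (s≤s (s≤s z≤n))
  chunk-length a (b ∷ b′ ∷ []) = s≤s (s≤s (s≤s z≤n))
  chunk-length a (b ∷ b′ ∷ b″ ∷ bs) = ≤-trans (≤-reflexive (*-suc 3 (length (chunk a bs)))) (s≤s (s≤s (s≤s (chunk-length a bs))))

  chunk-centre : ∀ a bs x → sm (λ γ → δ (centre γ) x) (chunk a bs) ≡ δ a x * length (chunk a bs)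
  chunk-centre a bs x = trans (go bs) (trans (sm-const (δ a x) (chunk a bs)) (*-comm (length (chunk a bs)) _))
    where
    go : ∀ bs → sm (λ γ → δ (centre γ) x) (chunk a bs) ≡ sm (λ _ → δ a x) (chunk a bs)
    go [] = refl
    go (b ∷ []) = refl
    go (b ∷ b′ ∷ []) = refl
    go (b ∷ b′ ∷ b″ ∷ bs) = cong (δ a x +_) (go bs)

  cross : (Fin n → Bool) → List Edge → ℕ
  cross S = sm (λ e → ind (S (proj₁ e) xor S (proj₂ e)))

  -- The 2 in `thin` comes from rounding up: a vertex of degree d is the centre of ⌈d/3⌉ groups, and
  -- each of them supplies one edge.
  record Packing (L : ℕ) (E : List Edge) : Set where
    field
      T         : Fin L → List Edge
      Rest      : List Edge
      partition : E ↭ concatMap T (allFin L) ++ Rest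
      thin      : ∀ a → 3 * degA a (concatMap T (allFin L)) ≤ degA a E + 2
      spans     : ∀ i → Spans (T i)

  module Pack (L : ℕ) (i₀ : Fin L) (E : List Edge) (cut : ∀ S u v → S u ≡ true → S v ≡ false → L * 6 ≤ cross S E) where

    nbrs : Fin n → List (Fin n)
    nbrs = bucket proj₁ (λ _ → proj₂) E

    gs : List Group
    gs = concatMap (λ a → chunk a (nbrs a)) (allFin n)

    gs-↭ : concatMap members gs ↭ E
    gs-↭ = ↭-trans (↭-reflexive (concatMap-concatMap members (λ a → chunk a (nbrs a)) (allFin n)))
      (↭-trans (concatMap-↭ (λ a → ↭-reflexive (trans (chunk-members a (nbrs a)) (lem a E))) (allFin n))
        (↭-trans (buckets proj₁ (λ a e → a , proj₂ e) E) (↭-reflexive (map-id E))))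
      where
      lem : ∀ a L → map (a ,_) (bucket proj₁ (λ _ → proj₂) L a) ≡ bucket proj₁ (λ a e → a , proj₂ e) L a
      lem a [] = refl
      lem a (e ∷ L) with proj₁ e ≟ a
      ... | yes _ = cong (_ ∷_) (lem a L)
      ... | no _ = lem a L

    centres : ∀ a → sm (λ γ → δ (centre γ) a) gs ≡ length (chunk a (nbrs a))
    centres a = trans (sm-concatMap _ (λ a → chunk a (nbrs a)) (allFin n))
      (trans (sm-cong (λ x → trans (chunk-centre x (nbrs x) a) (cong (_* length (chunk x (nbrs x))) (δ-sym x a))) (allFin n))
        (sm-δ a (λ x → length (chunk x (nbrs x)))))
      where
      δ-sym : ∀ (x y : Fin n) → δ x y ≡ δ y x
      δ-sym x y with x ≟ y | y ≟ x
      ... | yes _ | yes _ = refl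
      ... | no _  | no _  = refl
      ... | yes p | no q  = ⊥-elim (q (sym p))
      ... | no p  | yes q = ⊥-elim (p (sym q))

    N : ℕ
    N = suc (L * n′)

    -- L copies of the vertex set, glued at the vertex 0.
    φ : Fin L → Fin n → Fin N
    φ i fz     = fz
    φ i (fs v) = fs (combine i v)

    home : Fin L → Fin L × Fin n′ → Fin n
    home i (j , v) = if ⌊ j ≟ i ⌋ then fs v else fz

    -- The retraction onto copy `i`: all other copies collapse to the glued vertex. It maps a
    -- connection in the glued graph to one that uses only the edges selected in copy `i`, so every
    -- `T i` spans.
    ρ : Fin L → Fin N → Fin n
    ρ i fz     = fz
    ρ i (fs w) = home i (remQuot n′ w)

    ρφ : ∀ i v → ρ i (φ i v) ≡ v
    ρφ i fz = refl
    ρφ i (fs v) = trans (cong (home i) (remQuot-combine i v)) lem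
      where
      lem : home i (i , v) ≡ fs v
      lem with i ≟ i
      ... | yes _ = refl
      ... | no p  = ⊥-elim (p refl)

    ρφ≢ : ∀ {i j} v → j ≢ i → ρ i (φ j v) ≡ fz
    ρφ≢ fz _ = refl
    ρφ≢ {i} {j} (fs v) ne = trans (cong (home i) (remQuot-combine j v)) lem
      where
      lem : home i (j , v) ≡ fz
      lem with j ≟ i
      ... | yes p = ⊥-elim (ne p)
      ... | no _  = refl

    g : ℕ
    g = length gs

    layer : Fin (L * 3) → Fin L
    layer k = proj₁ (remQuot {L} 3 k)

    slot : Fin (L * 3) → Fin 3
    slot k = proj₂ (remQuot {L} 3 k)

    drawn : Fin g → Fin (L * 3) → Edge
    drawn γ k = proj₁ (draw (lookup gs γ) (slot k))

    left : Fin g → Fin (L * 3) → List Edge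
    left γ k = proj₂ (draw (lookup gs γ) (slot k))

    -- An option of a group is a copy together with one of its edges. Selecting a single option per
    -- group makes the trees of different copies disjoint and thin.
    opt : Fin g → Fin (L * 3) → Fin N × Fin N
    opt γ k = φ (layer k) (proj₁ (drawn γ k)) , φ (layer k) (proj₂ (drawn γ k))

    member-drawn : ∀ γ e → e ∈ members γ → ∃ λ j → e ≡ proj₁ (draw γ j)
    member-drawn (one a b) e (here p) = fz , p
    member-drawn (two a b b′) e (here p) = fz , p
    member-drawn (two a b b′) e (there (here p)) = fs fz , p
    member-drawn (three a b b′ b″) e (here p) = fz , p
    member-drawn (three a b b′ b″) e (there (here p)) = fs fz , p
    member-drawn (three a b b′ b″) e (there (there (here p))) = fs (fs fz) , p

    members≤3 : ∀ γ (f : Edge → ℕ) → (∀ e → e ∈ members γ → f e ≤ 1) → sm f (members γ) ≤ 3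
    members≤3 γ f h = ≤-trans (sm-mono (members γ) h) (≤-trans (≤-reflexive (trans (sm-const 1 (members γ)) (*-identityʳ _))) (len γ))
      where
      len : ∀ γ → length (members γ) ≤ 3
      len (one a b) = s≤s z≤n
      len (two a b b′) = s≤s (s≤s z≤n)
      len (three a b b′ b″) = s≤s (s≤s (s≤s z≤n))

    module _ (p : ℕ) (f : Fin N → Fin p) (onto : ∀ ℓ → ∃ λ v → f v ≡ ℓ) (X : Fin g → Bool)
      (flat : ∀ γ → X γ ≡ false → ∀ k → f (proj₁ (opt γ k)) ≡ f (proj₂ (opt γ k))) where

      ℓ₀ : Fin p
      ℓ₀ = f fz

      -- The class of the glued vertex is excluded: any other class that meets copy `i` is separated
      -- there from vertex 0, so the hypothesis on cuts applies to it.
      meets : Fin L → Fin p → Bool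
      meets i ℓ = ⌊ any? (λ v → f (φ i v) ≟ ℓ) ⌋ ∧ not ⌊ ℓ₀ ≟ ℓ ⌋

      dec-true : {A : Set} (d : Dec A) → A → ⌊ d ⌋ ≡ true
      dec-true (yes _) _ = refl
      dec-true (no n) a  = ⊥-elim (n a)

      dec-false : {A : Set} (d : Dec A) → ¬ A → ⌊ d ⌋ ≡ false
      dec-false (yes a) n = ⊥-elim (n a)
      dec-false (no _) _  = refl

      side : Fin L → Fin p → Fin n → Bool
      side i ℓ v = ⌊ f (φ i v) ≟ ℓ ⌋

      differ : Fin L → Edge → ℕ
      differ i e = ind (not ⌊ f (φ i (proj₁ e)) ≟ f (φ i (proj₂ e)) ⌋)

      total : ℕ
      total = sm (ind ∘ X) (allFin g)

      meets-cut : ∀ i ℓ → (L * 6) * ind (meets i ℓ) ≤ cross (side i ℓ) E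
      meets-cut i ℓ = go (any? (λ v → f (φ i v) ≟ ℓ)) (ℓ₀ ≟ ℓ)
        where
        go : (d : Dec (∃ λ v → f (φ i v) ≡ ℓ)) (d′ : Dec (ℓ₀ ≡ ℓ)) → (L * 6) * ind (⌊ d ⌋ ∧ not ⌊ d′ ⌋) ≤ cross (side i ℓ) E
        go (no _)        _       = ≤-trans (≤-reflexive (*-zeroʳ (L * 6))) z≤n
        go (yes _)       (yes _) = ≤-trans (≤-reflexive (*-zeroʳ (L * 6))) z≤n
        go (yes (v , q)) (no ne) = ≤-trans (≤-reflexive (*-identityʳ (L * 6)))
          (cut (side i ℓ) v fz (dec-true (f (φ i v) ≟ ℓ) q) (dec-false (ℓ₀ ≟ ℓ) ne))

      side-sum : ∀ i e → sm (λ ℓ → ind (side i ℓ (proj₁ e) xor side i ℓ (proj₂ e))) (allFin p) ≤ 2 * differ i e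
      side-sum i (a , b) with f (φ i a) ≟ f (φ i b)
      ... | yes q = ≤-reflexive (sm-0 (allFin p) λ ℓ _ → trans (cong (λ x → ind (⌊ f (φ i a) ≟ ℓ ⌋ xor ⌊ x ≟ ℓ ⌋)) (sym q)) (cong ind (xor-same ⌊ f (φ i a) ≟ ℓ ⌋)))
      ... | no _ = ≤-trans (sm-mono (allFin p) λ ℓ _ → xor≤ ⌊ f (φ i a) ≟ ℓ ⌋ ⌊ f (φ i b) ≟ ℓ ⌋)
          (≤-reflexive (trans (sm-+ (δ (f (φ i a))) (δ (f (φ i b))) (allFin p)) (cong₂ _+_ (sm-δ1 (f (φ i a))) (sm-δ1 (f (φ i b))))))
        where
        xor≤ : ∀ x y → ind (x xor y) ≤ ind x + ind y
        xor≤ true true = z≤n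
        xor≤ true false = ≤-refl
        xor≤ false true = ≤-refl
        xor≤ false false = z≤n

      differ-group : ∀ i γ → sm (differ i) (members (lookup gs γ)) ≤ 3 * ind (X γ)
      differ-group i γ with X γ in eq
      ... | true = members≤3 (lookup gs γ) (differ i) λ e _ → ind≤1 (not ⌊ f (φ i (proj₁ e)) ≟ f (φ i (proj₂ e)) ⌋)
        where
        ind≤1 : ∀ b → ind b ≤ 1
        ind≤1 true = ≤-refl
        ind≤1 false = z≤n
      ... | false = ≤-reflexive (sm-0 (members (lookup gs γ)) zero-differ)
        where
        zero-differ : ∀ e → e ∈ members (lookup gs γ) → differ i e ≡ 0
        zero-differ e m with member-drawn (lookup gs γ) e m
        ... | j , refl with f (φ i (proj₁ e)) ≟ f (φ i (proj₂ e))
        ... | yes _ = refl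
        ... | no ne = ⊥-elim (ne (subst (λ x → f (φ (proj₁ x) (proj₁ (proj₁ (draw (lookup gs γ) (proj₂ x))))) ≡ f (φ (proj₁ x) (proj₂ (proj₁ (draw (lookup gs γ) (proj₂ x))))))
                (remQuot-combine i j) (flat γ eq (combine i j))))

      differ-total : ∀ i → sm (differ i) E ≤ 3 * total
      differ-total i = ≤-trans (≤-reflexive (trans (sym (sm-↭ (differ i) gs-↭))
          (trans (cong (sm (differ i)) (cong (concatMap members) (sym (map-lookup gs))))
            (trans (cong (sm (differ i)) (concatMap-map members (lookup gs) (allFin g)))
              (sm-concatMap (differ i) (members ∘ lookup gs) (allFin g))))))
        (≤-trans (sm-mono (allFin g) (λ γ _ → differ-group i γ)) (≤-reflexive (sm-*ˡ 3 (ind ∘ X) (allFin g))))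

      -- Double counting of the pairs of a class and an edge leaving it in copy `i`. A class
      -- contributes at least 6L pairs, an edge at most two, and a group in `X` at most three edges;
      -- the factor 6 = 2 · 3 cancels.
      per-layer : ∀ i → L * sm (λ ℓ → ind (meets i ℓ)) (allFin p) ≤ total
      per-layer i = *-cancelˡ-≤ 6 (begin
        6 * (L * h)                                            ≡⟨ lem h ⟩
        (L * 6) * h                                                 ≡⟨ sm-*ˡ (L * 6) (λ ℓ → ind (meets i ℓ)) (allFin p) ⟨
        sm (λ ℓ → (L * 6) * ind (meets i ℓ)) (allFin p)             ≤⟨ sm-mono (allFin p) (λ ℓ _ → meets-cut i ℓ) ⟩
        sm (λ ℓ → cross (side i ℓ) E) (allFin p)               ≡⟨ sm-swap (λ ℓ e → ind (side i ℓ (proj₁ e) xor side i ℓ (proj₂ e))) (allFin p) E ⟩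
        sm (λ e → sm (λ ℓ → ind (side i ℓ (proj₁ e) xor side i ℓ (proj₂ e))) (allFin p)) E ≤⟨ sm-mono E (λ e _ → side-sum i e) ⟩
        sm (λ e → 2 * differ i e) E                            ≡⟨ sm-*ˡ 2 (differ i) E ⟩
        2 * sm (differ i) E                                    ≤⟨ *-monoʳ-≤ 2 (differ-total i) ⟩
        2 * (3 * total)                                        ≡⟨ lem′ total ⟩
        6 * total                                              ∎)
        where
        open ≤-Reasoning
        h = sm (λ ℓ → ind (meets i ℓ)) (allFin p)
        lem : ∀ h → 6 * (L * h) ≡ (L * 6) * h
        lem h = trans (sym (*-assoc 6 L h)) (cong (_* h) (*-comm 6 L))
        lem′ : ∀ h → 2 * (3 * h) ≡ 6 * h
        lem′ = solve-∀

      covered : ∀ ℓ → 1 ≤ δ ℓ₀ ℓ + sm (λ i → ind (meets i ℓ)) (allFin L)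
      covered ℓ = go (ℓ₀ ≟ ℓ) (onto ℓ)
        where
        go : Dec (ℓ₀ ≡ ℓ) → (∃ λ v → f v ≡ ℓ) → 1 ≤ δ ℓ₀ ℓ + sm (λ i → ind (meets i ℓ)) (allFin L)
        go (yes q) _ = ≤-trans (≤-reflexive (sym (δ-≡ q))) (m≤m+n _ _)
        go (no ne) (fz , q) = ⊥-elim (ne q)
        go (no ne) (fs w , q) = ≤-trans (≤-trans (≤-reflexive (sym hit)) (sm-∈ (λ i → ind (meets i ℓ)) (∈-allFin i))) (m≤n+m _ (δ ℓ₀ ℓ))
          where
          i = proj₁ (remQuot {L} n′ w)
          v = proj₂ (remQuot {L} n′ w)
          hit : ind (meets i ℓ) ≡ 1
          hit = cong₂ (λ x y → ind (x ∧ not y))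
            (dec-true (any? (λ v → f (φ i v) ≟ ℓ)) (fs v , trans (cong (f ∘ fs) (combine-remQuot {L} n′ w)) q))
            (dec-false (ℓ₀ ≟ ℓ) ne)

      -- Every class but that of the glued vertex meets some copy, so `p - 1` is at most the sum of
      -- the `L` counts, each of which is at most `total / L`.
      rich : p ≤ suc total
      rich = begin
        p                                                           ≡⟨ sm-one ⟨
        sm (λ _ → 1) (allFin p)                                     ≤⟨ sm-mono (allFin p) (λ ℓ _ → covered ℓ) ⟩
        sm (λ ℓ → δ ℓ₀ ℓ + sm (λ i → ind (meets i ℓ)) (allFin L)) (allFin p)
          ≡⟨ sm-+ (δ ℓ₀) (λ ℓ → sm (λ i → ind (meets i ℓ)) (allFin L)) (allFin p) ⟩
        sm (δ ℓ₀) (allFin p) + sm (λ ℓ → sm (λ i → ind (meets i ℓ)) (allFin L)) (allFin p)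
          ≡⟨ cong₂ _+_ (sm-δ1 ℓ₀) (sm-swap (λ ℓ i → ind (meets i ℓ)) (allFin p) (allFin L)) ⟩
        suc (sm (λ i → sm (λ ℓ → ind (meets i ℓ)) (allFin p)) (allFin L)) ≤⟨ s≤s bound ⟩
        suc total ∎
        where
        open ≤-Reasoning
        sm-one : sm (λ _ → 1) (allFin p) ≡ p
        sm-one = trans (sm-const 1 (allFin p)) (trans (*-identityʳ _) (length-tabulate {n = p} id))
        bound : sm (λ i → sm (λ ℓ → ind (meets i ℓ)) (allFin p)) (allFin L) ≤ total
        bound = *-cancelˡ-≤ L {{>-nonZero (≤-trans (s≤s z≤n) (toℕ<n i₀))}} (≤-trans (≤-reflexive (sym (sm-*ˡ L (λ i → sm (λ ℓ → ind (meets i ℓ)) (allFin p)) (allFin L))))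
          (≤-trans (sm-mono (allFin L) (λ i _ → per-layer i)) (≤-reflexive (trans (sm-const total (allFin L)) (cong (_* total) (length-tabulate {n = L} id))))))

    module R = Rainbow opt rich

    module Extract (τ : R.Sel) (spanning : R.Spanning τ) where

      σ : Fin g → Fin (L * 3)
      σ = lookupᵛ τ

      T : Fin L → List Edge
      T = bucket (layer ∘ σ) (λ _ γ → drawn γ (σ γ)) (allFin g)

      Rest : List Edge
      Rest = concatMap (λ γ → left γ (σ γ)) (allFin g)

      T-all : concatMap T (allFin L) ↭ map (λ γ → drawn γ (σ γ)) (allFin g)
      T-all = buckets (layer ∘ σ) (λ _ γ → drawn γ (σ γ)) (allFin g)

      T-partition : E ↭ concatMap T (allFin L) ++ Rest
      T-partition = ↭-trans (↭-sym gs-↭) (↭-trans (↭-reflexive (trans (cong (concatMap members) (sym (map-lookup gs))) (concatMap-map members (lookup gs) (allFin g))))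
        (↭-trans (go (allFin g)) (++⁺ʳ Rest (↭-sym T-all))))
        where
        go : ∀ Γ → concatMap (members ∘ lookup gs) Γ ↭ map (λ γ → drawn γ (σ γ)) Γ ++ concatMap (λ γ → left γ (σ γ)) Γ
        go [] = refl
        go (γ ∷ Γ) = ↭-trans (++⁺ (draw-↭ (lookup gs γ) (slot (σ γ))) (go Γ))
          (interleave (drawn γ (σ γ) ∷ []) (left γ (σ γ)) (map (λ γ → drawn γ (σ γ)) Γ) _)

      T-thin : ∀ a → 3 * degA a (concatMap T (allFin L)) ≤ degA a E + 2
      T-thin a = begin
        3 * degA a (concatMap T (allFin L))                   ≡⟨ cong (3 *_) (sm-↭ _ T-all) ⟩
        3 * degA a (map (λ γ → drawn γ (σ γ)) (allFin g))     ≡⟨ cong (3 *_) (sm-map _ (λ γ → drawn γ (σ γ)) (allFin g)) ⟩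
        3 * sm (λ γ → δ (proj₁ (drawn γ (σ γ))) a) (allFin g) ≡⟨ cong (3 *_) (sm-cong (λ γ → cong (λ x → δ x a) (draw-centre (lookup gs γ) (slot (σ γ)))) (allFin g)) ⟩
        3 * sm (λ γ → δ (centre (lookup gs γ)) a) (allFin g)  ≡⟨ cong (3 *_) (sm-map (λ γ → δ (centre γ) a) (lookup gs) (allFin g)) ⟨
        3 * sm (λ γ → δ (centre γ) a) (map (lookup gs) (allFin g)) ≡⟨ cong (λ x → 3 * sm (λ γ → δ (centre γ) a) x) (map-lookup gs) ⟩
        3 * sm (λ γ → δ (centre γ) a) gs                      ≡⟨ cong (3 *_) (centres a) ⟩
        3 * length (chunk a (nbrs a))                         ≤⟨ chunk-length a (nbrs a) ⟩
        length (nbrs a) + 2                                   ≡⟨ cong (_+ 2) (sm-bucket proj₁ (λ _ → proj₂) E a) ⟩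
        degA a E + 2                                          ∎
        where open ≤-Reasoning

      T-spans : ∀ i → Spans (T i)
      T-spans i u v = subst₂ (Path (_∈ T i)) (ρφ i u) (ρφ i v) (project (spanning (φ i u) (φ i v)))
        where
        open Multigraph {N} {Fin N × Fin N} proj₁ proj₂ using () renaming (Path to Pathᴺ; [] to []ᴺ; step to stepᴺ)
        ∈T : ∀ γ → layer (σ γ) ≡ i → drawn γ (σ γ) ∈ T i
        ∈T γ eq = ∈-concatMap⁺ (λ γ → if ⌊ layer (σ γ) ≟ i ⌋ then drawn γ (σ γ) ∷ [] else []) (lose (∈-allFin γ) (lem (layer (σ γ) ≟ i)))
          where
          lem : (d : Dec (layer (σ γ) ≡ i)) → drawn γ (σ γ) ∈ (if ⌊ d ⌋ then drawn γ (σ γ) ∷ [] else [])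
          lem (yes _) = here refl
          lem (no ne) = ⊥-elim (ne eq)
        hop : ∀ γ → Path (_∈ T i) (ρ i (proj₁ (opt γ (σ γ)))) (ρ i (proj₂ (opt γ (σ γ))))
        hop γ = go (layer (σ γ) ≟ i)
          where
          a = proj₁ (drawn γ (σ γ))
          b = proj₂ (drawn γ (σ γ))
          back : layer (σ γ) ≡ i → ∀ v → v ≡ ρ i (φ (layer (σ γ)) v)
          back eq v = sym (trans (cong (λ j → ρ i (φ j v)) eq) (ρφ i v))
          go : Dec (layer (σ γ) ≡ i) → Path (_∈ T i) (ρ i (φ (layer (σ γ)) a)) (ρ i (φ (layer (σ γ)) b))
          go (yes eq) = step (drawn γ (σ γ)) (∈T γ eq) (inj₁ (back eq a , back eq b)) []
          go (no ne) = subst (Path (_∈ T i) (ρ i (φ (layer (σ γ)) a))) (trans (ρφ≢ a ne) (sym (ρφ≢ b ne))) []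
        open Multigraph {n} {Edge} proj₁ proj₂ using (path-trans; path-sym)
        project : ∀ {x y} → Pathᴺ (R.Chosen τ R.Full) x y → Path (_∈ T i) (ρ i x) (ρ i y)
        project []ᴺ = []
        project (stepᴺ _ (R.chosen γ _ refl) (inj₁ (refl , refl)) r) = path-trans (hop γ) (project r)
        project (stepᴺ _ (R.chosen γ _ refl) (inj₂ (refl , refl)) r) = path-trans (path-sym (hop γ)) (project r)

  packing : ∀ L (i₀ : Fin L) E → (∀ S u v → S u ≡ true → S v ≡ false → L * 6 ≤ cross S E) → Packing L E
  packing L i₀ E cut = extract (P.R.rainbow (combine i₀ fz))
    where
    module P = Pack L i₀ E cut
    extract : ∃ P.R.Spanning → Packing L E
    extract (τ , spanning) = record
      { T = X.T ; Rest = X.Rest ; partition = X.T-partition ; thin = X.T-thin ; spans = X.T-spans }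
      where module X = P.Extract τ spanning

-- From trails to paths

record Trail (n : ℕ) : Set where
  constructor trl
  field x0 x1 x2 x3 x4 x5 : Fin n

open Trail

-- Every edge is written with its end in A in front: x0, x2, x4 are to lie in A and x1, x3, x5 in B.
trailEdges : ∀ {n} → Trail n → List (Fin n × Fin n)
trailEdges (trl a b c d e f) = (a , b) ∷ (c , b) ∷ (c , d) ∷ (e , d) ∷ (e , f) ∷ []

-- Freeness from repetitions, in the form in which it is used: two disjoint blocks, cut out after
-- any rearrangement, share no edge.
Simple : ∀ {A : Set} → List A → Set
Simple L = ∀ {e} xs ys → L ↭ xs ++ ys → e ∈ xs → e ∈ ys → ⊥

open Rearrange using (rearrange; shuffle; #_; _⊕_; ∅)

module Unvisited {n : ℕ} where

  remaining : (Fin n → Bool) → ℕ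
  remaining V = sm (λ v → ind (not (V v))) (allFin n)

  visit : Fin n → (Fin n → Bool) → Fin n → Bool
  visit x V v = V v ∨ ⌊ x ≟ v ⌋

  visit-old : ∀ x V {v} → V v ≡ true → visit x V v ≡ true
  visit-old x V p rewrite p = refl

  visit-new : ∀ x V → visit x V x ≡ true
  visit-new x V with V x | x ≟ x
  ... | true  | _     = refl
  ... | false | yes _ = refl
  ... | false | no p  = ⊥-elim (p refl)

  visit-case : ∀ x V {v} → visit x V v ≡ true → V v ≡ true ⊎ x ≡ v
  visit-case x V {v} p with V v | x ≟ v
  ... | true  | _     = inj₁ refl
  ... | false | yes q = inj₂ q

  visit-fresh : ∀ x V {v} → V v ≡ false → x ≢ v → visit x V v ≡ false
  visit-fresh x V {v} p q rewrite p with x ≟ v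
  ... | yes r = ⊥-elim (q r)
  ... | no _  = refl

  remaining-visit : ∀ x V → V x ≡ false → suc (remaining (visit x V)) ≡ remaining V
  remaining-visit x V p = trans (cong (_+ remaining (visit x V)) (sym (sm-δ1 x)))
    (trans (sym (sm-+ (δ x) (λ v → ind (not (visit x V v))) (allFin n))) (sm-cong pt (allFin n)))
    where
    pt : ∀ v → δ x v + ind (not (visit x V v)) ≡ ind (not (V v))
    pt v with x ≟ v
    ... | yes refl rewrite p = refl
    ... | no _ with V v
    ... | true = refl
    ... | false = refl

  remaining-pos : ∀ x V → V x ≡ false → 1 ≤ remaining V
  remaining-pos x V p = ≤-trans (s≤s z≤n) (≤-reflexive (remaining-visit x V p))

module Untangle {n : ℕ} (E : List (Fin n × Fin n)) (simple : Simple E) where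

  open Unvisited {n}

  Tr : Set
  Tr = Trail n

  record Cover (ps : List Tr) : Set where
    constructor covers
    field covered : concatMap trailEdges ps ↭ E

  open Cover

  pass hang : Fin n → List Tr → ℕ
  pass b = sm (λ Q → δ (x1 Q) b + δ (x3 Q) b)
  hang a = sm (λ Q → δ (x4 Q) a)

  closedA closedB : List Tr → ℕ
  closedA = sm (λ Q → δ (x0 Q) (x4 Q))
  closedB = sm (λ Q → δ (x1 Q) (x5 Q))

  recover : ∀ {ps qs} → ps ↭ qs → Cover ps → Cover qs
  recover p (covers c) = covers (↭-trans (concatMap⁺ trailEdges (↭-sym p)) c)

  clash : ∀ {P Q r e} → Cover (P ∷ Q ∷ r) → e ∈ trailEdges P → e ∈ trailEdges Q → ⊥
  clash {P} {Q} (covers c) p q = simple (trailEdges P) _ (↭-sym c) p (∈-++⁺ˡ q)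

  self-clash : ∀ {P r e} xs ys → trailEdges P ≡ xs ++ ys → Cover (P ∷ r) → e ∈ xs → e ∈ ys → ⊥
  self-clash {P} {r} xs ys eq (covers c) p q = simple xs (ys ++ concatMap trailEdges r)
    (↭-trans (↭-sym c) (↭-reflexive (trans (cong (_++ _) eq) (++-assoc xs ys (concatMap trailEdges r))))) p (∈-++⁺ˡ q)

  cover-∈ : ∀ {P r e} → Cover (P ∷ r) → e ∈ trailEdges P → e ∈ E
  cover-∈ (covers c) m = ∈-resp-↭ c (∈-++⁺ˡ m)

  rotate : ∀ (a x m v w : Fin n) → trailEdges (trl a x m v a w) ↭ trailEdges (trl a v m x a w)
  rotate a x m v w = shuffle (((a , x) ∷ []) ∷ ((m , x) ∷ []) ∷ ((m , v) ∷ []) ∷ ((a , v) ∷ []) ∷ ((a , w) ∷ []) ∷ [])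
    (0 ∷ 1 ∷ 2 ∷ 3 ∷ 4 ∷ []) (3 ∷ 2 ∷ 1 ∷ 0 ∷ 4 ∷ [])

  rotate′ : ∀ (q b x m y : Fin n) → trailEdges (trl q b y m x b) ↭ trailEdges (trl q b x m y b)
  rotate′ q b x m y = shuffle (((q , b) ∷ []) ∷ ((y , b) ∷ []) ∷ ((y , m) ∷ []) ∷ ((x , m) ∷ []) ∷ ((x , b) ∷ []) ∷ [])
    (0 ∷ 1 ∷ 2 ∷ 3 ∷ 4 ∷ []) (0 ∷ 4 ∷ 3 ∷ 2 ∷ 1 ∷ [])

  swap-first : ∀ (p q x p2 p3 p4 p5 q2 q3 q4 q5 : Fin n) →
    trailEdges (trl p x p2 p3 p4 p5) ++ trailEdges (trl q x q2 q3 q4 q5) ↭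
    trailEdges (trl q x p2 p3 p4 p5) ++ trailEdges (trl p x q2 q3 q4 q5)
  swap-first p q x p2 p3 p4 p5 q2 q3 q4 q5 = shuffle
    (((p , x) ∷ []) ∷ ((p2 , x) ∷ (p2 , p3) ∷ (p4 , p3) ∷ (p4 , p5) ∷ []) ∷ ((q , x) ∷ []) ∷ ((q2 , x) ∷ (q2 , q3) ∷ (q4 , q3) ∷ (q4 , q5) ∷ []) ∷ [])
    (0 ∷ 1 ∷ 2 ∷ 3 ∷ []) (2 ∷ 1 ∷ 0 ∷ 3 ∷ [])

  swap-tail : ∀ (p0 p1 p2 x p4 p5 q0 q1 q2 q4 q5 : Fin n) →
    trailEdges (trl p0 p1 p2 x p4 p5) ++ trailEdges (trl q0 q1 q2 x q4 q5) ↭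
    trailEdges (trl p0 p1 p2 x q4 q5) ++ trailEdges (trl q0 q1 q2 x p4 p5)
  swap-tail p0 p1 p2 x p4 p5 q0 q1 q2 q4 q5 = shuffle
    (((p0 , p1) ∷ (p2 , p1) ∷ (p2 , x) ∷ []) ∷ ((p4 , x) ∷ (p4 , p5) ∷ []) ∷ ((q0 , q1) ∷ (q2 , q1) ∷ (q2 , x) ∷ []) ∷ ((q4 , x) ∷ (q4 , q5) ∷ []) ∷ [])
    (0 ∷ 1 ∷ 2 ∷ 3 ∷ []) (0 ∷ 3 ∷ 2 ∷ 1 ∷ [])

  swap-last : ∀ (p0 p1 p2 p3 x p5 q0 q1 q2 q3 q5 : Fin n) →
    trailEdges (trl p0 p1 p2 p3 x p5) ++ trailEdges (trl q0 q1 q2 q3 x q5) ↭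
    trailEdges (trl p0 p1 p2 p3 x q5) ++ trailEdges (trl q0 q1 q2 q3 x p5)
  swap-last p0 p1 p2 p3 x p5 q0 q1 q2 q3 q5 = shuffle
    (((p0 , p1) ∷ (p2 , p1) ∷ (p2 , p3) ∷ (x , p3) ∷ []) ∷ ((x , p5) ∷ []) ∷ ((q0 , q1) ∷ (q2 , q1) ∷ (q2 , q3) ∷ (x , q3) ∷ []) ∷ ((x , q5) ∷ []) ∷ [])
    (0 ∷ 1 ∷ 2 ∷ 3 ∷ []) (0 ∷ 3 ∷ 2 ∷ 1 ∷ [])

  replace₂ : ∀ {P Q P′ Q′ r} → trailEdges P ++ trailEdges Q ↭ trailEdges P′ ++ trailEdges Q′ → Cover (P ∷ Q ∷ r) → Cover (P′ ∷ Q′ ∷ r)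
  replace₂ {P} {Q} {P′} {Q′} {r} p (covers c) = covers (↭-trans (↭-reflexive (sym (++-assoc (trailEdges P′) (trailEdges Q′) _)))
    (↭-trans (++⁺ʳ (concatMap trailEdges r) (↭-sym p)) (↭-trans (↭-reflexive (++-assoc (trailEdges P) (trailEdges Q) _)) c)))

  replace₁ : ∀ {P P′ r} → trailEdges P ↭ trailEdges P′ → Cover (P ∷ r) → Cover (P′ ∷ r)
  replace₁ {r = r} p (covers c) = covers (↭-trans (++⁺ʳ (concatMap trailEdges r) (↭-sym p)) c)

  flip₂ : ∀ {P Q r} → Cover (P ∷ Q ∷ r) → Cover (Q ∷ P ∷ r)
  flip₂ = recover (pswap _ _ refl)

  -- First phase.  A trail with x0 = x4 = a can be opened at a neighbour x of a on its 4-cycle by exchanging ends with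
  -- another trail passing x; this fails only if the other trail then closes at a, in which case we continue from the
  -- second neighbour of a on the new 4-cycle.  Every trail holds at most the edge it needs to a, so no vertex is met twice.
  record Opened (ps : List Tr) : Set where
    field
      trails  : List Tr
      cover   : Cover trails
      fewer   : closedA trails < closedA ps
      pass-≡  : ∀ b → pass b trails ≡ pass b ps
      hang-≡  : ∀ a → hang a trails ≡ hang a ps

  opened-via : ∀ {ps qs} → closedA qs ≡ closedA ps → (∀ b → pass b qs ≡ pass b ps) → (∀ a → hang a qs ≡ hang a ps) → Opened qs → Opened ps
  opened-via c p h o = record
    { trails = trails ; cover = cover ; fewer = subst (_ <_) c fewer
    ; pass-≡ = λ b → trans (pass-≡ b) (p b) ; hang-≡ = λ a → trans (hang-≡ a) (h a) }
    where open Opened o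

  PassTwice : List Tr → Set
  PassTwice ps = ∀ {a b} → (a , b) ∈ E → 2 ≤ pass b ps

  -- For a trail closed at `a`: its two neighbours of `a` on the 4-cycle are both marked or both
  -- unmarked. Each implication depends on one end only, so that it already holds for trails that an
  -- exchange is yet to close.
  Inv₁ : Fin n → (Fin n → Bool) → Tr → Set
  Inv₁ a V Q = (x4 Q ≡ a → V (x3 Q) ≡ true → V (x1 Q) ≡ true) × (x0 Q ≡ a → V (x1 Q) ≡ true → V (x3 Q) ≡ true)

  true≢false : ∀ {b : Bool} → b ≡ true → b ≡ false → ⊥
  true≢false refl ()

  not-true : ∀ {b : Bool} → (b ≡ true → ⊥) → b ≡ false
  not-true {true}  h = ⊥-elim (h refl)
  not-true {false} h = refl

  -- `V` marks the neighbours of `a` already tried; `v` is marked and `x` is the next one. If the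
  -- partner closes at `a`, the invariant makes its other neighbour of `a` unmarked, so the number
  -- of unmarked vertices bounds the number of rounds.
  walk₁ : ∀ k a x m v w r V → remaining V ≤ k → Cover (trl a x m v a w ∷ r) → PassTwice (trl a x m v a w ∷ r) →
    V v ≡ true → V x ≡ false → (∀ Q → Q ∈ r → Inv₁ a V Q) → Opened (trl a x m v a w ∷ r)
  walk₁ zero a x m v w r V le c pt Vv Vx inv = ⊥-elim (1+n≰n (≤-trans (remaining-pos x V Vx) le))
  walk₁ (suc k) a x m v w r V le c pt Vv Vx inv
    -- The closed trail passes `x` only once, as `v` differs from `x`; the second passage is in
    -- another trail.
    with sm-pos (λ Q → δ (x1 Q) x + δ (x3 Q) x) r (s≤s⁻¹ (subst (λ z → 2 ≤ z + pass x r)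
           (cong₂ _+_ (δ-refl x) (δ-≢ (λ v≡x → true≢false Vv (trans (cong V v≡x) Vx)))) (pt (cover-∈ c (here refl)))))
  ... | trl q0 q1 q2 q3 q4 q5 , Q∈r , hit with ∈⇒↭ Q∈r | q1 ≟ x
  ... | r′ , perm | yes refl = goal
    where
    P = trl a x m v a w
    Q = trl q0 x q2 q3 q4 q5
    P′ = trl q0 x m v a w
    c₂ : Cover (P ∷ Q ∷ r′)
    c₂ = recover (prep P perm) c
    q0≢a : q0 ≢ a
    q0≢a q = clash {P} {Q} {r′} c₂ (here refl) (here (cong (_, x) (sym q)))
    c₃ : Cover (P′ ∷ trl a x q2 q3 q4 q5 ∷ r′)
    c₃ = replace₂ {P} {Q} {P′} {trl a x q2 q3 q4 q5} (swap-first a q0 x m v a w q2 q3 q4 q5) c₂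
    goal : Opened (P ∷ r)
    goal with q4 ≟ a
    ... | no q4≢a = record
      { trails = P′ ∷ trl a x q2 q3 q4 q5 ∷ r′ ; cover = c₃
      ; fewer = ≤-trans (≤-reflexive (cong suc (cong₂ (λ i j → i + (j + closedA r′)) (δ-≢ q0≢a) (δ-≢ (q4≢a ∘ sym)))))
          (≤-trans (s≤s (m≤n+m _ (δ q0 q4))) (≤-reflexive (cong₂ _+_ (sym (δ-refl a)) (sym (sm-↭ (λ Q → δ (x0 Q) (x4 Q)) perm)))))
      ; pass-≡ = λ b → cong (δ x b + δ v b +_) (sym (sm-↭ (λ Q → δ (x1 Q) b + δ (x3 Q) b) perm))
      ; hang-≡ = λ z → cong (δ a z +_) (sym (sm-↭ (λ Q → δ (x4 Q) z) perm)) }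
    -- The partner is now closed. Its 4-cycle is reversed, so that `x` moves to position 3 and `q3`
    -- becomes the vertex to be tried next.
    ... | yes refl = opened-via closed-same pass-same hang-same
        (walk₁ k a q3 q2 x q5 (P′ ∷ r′) (visit x V) le′ c₄ pt′ (visit-new x V) fresh inv′)
      where
      Q″ = trl a q3 q2 x a q5
      c₄ : Cover (Q″ ∷ P′ ∷ r′)
      c₄ = replace₁ {trl a x q2 q3 a q5} {Q″} (rotate a x q2 q3 q5) (flip₂ {P′} {trl a x q2 q3 a q5} {r′} c₃)
      pass-same : ∀ b → pass b (Q″ ∷ P′ ∷ r′) ≡ pass b (P ∷ r)
      pass-same b = trans (lem (δ q3 b) (δ x b) (δ v b) (pass b r′)) (cong (δ x b + δ v b +_) (sym (sm-↭ (λ Q → δ (x1 Q) b + δ (x3 Q) b) perm)))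
        where
        lem : ∀ α β γ z → α + β + (β + γ + z) ≡ β + γ + (β + α + z)
        lem = solve-∀
      hang-same : ∀ z → hang z (Q″ ∷ P′ ∷ r′) ≡ hang z (P ∷ r)
      hang-same z = cong (δ a z +_) (sym (sm-↭ (λ Q → δ (x4 Q) z) perm))
      closed-same : closedA (Q″ ∷ P′ ∷ r′) ≡ closedA (P ∷ r)
      closed-same = cong (δ a a +_) (sym (sm-↭ (λ Q → δ (x0 Q) (x4 Q)) perm))
      pt′ : PassTwice (Q″ ∷ P′ ∷ r′)
      pt′ {b = b} e = ≤-trans (pt e) (≤-reflexive (sym (pass-same b)))
      le′ : remaining (visit x V) ≤ k
      le′ = s≤s⁻¹ (≤-trans (≤-reflexive (remaining-visit x V Vx)) le)
      fresh : visit x V q3 ≡ false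
      fresh = visit-fresh x V (not-true λ t → true≢false (proj₁ (inv Q Q∈r) refl t) Vx) λ x≡q3 →
          self-clash {Q″} {P′ ∷ r′} ((a , q3) ∷ (q2 , q3) ∷ (q2 , x) ∷ []) ((a , x) ∷ (a , q5) ∷ []) refl c₄ (here refl) (here (cong (a ,_) (sym x≡q3)))
      inv′ : ∀ R → R ∈ P′ ∷ r′ → Inv₁ a (visit x V) R
      inv′ R (here refl) = (λ _ _ → visit-new x V) , λ q0≡a _ → ⊥-elim (q0≢a q0≡a)
      inv′ R (there R∈) = first , second
        where
        R∈r : R ∈ r
        R∈r = ∈-resp-↭ (↭-sym perm) (there R∈)
        away : (a , x) ∈ trailEdges R → ⊥
        away = case ∈⇒↭ R∈r of λ (r₀ , p₀) → clash {P} {R} {r₀} (recover (prep P p₀) c) (here refl)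
        first : x4 R ≡ a → visit x V (x3 R) ≡ true → visit x V (x1 R) ≡ true
        first e4 t with visit-case x V t
        ... | inj₁ old = visit-old x V (proj₁ (inv R R∈r) e4 old)
        ... | inj₂ x≡ = ⊥-elim (away (there (there (there (here (cong₂ _,_ (sym e4) x≡))))))
        second : x0 R ≡ a → visit x V (x1 R) ≡ true → visit x V (x3 R) ≡ true
        second e0 t with visit-case x V t
        ... | inj₁ old = visit-old x V (proj₂ (inv R R∈r) e0 old)
        ... | inj₂ x≡ = ⊥-elim (away (here (cong₂ _,_ (sym e0) x≡)))
  walk₁ (suc k) a x m v w r V le c pt Vv Vx inv | trl q0 q1 q2 q3 q4 q5 , Q∈r , hit | r′ , perm | no q1≢x
    with δ-pos {u = q3} {x} hit
  ... | refl = goal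
    where
    P₀ = trl a x m v a w
    -- The partner passes `x` at position 3. Reversing the 4-cycle puts `x` there in the closed
    -- trail too, and the last two edges can be exchanged.
    P = trl a v m x a w
    Q = trl q0 q1 q2 x q4 q5
    P′ = trl a v m x q4 q5
    c₁ : Cover (P₀ ∷ Q ∷ r′)
    c₁ = recover (prep P₀ perm) c
    c₂ : Cover (P ∷ Q ∷ r′)
    c₂ = replace₁ {P₀} {P} (rotate a x m v w) c₁
    q4≢a : q4 ≢ a
    q4≢a q = clash {P₀} {Q} {r′} c₁ (here refl) (there (there (there (here (cong (_, x) (sym q))))))
    Q′ = trl q0 q1 q2 x a w
    c₃ : Cover (P′ ∷ Q′ ∷ r′)
    c₃ = replace₂ {P} {Q} {P′} {Q′} (swap-tail a v m x a w q0 q1 q2 q4 q5) c₂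
    goal : Opened (P₀ ∷ r)
    goal with q0 ≟ a
    ... | no q0≢a = record
      { trails = P′ ∷ Q′ ∷ r′ ; cover = c₃
      ; fewer = ≤-trans (≤-reflexive (cong suc (cong₂ (λ i j → i + (j + closedA r′)) (δ-≢ (q4≢a ∘ sym)) (δ-≢ q0≢a))))
          (≤-trans (s≤s (m≤n+m _ (δ q0 q4))) (≤-reflexive (cong₂ _+_ (sym (δ-refl a)) (sym (sm-↭ (λ Q → δ (x0 Q) (x4 Q)) perm)))))
      ; pass-≡ = λ b → cong₂ _+_ (+-comm (δ v b) (δ x b)) (sym (sm-↭ (λ Q → δ (x1 Q) b + δ (x3 Q) b) perm))
      ; hang-≡ = λ z → trans (lem (δ q4 z) (δ a z) (hang z r′)) (cong (δ a z +_) (sym (sm-↭ (λ Q → δ (x4 Q) z) perm))) }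
      where
      lem : ∀ α β z → α + (β + z) ≡ β + (α + z)
      lem = solve-∀
    ... | yes refl = opened-via closed-same pass-same hang-same
        (walk₁ k a q1 q2 x w (P′ ∷ r′) (visit x V) le′ c₄ pt′ (visit-new x V) fresh inv′)
      where
      c₄ : Cover (Q′ ∷ P′ ∷ r′)
      c₄ = flip₂ {P′} {Q′} {r′} c₃
      pass-same : ∀ b → pass b (Q′ ∷ P′ ∷ r′) ≡ pass b (P₀ ∷ r)
      pass-same b = trans (lem (δ q1 b) (δ x b) (δ v b) (pass b r′)) (cong (δ x b + δ v b +_) (sym (sm-↭ (λ Q → δ (x1 Q) b + δ (x3 Q) b) perm)))
        where
        lem : ∀ α β γ z → α + β + (γ + β + z) ≡ β + γ + (α + β + z)
        lem = solve-∀
      hang-same : ∀ z → hang z (Q′ ∷ P′ ∷ r′) ≡ hang z (P₀ ∷ r)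
      hang-same z = cong (δ a z +_) (sym (sm-↭ (λ Q → δ (x4 Q) z) perm))
      closed-same : closedA (Q′ ∷ P′ ∷ r′) ≡ closedA (P₀ ∷ r)
      closed-same = cong (δ a a +_) (sym (sm-↭ (λ Q → δ (x0 Q) (x4 Q)) perm))
      pt′ : PassTwice (Q′ ∷ P′ ∷ r′)
      pt′ {b = b} e = ≤-trans (pt e) (≤-reflexive (sym (pass-same b)))
      le′ : remaining (visit x V) ≤ k
      le′ = s≤s⁻¹ (≤-trans (≤-reflexive (remaining-visit x V Vx)) le)
      fresh : visit x V q1 ≡ false
      fresh = visit-fresh x V (not-true λ t → true≢false (proj₂ (inv Q Q∈r) refl t) Vx) (q1≢x ∘ sym)
      inv′ : ∀ R → R ∈ P′ ∷ r′ → Inv₁ a (visit x V) R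
      inv′ R (here refl) = (λ q4≡a _ → ⊥-elim (q4≢a q4≡a)) , λ _ _ → visit-new x V
      inv′ R (there R∈) = first , second
        where
        R∈r : R ∈ r
        R∈r = ∈-resp-↭ (↭-sym perm) (there R∈)
        away : (a , x) ∈ trailEdges R → ⊥
        away = case ∈⇒↭ R∈r of λ (r₀ , p₀) → clash {P₀} {R} {r₀} (recover (prep P₀ p₀) c) (here refl)
        first : x4 R ≡ a → visit x V (x3 R) ≡ true → visit x V (x1 R) ≡ true
        first e4 t with visit-case x V t
        ... | inj₁ old = visit-old x V (proj₁ (inv R R∈r) e4 old)
        ... | inj₂ x≡ = ⊥-elim (away (there (there (there (here (cong₂ _,_ (sym e4) x≡))))))
        second : x0 R ≡ a → visit x V (x1 R) ≡ true → visit x V (x3 R) ≡ true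
        second e0 t with visit-case x V t
        ... | inj₁ old = visit-old x V (proj₂ (inv R R∈r) e0 old)
        ... | inj₂ x≡ = ⊥-elim (away (here (cong₂ _,_ (sym e0) x≡)))

  record OpenA (ps : List Tr) : Set where
    field
      trails : List Tr
      cover  : Cover trails
      openA  : closedA trails ≡ 0
      hang-≡ : ∀ a → hang a trails ≡ hang a ps

  open-A : ∀ k ps → closedA ps ≤ k → Cover ps → PassTwice ps → OpenA ps
  open-A k ps le c pt with closedA ps in eq
  ... | zero = record { trails = ps ; cover = c ; openA = eq ; hang-≡ = λ _ → refl }
  open-A (suc k) ps le c pt | suc j with sm-pos (λ Q → δ (x0 Q) (x4 Q)) ps (subst (1 ≤_) (sym eq) (s≤s z≤n))
  ... | trl a x m v a′ w , P∈ , hit with ∈⇒↭ P∈ | δ-pos hit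
  ... | r , perm | refl = record { trails = O.trails ; cover = O.cover ; openA = O.openA
                                 ; hang-≡ = λ z → trans (O.hang-≡ z) (trans (S.hang-≡ z) (sym (sm-↭ (λ Q → δ (x4 Q) z) perm))) }
    where
    P = trl a x m v a w
    c′ : Cover (P ∷ r)
    c′ = recover perm c
    pt′ : PassTwice (P ∷ r)
    pt′ {b = b} e = ≤-trans (pt e) (≤-reflexive (sm-↭ (λ Q → δ (x1 Q) b + δ (x3 Q) b) perm))
    -- At the start only `v` is marked. The edge from `a` to `v` belongs to the closed trail, so no
    -- other trail meets a premise of the invariant.
    V : Fin n → Bool
    V z = ⌊ v ≟ z ⌋
    v≢x : v ≢ x
    v≢x q = self-clash {P} {r} ((a , x) ∷ []) ((m , x) ∷ (m , v) ∷ (a , v) ∷ (a , w) ∷ []) refl c′ (here refl) (there (there (here (cong (a ,_) (sym q)))))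
    Vv : V v ≡ true
    Vv with v ≟ v
    ... | yes _ = refl
    ... | no q = ⊥-elim (q refl)
    Vx : V x ≡ false
    Vx with v ≟ x
    ... | yes q = ⊥-elim (v≢x q)
    ... | no _ = refl
    V-only : ∀ {z} → V z ≡ true → v ≡ z
    V-only {z} t with v ≟ z
    ... | yes q = q
    away : ∀ {R} → R ∈ r → (a , v) ∈ trailEdges R → ⊥
    away {R} R∈ = case ∈⇒↭ R∈ of λ (r₀ , p₀) → clash {P} {R} {r₀} (recover (prep P p₀) c′) (there (there (there (here refl))))
    module S = Opened (walk₁ (remaining V) a x m v w r V ≤-refl c′ pt′ Vv Vx
      λ R R∈ → (λ e4 t → ⊥-elim (away R∈ (there (there (there (here (cong₂ _,_ (sym e4) (V-only t)))))))) ,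
               (λ e0 t → ⊥-elim (away R∈ (here (cong₂ _,_ (sym e0) (V-only t))))))
    module O = OpenA (open-A k S.trails
      (s≤s⁻¹ (≤-trans (≤-trans S.fewer (≤-reflexive (trans (sym (sm-↭ (λ Q → δ (x0 Q) (x4 Q)) perm)) eq))) le))
      S.cover λ {_} {b} e → ≤-trans (pt′ e) (≤-reflexive (sym (S.pass-≡ b))))

  -- Second phase.  Only last edges are exchanged, so no trail is closed at x0 again.
  OpenAt : List Tr → Set
  OpenAt ps = ∀ Q → Q ∈ ps → x0 Q ≢ x4 Q

  openAt : ∀ ps → closedA ps ≡ 0 → OpenAt ps
  openAt ps z Q m q = case subst (1 ≤_) z (≤-trans (≤-reflexive (sym (δ-≡ q))) (sm-∈ (λ Q → δ (x0 Q) (x4 Q)) m)) of λ ()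

  -- Later reversals of 4-cycles change x4 and with it the number of trails hanging at a vertex. The
  -- existence of one good trail at every vertex survives them, and it provides the partners for the
  -- exchanges.
  GoodHang : Fin n → List Tr → Set
  GoodHang a ps = ∃ λ Q → Q ∈ ps × x4 Q ≡ a × x1 Q ≢ x5 Q

  record Tidied (ps : List Tr) : Set where
    field
      trails : List Tr
      cover  : Cover trails
      opn    : OpenAt trails
      fewer  : closedB trails < closedB ps
      hang-≡ : ∀ a → hang a trails ≡ hang a ps

  -- The last edges join `a` to `p1` and to `q1`. They are distinct edges, so `p1` and `q1` differ
  -- and the exchange opens both trails.
  swap-closed : ∀ {a p0 p1 p2 p3 p5 q0 q1 q2 q3 q5 r} → let P = trl p0 p1 p2 p3 a p5; Q = trl q0 q1 q2 q3 a q5 in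
    Cover (P ∷ Q ∷ r) → OpenAt (P ∷ Q ∷ r) → p1 ≡ p5 → q1 ≡ q5 → Tidied (P ∷ Q ∷ r)
  swap-closed {a} {p0} {p1} {p2} {p3} {p5} {q0} {q1} {q2} {q3} {q5} {r} c o refl refl = record
    { trails = P′ ∷ Q′ ∷ r
    ; cover = replace₂ {P} {Q} {P′} {Q′} (swap-last p0 p1 p2 p3 a p1 q0 q1 q2 q3 q1) c
    ; opn = λ where _ (here refl) → o P (here refl)
                    _ (there (here refl)) → o Q (there (here refl))
                    R (there (there m)) → o R (there (there m))
    ; fewer = ≤-trans (≤-reflexive (cong suc (cong₂ (λ i j → i + (j + closedB r)) (δ-≢ p≢q) (δ-≢ (p≢q ∘ sym)))))
        (≤-trans (s≤s (m≤n+m _ (δ q1 q1))) (≤-reflexive (cong (_+ _) (sym (δ-refl p1)))))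
    ; hang-≡ = λ _ → refl }
    where
    P = trl p0 p1 p2 p3 a p1
    Q = trl q0 q1 q2 q3 a q1
    P′ = trl p0 p1 p2 p3 a q1
    Q′ = trl q0 q1 q2 q3 a p1
    p≢q : p1 ≢ q1
    p≢q e = clash {P} {Q} {r} c (there (there (there (there (here refl))))) (there (there (there (there (here (cong (a ,_) e))))))

  tidied-↭ : ∀ {ps qs} → ps ↭ qs → Tidied qs → Tidied ps
  tidied-↭ p t = record { trails = trails ; cover = cover ; opn = opn ; fewer = subst (_ <_) (sym (sm-↭ _ p)) fewer
                        ; hang-≡ = λ a → trans (hang-≡ a) (sym (sm-↭ _ p)) }
    where open Tidied t

  open-↭ : ∀ {ps qs} → ps ↭ qs → OpenAt ps → OpenAt qs
  open-↭ p o Q m = o Q (∈-resp-↭ (↭-sym p) m)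

  good-or-tidy : ∀ ps → Cover ps → OpenAt ps → ∀ a → 2 ≤ hang a ps → GoodHang a ps ⊎ Tidied ps
  good-or-tidy ps c o a h with sm-pos (λ Q → δ (x4 Q) a) ps (≤-trans (s≤s z≤n) h)
  ... | P@(trl p0 p1 p2 p3 p4 p5) , P∈ , hit with δ-pos {u = p4} {a} hit | p1 ≟ p5 | ∈⇒↭ P∈
  ... | refl | no good | _ = inj₁ (P , P∈ , refl , good)
  ... | refl | yes bad | r , perm
    with sm-pos (λ Q → δ (x4 Q) a) r (s≤s⁻¹ (subst (2 ≤_) (trans (sm-↭ (λ Q → δ (x4 Q) a) perm) (cong (_+ hang a r) (δ-refl a))) h))
  ... | Q@(trl q0 q1 q2 q3 q4 q5) , Q∈ , hit′ with δ-pos {u = q4} {a} hit′ | q1 ≟ q5 | ∈⇒↭ Q∈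
  ... | refl | no good | _ = inj₁ (Q , ∈-resp-↭ (↭-sym perm) (there Q∈) , refl , good)
  ... | refl | yes bad′ | r′ , perm′ = inj₂ (tidied-↭ all (swap-closed (recover all c) (open-↭ all o) bad bad′))
    where
    all : ps ↭ P ∷ Q ∷ r′
    all = ↭-trans perm (prep P perm′)

  all-or : ∀ {m} {P : Fin m → Set} {X : Set} → (∀ i → P i ⊎ X) → (∀ i → P i) ⊎ X
  all-or {zero}  h = inj₁ λ ()
  all-or {suc m} h with h fz | all-or (h ∘ fs)
  ... | inj₂ x | _      = inj₂ x
  ... | inj₁ _ | inj₂ x = inj₂ x
  ... | inj₁ p | inj₁ q = inj₁ λ where fz → p
                                       (fs i) → q i

  record Prepared : Set where
    field
      trails : List Tr
      cover  : Cover trails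
      opn    : OpenAt trails
      good   : ∀ {a b} → (a , b) ∈ E → GoodHang a trails

  HangTwice : List Tr → Set
  HangTwice ps = ∀ {a b} → (a , b) ∈ E → 2 ≤ hang a ps

  prepare : ∀ k ps → closedB ps ≤ k → Cover ps → OpenAt ps → HangTwice ps → Prepared
  prepare k ps le c o h with all-or {P = λ a → 2 ≤ hang a ps → GoodHang a ps} {X = Tidied ps} dec
    where
    dec : ∀ a → (2 ≤ hang a ps → GoodHang a ps) ⊎ Tidied ps
    dec a with 2 ≤? hang a ps
    ... | no ¬2 = inj₁ λ y → ⊥-elim (¬2 y)
    ... | yes y with good-or-tidy ps c o a y
    ... | inj₁ g = inj₁ λ _ → g
    ... | inj₂ t = inj₂ t
  ... | inj₁ good = record { trails = ps ; cover = c ; opn = o ; good = λ e → good _ (h e) }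
  prepare zero ps le c o h | inj₂ t = ⊥-elim (n≮0 (≤-trans (Tidied.fewer t) le))
  prepare (suc k) ps le c o h | inj₂ t = prepare k trails (s≤s⁻¹ (≤-trans fewer le)) cover opn λ {a} e → ≤-trans (h e) (≤-reflexive (sym (hang-≡ a)))
    where open Tidied t

  GoodAll : List Tr → Set
  GoodAll ps = ∀ {a b} → (a , b) ∈ E → GoodHang a ps

  record Step (m : ℕ) : Set where
    field
      trails : List Tr
      cover  : Cover trails
      opn    : OpenAt trails
      good   : GoodAll trails
      fewer  : closedB trails < m

  -- The marks are on neighbours of `b`. For a trail that becomes closed at `b` with an unmarked x4,
  -- the neighbour x2 is unmarked as well and can be tried next.
  Inv₂ : Fin n → (Fin n → Bool) → Tr → Set
  Inv₂ b V Q = x1 Q ≡ b → V (x2 Q) ≡ true → V (x4 Q) ≡ true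

  -- The trail closed at `b` exchanges last edges with a good trail hanging at `x`. This opens it;
  -- if the partner now closes at `b`, its 4-cycle is reversed and the search goes on from its
  -- former x2. One of the two trails remains good at `x` in either case.
  walk₂ : ∀ k p0 b v m x r V → let P = trl p0 b v m x b in
    remaining V ≤ k → Cover (P ∷ r) → OpenAt (P ∷ r) → GoodAll (P ∷ r) →
    V v ≡ true → V x ≡ false → (∀ Q → Q ∈ r → Inv₂ b V Q) → Step (closedB (P ∷ r))
  walk₂ zero p0 b v m x r V le c o g Vv Vx inv = ⊥-elim (1+n≰n (≤-trans (remaining-pos x V Vx) le))
  walk₂ (suc k) p0 b v m x r V le c o g Vv Vx inv with g (cover-∈ c (there (there (there (there (here refl))))))
  ... | _ , here refl , _ , bad = ⊥-elim (bad refl)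
  ... | trl q0 q1 q2 q3 .x q5 , there Q∈r , refl , q1≢q5 with ∈⇒↭ Q∈r
  ... | r′ , perm = goal
    where
    P = trl p0 b v m x b
    Q = trl q0 q1 q2 q3 x q5
    P′ = trl p0 b v m x q5
    Q′ = trl q0 q1 q2 q3 x b
    c₂ : Cover (P ∷ Q ∷ r′)
    c₂ = recover (prep P perm) c
    c₃ : Cover (P′ ∷ Q′ ∷ r′)
    c₃ = replace₂ {P} {Q} {P′} {Q′} (swap-last p0 b v m x b q0 q1 q2 q3 q5) c₂
    b≢q5 : b ≢ q5
    b≢q5 e = clash {P} {Q} {r′} c₂ (there (there (there (there (here refl))))) (there (there (there (there (here (cong (x ,_) e))))))
    in-r : ∀ {R} → R ∈ r′ → R ∈ r
    in-r m = ∈-resp-↭ (↭-sym perm) (there m)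
    goal : Step (closedB (P ∷ r))
    goal with q1 ≟ b
    ... | no q1≢b = record
      { trails = P′ ∷ Q′ ∷ r′ ; cover = c₃
      ; opn = λ where _ (here refl) → o P (here refl)
                      _ (there (here refl)) → o Q (there Q∈r)
                      R (there (there m)) → o R (there (in-r m))
      ; good = λ e → keep (g e)
      ; fewer = ≤-trans (≤-reflexive (cong suc (cong₂ (λ i j → i + (j + closedB r′)) (δ-≢ b≢q5) (δ-≢ q1≢b))))
          (≤-trans (s≤s (m≤n+m _ (δ q1 q5))) (≤-reflexive (cong₂ _+_ (sym (δ-refl b)) (sym (sm-↭ (λ Q → δ (x1 Q) (x5 Q)) perm))))) }
      where
      keep : ∀ {a} → GoodHang a (P ∷ r) → GoodHang a (P′ ∷ Q′ ∷ r′)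
      keep (_ , here refl , _ , bad) = ⊥-elim (bad refl)
      keep (R , there R∈ , eq , good) with ∈-resp-↭ perm R∈
      ... | here refl = Q′ , there (here refl) , eq , q1≢b
      ... | there m = R , there (there m) , eq , good
    ... | yes refl = subst Step closed-same (walk₂ k q0 b x q3 q2 (P′ ∷ r′) (visit x V) le′ c₄ o′ (λ e → keep (g e)) (visit-new x V) fresh inv′)
      where
      Q″ = trl q0 b x q3 q2 b
      c₄ : Cover (Q″ ∷ P′ ∷ r′)
      c₄ = replace₁ {Q′} {Q″} (rotate′ q0 b x q3 q2) (flip₂ {P′} {Q′} {r′} c₃)
      closed-same : closedB (Q″ ∷ P′ ∷ r′) ≡ closedB (P ∷ r)
      closed-same = cong (δ b b +_) (sym (sm-↭ (λ Q → δ (x1 Q) (x5 Q)) perm))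
      le′ : remaining (visit x V) ≤ k
      le′ = s≤s⁻¹ (≤-trans (≤-reflexive (remaining-visit x V Vx)) le)
      -- The reversal makes `q2` the new x4. It differs from `q0`, because the trail has distinct
      -- edges from these to `b`.
      o′ : OpenAt (Q″ ∷ P′ ∷ r′)
      o′ _ (here refl) e = self-clash {Q″} {P′ ∷ r′} ((q0 , b) ∷ (x , b) ∷ (x , q3) ∷ []) ((q2 , q3) ∷ (q2 , b) ∷ []) refl c₄ (here refl) (there (here (cong (_, b) e)))
      o′ _ (there (here refl)) = o P (here refl)
      o′ R (there (there m)) = o R (there (in-r m))
      keep : ∀ {a} → GoodHang a (P ∷ r) → GoodHang a (Q″ ∷ P′ ∷ r′)
      keep (_ , here refl , _ , bad) = ⊥-elim (bad refl)
      keep (R , there R∈ , eq , good) with ∈-resp-↭ perm R∈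
      ... | here refl = P′ , there (here refl) , eq , b≢q5
      ... | there m = R , there (there m) , eq , good
      x≢q2 : x ≢ q2
      x≢q2 e = self-clash {Q″} {P′ ∷ r′} ((q0 , b) ∷ (x , b) ∷ (x , q3) ∷ []) ((q2 , q3) ∷ (q2 , b) ∷ []) refl c₄ (there (here refl)) (there (here (cong (_, b) e)))
      fresh : visit x V q2 ≡ false
      fresh = visit-fresh x V (not-true λ t → true≢false (inv Q Q∈r refl t) Vx) x≢q2
      inv′ : ∀ R → R ∈ P′ ∷ r′ → Inv₂ b (visit x V) R
      inv′ R (here refl) _ _ = visit-new x V
      inv′ R (there R∈) e1 t with visit-case x V t
      ... | inj₁ old = visit-old x V (inv R (in-r R∈) e1 old)
      ... | inj₂ x≡ = ⊥-elim (case ∈⇒↭ (in-r R∈) of λ (r₀ , p₀) →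
          clash {P} {R} {r₀} (recover (prep P p₀) c) (there (there (there (there (here refl))))) (there (here (cong₂ _,_ x≡ (sym e1)))))

  open-B : ∀ k ps → closedB ps ≤ k → Cover ps → OpenAt ps → GoodAll ps → ∃ λ qs → Cover qs × OpenAt qs × closedB qs ≡ 0
  open-B k ps le c o g with closedB ps in eq
  ... | zero = ps , c , o , eq
  open-B (suc k) ps le c o g | suc j with sm-pos (λ Q → δ (x1 Q) (x5 Q)) ps (subst (1 ≤_) (sym eq) (s≤s z≤n))
  ... | trl p0 b v m x b′ , P∈ , hit with ∈⇒↭ P∈ | δ-pos hit
  ... | r , perm | refl = open-B k S.trails
      (s≤s⁻¹ (≤-trans (≤-trans S.fewer (≤-reflexive (trans (sym (sm-↭ (λ Q → δ (x1 Q) (x5 Q)) perm)) eq))) le)) S.cover S.opn S.good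
    where
    P = trl p0 b v m x b
    c′ : Cover (P ∷ r)
    c′ = recover perm c
    V : Fin n → Bool
    V z = ⌊ v ≟ z ⌋
    v≢x : v ≢ x
    v≢x q = self-clash {P} {r} ((p0 , b) ∷ (v , b) ∷ []) ((v , m) ∷ (x , m) ∷ (x , b) ∷ []) refl c′ (there (here refl)) (there (there (here (cong (_, b) q))))
    Vv : V v ≡ true
    Vv with v ≟ v
    ... | yes _ = refl
    ... | no q = ⊥-elim (q refl)
    Vx : V x ≡ false
    Vx with v ≟ x
    ... | yes q = ⊥-elim (v≢x q)
    ... | no _ = refl
    V-only : ∀ {z} → V z ≡ true → v ≡ z
    V-only {z} t with v ≟ z
    ... | yes q = q
    module S = Step (walk₂ (remaining V) p0 b v m x r V ≤-refl c′ (open-↭ perm o)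
      (λ e → case g e of λ (R , R∈ , eq , good) → R , ∈-resp-↭ perm R∈ , eq , good) Vv Vx
      λ R R∈ e1 t → ⊥-elim (case ∈⇒↭ R∈ of λ (r₀ , p₀) →
        clash {P} {R} {r₀} (recover (prep P p₀) c′) (there (here refl)) (there (here (cong₂ _,_ (V-only t) (sym e1))))))

  untangle : ∀ ps → Cover ps → PassTwice ps → HangTwice ps →
    ∃ λ qs → Cover qs × (∀ Q → Q ∈ qs → x0 Q ≢ x4 Q × x1 Q ≢ x5 Q)
  untangle ps c pt ht = case open-B (closedB R.trails) R.trails ≤-refl R.cover R.opn R.good of λ
    (qs , cq , oq , zq) → qs , cq , λ Q m → oq Q m , λ q →
      case subst (1 ≤_) zq (≤-trans (≤-reflexive (sym (δ-≡ q))) (sm-∈ (λ Q → δ (x1 Q) (x5 Q)) m)) of λ ()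
    where
    module O = OpenA (open-A (closedA ps) ps ≤-refl c pt)
    module R = Prepared (prepare (closedB O.trails) O.trails ≤-refl O.cover (openAt O.trails O.openA)
      λ {a} e → ≤-trans (ht e) (≤-reflexive (sym (O.hang-≡ a))))

-- Parity correction along hops

module _ {n : ℕ} {X : Set} (key : X → Fin n) where

  count : List X → Fin n → ℕ
  count xs v = sm (λ x → δ (key x) v) xs

  find-key : ∀ xs v → 1 ≤ count xs v → ∃ λ x → ∃ λ ys → key x ≡ v × xs ↭ x ∷ ys
  find-key xs v h with sm-pos (λ x → δ (key x) v) xs h
  ... | x , m , p with ∈⇒↭ m
  ... | ys , q = x , ys , δ-pos p , q

  both : X × X → List X
  both (x , y) = x ∷ y ∷ []

  pairUp : ∀ k xs → length xs ≤ k → (∀ v → odd (count xs v) ≡ false) →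
    ∃ λ ps → xs ↭ concatMap both ps × (∀ p → p ∈ ps → key (proj₁ p) ≡ key (proj₂ p))
  pairUp k [] le ev = [] , refl , λ _ ()
  pairUp (suc k) (x ∷ xs) (s≤s le) ev with find-key xs (key x) (pos (count xs (key x)) (trans (sym (cong (λ z → odd (z + count xs (key x))) (δ-refl (key x)))) (ev (key x))))
    where
    pos : ∀ m → not (odd m) ≡ false → 1 ≤ m
    pos (suc m) _ = s≤s z≤n
  ... | y , ys , eq , p with pairUp k ys (≤-trans (n≤1+n _) (subst (_≤ k) (↭-length p) le)) ev′
    where
    ev′ : ∀ v → odd (count ys v) ≡ false
    ev′ v = trans (cong (λ z → z xor odd (count ys v)) (sym (xor-same (odd (δ (key x) v)))))
      (trans (xor-assoc (odd (δ (key x) v)) _ _) (trans (cong (odd (δ (key x) v) xor_)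
        (trans (cong (λ z → odd (δ z v) xor odd (count ys v)) (sym eq)) (sym (odd-+ (δ (key y) v) (count ys v)))))
        (trans (sym (odd-+ (δ (key x) v) _)) (trans (cong (λ z → odd (δ (key x) v + z)) (sym (sm-↭ _ p))) (ev v)))))
  ... | ps , q , h = (x , y) ∷ ps , prep x (↭-trans p (prep y q)) , λ where
      _ (here refl) → sym eq
      p (there m) → h p m

matchUp : ∀ {n} {X Y : Set} (k₁ : X → Fin n) (k₂ : Y → Fin n) xs ys → (∀ v → count k₁ xs v ≡ count k₂ ys v) →
  ∃ λ (zs : List (X × Y)) → xs ↭ map proj₁ zs × ys ↭ map proj₂ zs × (∀ z → z ∈ zs → k₁ (proj₁ z) ≡ k₂ (proj₂ z))
matchUp k₁ k₂ [] [] h = [] , refl , refl , λ _ ()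
matchUp k₁ k₂ [] (y ∷ ys) h = ⊥-elim (1+n≰n (≤-trans (≤-reflexive (sym (δ-refl (k₂ y)))) (≤-trans (m≤m+n _ (count k₂ ys (k₂ y))) (≤-reflexive (sym (h (k₂ y)))))))
matchUp k₁ k₂ (x ∷ xs) ys h with find-key k₂ ys (k₁ x) (≤-trans (≤-trans (≤-reflexive (sym (δ-refl (k₁ x)))) (m≤m+n _ (count k₁ xs (k₁ x)))) (≤-reflexive (h (k₁ x))))
... | y , ys′ , eq , p with matchUp k₁ k₂ xs ys′ (λ v → +-cancelˡ-≡ (δ (k₁ x) v) _ _
      (trans (h v) (trans (sm-↭ _ p) (cong (λ z → δ z v + count k₂ ys′ v) eq))))
... | zs , q₁ , q₂ , hh = (x , y) ∷ zs , prep x q₁ , ↭-trans p (prep y q₂) , λ where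
      _ (here refl) → sym eq
      z (there m) → hh z m

module Bicoloured {n : ℕ} (c : Fin n → Bool) where

  Edge : Set
  Edge = Fin n × Fin n

  open Multigraph {n} {Edge} proj₁ proj₂ public

  deg-AB : ∀ L v → deg L v ≡ degA v L + degB v L
  deg-AB L v = sm-+ (λ e → δ (proj₁ e) v) (λ e → δ (proj₂ e) v) L

  AB : List Edge → Set
  AB L = ∀ e → e ∈ L → c (proj₁ e) ≡ true × c (proj₂ e) ≡ false

  AB-↭ : ∀ {L K} → L ↭ K → AB L → AB K
  AB-↭ p h e m = h e (∈-resp-↭ (↭-sym p) m)

  AB-left : ∀ {L K} → AB (L ++ K) → AB L
  AB-left h e m = h e (∈-++⁺ˡ m)

  AB-right : ∀ L {K} → AB (L ++ K) → AB K
  AB-right L h e m = h e (∈-++⁺ʳ L m)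

  degA-B : ∀ {L a} → AB L → c a ≡ false → degA a L ≡ 0
  degA-B {L} ab ca = sm-0 L λ e m → δ-≢ λ eq → case trans (sym (proj₁ (ab e m))) (trans (cong c eq) ca) of λ ()

  degB-A : ∀ {L b} → AB L → c b ≡ true → degB b L ≡ 0
  degB-A {L} ab cb = sm-0 L λ e m → δ-≢ λ eq → case trans (sym cb) (trans (cong c (sym eq)) (proj₂ (ab e m))) of λ ()

  orient : Bool → Fin n → Fin n → Edge
  orient true  u w = u , w
  orient false u w = w , u

  step-shape : ∀ {e u w} → Joins e u w → c (proj₁ e) ≡ true × c (proj₂ e) ≡ false → e ≡ orient (c u) u w × c w ≡ not (c u)
  step-shape (inj₁ (refl , refl)) (p , q) rewrite p = refl , q
  step-shape (inj₂ (refl , refl)) (p , q) rewrite q = refl , p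

  Hop : Set
  Hop = Fin n × Fin n × Fin n

  src mid tgt : Hop → Fin n
  src = proj₁
  mid = proj₁ ∘ proj₂
  tgt = proj₂ ∘ proj₂

  -- The Boolean is the colour of the two ends: `true` for ends in A and centre in B, `false` for
  -- the converse.
  hopEdges : Bool → Hop → List Edge
  hopEdges true  (x , y , z) = (x , y) ∷ (z , y) ∷ []
  hopEdges false (x , y , z) = (y , x) ∷ (y , z) ∷ []

  data Chain : Fin n → Fin n → List Hop → Set where
    []  : ∀ {u} → Chain u u []
    _∷_ : ∀ {u v} h {hs} → src h ≡ u × c u ≡ c (tgt h) → Chain (tgt h) v hs → Chain u v (h ∷ hs)

  hops : ∀ {u v es} → Walk u v es → AB es → c u ≡ c v → ∃ λ hs → es ≡ concatMap (hopEdges (c u)) hs × Chain u v hs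
  hops [] _ _ = [] , refl , []
  hops {u} {v} (step {e = e} j []) ab eq = ⊥-elim (lem (c u) (trans eq (proj₂ (step-shape {e} j (ab e (here refl))))))
    where
    lem : ∀ b → b ≡ not b → ⊥
    lem true ()
    lem false ()
  hops {u} {v} (step {w = w} {e = e} j (step {w = w′} {e = e′} {es = es} j′ wk)) ab eq
    with step-shape {e} j (ab e (here refl)) | step-shape {e′} j′ (ab e′ (there (here refl)))
  ... | refl , cw | refl , cw′ with hops wk (λ e m → ab e (there (there m))) (trans (trans cw′ (trans (cong not cw) (not-involutive (c u)))) eq)
  ... | hs , refl , ch = (u , w , w′) ∷ hs , lem , (_∷_ (u , w , w′) (refl , sym cc) ch)
    where
    cc : c w′ ≡ c u
    cc = trans cw′ (trans (cong not cw) (not-involutive (c u)))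
    lem : orient (c u) u w ∷ orient (c w) w w′ ∷ concatMap (hopEdges (c w′)) hs ≡ hopEdges (c u) (u , w , w′) ++ concatMap (hopEdges (c u)) hs
    lem rewrite cc | cw with c u
    ... | true = refl
    ... | false = refl

  chain-count : ∀ {u v hs} → Chain u v hs → ∀ z → δ u z + count tgt hs z ≡ count src hs z + δ v z
  chain-count {u} [] z = +-identityʳ (δ u z)
  chain-count (_∷_ h {hs} (refl , _) ch) z = trans (cong (δ (src h) z +_) (chain-count ch z)) (sym (+-assoc (δ (src h) z) _ _))

  module K = Multigraph {n} {Hop} src tgt

  chain-path : ∀ {u v hs} → Chain u v hs → ∀ h → h ∈ hs → K.Path (_∈ hs) (src h) v × K.Path (_∈ hs) (tgt h) v
  chain-path (_∷_ h {hs} (refl , _) ch) _ (here refl) = K.step h (here refl) (inj₁ (refl , refl)) (start ch) , start ch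
    where
    start : ∀ {w} → Chain w _ hs → K.Path (_∈ h ∷ hs) w _
    start [] = K.[]
    start ch@(_∷_ h′ (refl , _) _) = K.path-map (λ _ → there) (proj₁ (chain-path ch h′ (here refl)))
  chain-path (_∷_ h _ ch) h′ (there m) with chain-path ch h′ m
  ... | p , q = K.path-map (λ _ → there) p , K.path-map (λ _ → there) q

  chain-colour : ∀ {u v hs} → Chain u v hs → ∀ h → h ∈ hs → c (src h) ≡ c u × c (tgt h) ≡ c u
  chain-colour (_∷_ h (refl , eq) ch) _ (here refl) = refl , sym eq
  chain-colour (_∷_ h (refl , eq) ch) h′ (there m) with chain-colour ch h′ m
  ... | p , q = trans p (sym eq) , trans q (sym eq)

  -- Five is odd, so successive pieces start in different classes; a piece that starts in B ends in
  -- A and is read backwards.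
  fives : ∀ k {u v es} → Walk u v es → AB es → length es ≡ k * 5 → ∃ λ ts → concatMap trailEdges ts ↭ es
  fives zero [] ab eq = [] , refl
  fives (suc k) (step {w = w₁} {e = e₁} j₁ (step {w = w₂} {e = e₂} j₂ (step {w = w₃} {e = e₃} j₃ (step {w = w₄} {e = e₄} j₄ (step {w = w₅} {e = e₅} {es = es} j₅ wk))))) ab eq
    with fives k wk (λ e m → ab e (there (there (there (there (there m)))))) (suc-injective (suc-injective (suc-injective (suc-injective (suc-injective eq)))))
  fives (suc k) {u} (step {w = w₁} {e = e₁} j₁ (step {w = w₂} {e = e₂} j₂ (step {w = w₃} {e = e₃} j₃ (step {w = w₄} {e = e₄} j₄ (step {w = w₅} {e = e₅} {es = es} j₅ wk))))) ab eq
    | ts , p with c u in cu | step-shape {e₁} j₁ (ab e₁ (here refl)) | step-shape {e₂} j₂ (ab e₂ (there (here refl)))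
      | step-shape {e₃} j₃ (ab e₃ (there (there (here refl)))) | step-shape {e₄} j₄ (ab e₄ (there (there (there (here refl)))))
      | step-shape {e₅} j₅ (ab e₅ (there (there (there (there (here refl))))))
  ... | true | refl , q₁ | r₂ , q₂ | r₃ , q₃ | r₄ , q₄ | r₅ , q₅ rewrite q₁ | q₂ | q₃ | q₄ | r₂ | r₃ | r₄ | r₅ =
      trl u w₁ w₂ w₃ w₄ w₅ ∷ ts , ++⁺ˡ (trailEdges (trl u w₁ w₂ w₃ w₄ w₅)) p
  ... | false | refl , q₁ | r₂ , q₂ | r₃ , q₃ | r₄ , q₄ | r₅ , q₅ rewrite q₁ | q₂ | q₃ | q₄ | r₂ | r₃ | r₄ | r₅ =
      trl w₅ w₄ w₃ w₂ w₁ u ∷ ts , ↭-trans (++⁺ˡ (trailEdges (trl w₅ w₄ w₃ w₂ w₁ u)) p)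
        (Rearrange.shuffle (((w₅ , w₄) ∷ []) ∷ ((w₃ , w₄) ∷ []) ∷ ((w₃ , w₂) ∷ []) ∷ ((w₁ , w₂) ∷ []) ∷ ((w₁ , u) ∷ []) ∷ es ∷ [])
          (0 ∷ 1 ∷ 2 ∷ 3 ∷ 4 ∷ 5 ∷ []) (4 ∷ 3 ∷ 2 ∷ 1 ∷ 0 ∷ 5 ∷ []))

  pickExact : ∀ L (k : Fin n → ℕ) → (∀ a → k a ≤ degA a L) → ∃₂ λ L₁ L₂ → L ↭ L₁ ++ L₂ × (∀ a → degA a L₁ ≡ k a)
  pickExact [] k h = [] , [] , refl , λ a → sym (n≤0⇒n≡0 (h a))
  pickExact (e ∷ L) k h with k (proj₁ e) in eq
  ... | zero with pickExact L k (λ a → lem a)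
    where
    lem : ∀ a → k a ≤ degA a L
    lem a with proj₁ e ≟ a | h a
    ... | yes refl | _ = ≤-trans (≤-reflexive eq) z≤n
    ... | no _ | q = q
  ... | L₁ , L₂ , p , d = L₁ , e ∷ L₂ , ↭-trans (prep e p) (↭-sym (shift e L₁ L₂)) , d
  pickExact (e ∷ L) k h | suc j with pickExact L (λ a → k a ∸ δ (proj₁ e) a) (λ a → m≤n+o⇒m∸n≤o (k a) (δ (proj₁ e) a) (h a))
  ... | L₁ , L₂ , p , d = e ∷ L₁ , L₂ , prep e p , λ a → trans (cong (δ (proj₁ e) a +_) (d a)) (m+[n∸m]≡n (lem a))
    where
    lem : ∀ a → δ (proj₁ e) a ≤ k a
    lem a with proj₁ e ≟ a
    ... | yes refl = ≤-trans (s≤s z≤n) (≤-reflexive (sym eq))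
    ... | no _ = z≤n

  first second : Hop → Edge
  first (x , y , z)  = y , x
  second (x , y , z) = y , z

  hops-split : ∀ hs → concatMap (hopEdges false) hs ↭ map first hs ++ map second hs
  hops-split [] = refl
  hops-split (h ∷ hs) = prep (first h) (↭-trans (prep (second h) (hops-split hs)) (↭-sym (shift (second h) (map first hs) (map second hs))))

  -- The network of exchanges: a graph on B whose edges are hops with centres in A. It is connected
  -- on B, so parities can be shifted from any vertex of B to `r`.
  record Web (r : Fin n) (hs : List Hop) : Set where
    field
      linked : ∀ z → c z ≡ false → K.Path (_∈ hs) z r
      ends   : ∀ h → h ∈ hs → c (src h) ≡ false × c (tgt h) ≡ false

  -- Choosing one edge of every hop and moving the choice along paths of the web adjusts all parities without changing
  -- the number of chosen edges at any centre.
  select : ∀ {r hs} → Web r hs → ∀ L (m : Fin n → ℕ) (π : Fin n → Bool) →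
    (∀ a → count mid hs a ≤ m a) → (∀ a → m a ≤ count mid hs a + degA a L) →
    ∃₂ λ P Q → concatMap (hopEdges false) hs ++ L ↭ P ++ Q × (∀ a → degA a P ≡ m a) ×
      (∀ b → c b ≡ false → b ≢ r → odd (degB b P) ≡ π b)
  select {r} {hs} web L m π lo hi
    with pickExact L (λ a → m a ∸ count mid hs a) (λ a → m≤n+o⇒m∸n≤o (m a) (count mid hs a) (hi a))
  ... | L₁ , L₂ , p , d with K.tjoin hs r π′ conn
    where
    open Web web
    -- The reference choice consists of the first edges of all hops and of `L₁`. Switching a hop to
    -- its second edge changes the parities exactly at its two ends, so the hops to be switched form
    -- a T-join for the wrong parities.
    π′ : Fin n → Bool
    π′ b = if c b then false else odd (degB b (map first hs ++ L₁)) xor π b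
    conn : ∀ v → (π′ v ≡ false × K.deg hs v ≡ 0) ⊎ K.Path (_∈ hs) v r
    conn v with c v in eq
    ... | false = inj₂ (linked v eq)
    ... | true = inj₁ (refl , sm-0 hs λ h m → cong₂ _+_ (δ-≢ (neq (proj₁ (ends h m)))) (δ-≢ (neq (proj₂ (ends h m)))))
      where
      neq : ∀ {x} → c x ≡ false → x ≢ v
      neq q refl = case trans (sym q) eq of λ ()
  ... | J , J′ , q , par = map second J ++ map first J′ ++ L₁ , map first J ++ map second J′ ++ L₂ , perm , exact , parity
    where
    S = map second J
    S′ = map second J′
    F = map first J
    F′ = map first J′
    perm : concatMap (hopEdges false) hs ++ L ↭ (S ++ F′ ++ L₁) ++ (F ++ S′ ++ L₂)
    perm = ↭-trans (++⁺ (↭-trans (hops-split hs) (++⁺ (↭-trans (map⁺ first q) (↭-reflexive (map-++ first J J′)))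
                                                          (↭-trans (map⁺ second q) (↭-reflexive (map-++ second J J′))))) p)
      (↭-trans (↭-reflexive assoc₁) (↭-trans (Rearrange.shuffle (F ∷ F′ ∷ S ∷ S′ ∷ L₁ ∷ L₂ ∷ []) (0 ∷ 1 ∷ 2 ∷ 3 ∷ 4 ∷ 5 ∷ []) (2 ∷ 1 ∷ 4 ∷ 0 ∷ 3 ∷ 5 ∷ []))
        (↭-reflexive assoc₂)))
      where
      assoc₁ : ((F ++ F′) ++ (S ++ S′)) ++ (L₁ ++ L₂) ≡ F ++ F′ ++ S ++ S′ ++ L₁ ++ L₂
      assoc₁ = trans (++-assoc (F ++ F′) (S ++ S′) (L₁ ++ L₂)) (trans (++-assoc F F′ _) (cong (λ z → F ++ F′ ++ z) (++-assoc S S′ _)))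
      assoc₂ : S ++ F′ ++ L₁ ++ F ++ S′ ++ L₂ ≡ (S ++ F′ ++ L₁) ++ (F ++ S′ ++ L₂)
      assoc₂ = sym (trans (++-assoc S (F′ ++ L₁) _) (cong (S ++_) (++-assoc F′ L₁ _)))
    exact : ∀ a → degA a (S ++ F′ ++ L₁) ≡ m a
    exact a = begin
      degA a (S ++ F′ ++ L₁)                        ≡⟨ trans (sm-++ _ S (F′ ++ L₁)) (cong (degA a S +_) (sm-++ _ F′ L₁)) ⟩
      degA a S + (degA a F′ + degA a L₁)            ≡⟨ cong₂ _+_ (sm-map _ second J) (cong₂ _+_ (sm-map _ first J′) (d a)) ⟩
      count mid J a + (count mid J′ a + (m a ∸ s))  ≡⟨ +-assoc (count mid J a) _ _ ⟨
      count mid J a + count mid J′ a + (m a ∸ s)    ≡⟨ cong (_+ (m a ∸ s)) (trans (sym (sm-++ _ J J′)) (sym (sm-↭ _ q))) ⟩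
      s + (m a ∸ s)                                 ≡⟨ m+[n∸m]≡n (lo a) ⟩
      m a                                           ∎
      where
      open ≡-Reasoning
      s = count mid hs a
    parity : ∀ b → c b ≡ false → b ≢ r → odd (degB b (S ++ F′ ++ L₁)) ≡ π b
    parity b cb b≢r = trans (cong odd expand) (trans flip (trans (cong (odd base xor_) (trans (par b b≢r) π′b)) (cancel (odd base) (π b))))
      where
      base = degB b (map first hs ++ L₁)
      π′b : (if c b then false else odd base xor π b) ≡ odd base xor π b
      π′b rewrite cb = refl
      α = count src J b
      β = count tgt J b
      γ = count src J′ b
      λ₁ = degB b L₁
      expand : degB b (S ++ F′ ++ L₁) ≡ β + (γ + λ₁)
      expand = trans (sm-++ _ S (F′ ++ L₁)) (cong₂ _+_ (sm-map _ second J) (trans (sm-++ _ F′ L₁) (cong (_+ λ₁) (sm-map _ first J′))))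
      base≡ : base ≡ α + (γ + λ₁)
      base≡ = trans (sm-++ _ (map first hs) L₁) (trans (cong (_+ λ₁) (trans (sm-map _ first hs) (trans (sm-↭ _ q) (sm-++ _ J J′)))) (+-assoc α γ λ₁))
      degJ : K.deg J b ≡ α + β
      degJ = sm-+ (λ h → δ (src h) b) (λ h → δ (tgt h) b) J
      bool : ∀ x y z → y xor z ≡ (x xor z) xor (x xor y)
      bool true true true = refl
      bool true true false = refl
      bool true false true = refl
      bool true false false = refl
      bool false true true = refl
      bool false true false = refl
      bool false false true = refl
      bool false false false = refl
      cancel : ∀ x y → x xor (x xor y) ≡ y
      cancel true true = refl
      cancel true false = refl
      cancel false y = refl
      flip : odd (β + (γ + λ₁)) ≡ odd base xor odd (K.deg J b)
      flip = trans (odd-+ β _) (trans (bool (odd α) (odd β) (odd (γ + λ₁)))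
        (cong₂ _xor_ (sym (trans (cong odd base≡) (odd-+ α _))) (sym (trans (cong odd degJ) (odd-+ α β)))))

-- Splitting the edges into trails

double : ∀ {x y} → x + x ≡ y + y → x ≡ y
double {zero}  {zero}  _ = refl
double {suc x} {suc y} e = cong suc (double (suc-injective (trans (sym (+-suc x x)) (trans (suc-injective e) (+-suc y y)))))

four : ∀ m → 4 * m ≡ (m + m) + (m + m)
four = solve-∀

quarter : ∀ m → ∃ λ h → m ≤ 4 * h × 4 * h ≤ m + 3
quarter zero = 0 , z≤n , z≤n
quarter (suc zero) = 1 , s≤s z≤n , ≤-refl
quarter (suc (suc zero)) = 1 , s≤s (s≤s z≤n) , n≤1+n 4
quarter (suc (suc (suc zero))) = 1 , n≤1+n 3 , s≤s (s≤s (s≤s (s≤s z≤n)))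
quarter (suc (suc (suc (suc m)))) with quarter m
... | h , lo , hi = suc h , ≤-trans (+-monoʳ-≤ 4 lo) (≤-reflexive (sym (*-suc 4 h))) , ≤-trans (≤-reflexive (*-suc 4 h)) (+-monoʳ-≤ 4 hi)

-- The requirements on q(a) = q, where s₁ and s₂ count the hops through a of the two webs, y is the degree of a in three
-- further trees and ℓ its degree in the edges not used by the trees.
record Share (s₁ s₂ y ℓ : ℕ) (p : Bool) (q : ℕ) : Set where
  field
    parity : odd q ≡ p
    lo₁    : s₁ ≤ q
    lo₂    : s₂ + y ≤ 4 * q
    hi₂    : 4 * q ≤ y + (s₂ + ℓ)
    hi₁    : 5 * q ≤ y + s₁ + (s₂ + s₂ + ℓ)

-- Take the least value for the lower bounds that comes from adding them, `s₁ + ⌈(s₂ + y) / 4⌉`, or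
-- its successor if the parity is wrong. The upper bounds hold because `ℓ` is about twice the number
-- of tree edges at the vertex.
share : ∀ t₀ s₁ s₂ y ℓ p → 1 ≤ t₀ → 1 ≤ s₁ → 1 ≤ s₂ → 3 ≤ y →
  2 * t₀ + 4 * s₁ + 4 * s₂ + 2 * y ≤ ℓ + 2 → ∃ λ q → Share s₁ s₂ y ℓ p q × 2 ≤ q
share (suc t) (suc s) (suc u) (suc zero) ℓ p _ _ _ (s≤s ()) big
share (suc t) (suc s) (suc u) (suc (suc zero)) ℓ p _ _ _ (s≤s (s≤s ())) big
share (suc t) (suc s) (suc u) (suc (suc (suc v))) ℓ p _ _ _ _ big with quarter (suc u + (3 + v))
... | h , lo , hi = fit (odd (suc s + h) ≟ᵇ p)
  where
  s₁ = suc s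
  s₂ = suc u
  y = 3 + v
  q₀ = s₁ + h
  h≥1 : 1 ≤ h
  h≥1 = pos h lo
    where
    pos : ∀ {m} h → suc m ≤ 4 * h → 1 ≤ h
    pos (suc _) _ = s≤s z≤n
  -- The variables are now excesses over the minimal values 1, 1, 1 and 3, whence 14 = 2 + 4 + 4 + 6
  -- - 2.
  ℓ-big : 2 * t + 4 * s + 4 * u + 2 * v + 14 ≤ ℓ
  ℓ-big = +-cancelʳ-≤ 2 _ _ (≤-trans (≤-reflexive (eq t s u v)) big)
    where
    eq : ∀ t s u v → 2 * t + 4 * s + 4 * u + 2 * v + 14 + 2 ≡ 2 * suc t + 4 * suc s + 4 * suc u + 2 * (3 + v)
    eq = solve-∀
  bound : ∀ q → q₀ ≤ q → q ≤ suc q₀ → odd q ≡ p → Share s₁ s₂ y ℓ p q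
  bound q lq uq par = record
    { parity = par
    ; lo₁ = ≤-trans (m≤m+n s₁ h) lq
    ; lo₂ = ≤-trans lo (*-monoʳ-≤ 4 (≤-trans (m≤n+m h s₁) lq))
    ; hi₂ = begin
        4 * q ≤⟨ *-monoʳ-≤ 4 uq ⟩
        4 * suc q₀ ≡⟨ e₁ s h ⟩
        4 * h + (4 * s + 8) ≤⟨ +-monoˡ-≤ _ hi ⟩
        suc u + (3 + v) + 3 + (4 * s + 8) ≡⟨ e₂ s u v ⟩
        3 + v + (suc u + (4 * s + 11)) ≤⟨ +-monoʳ-≤ (3 + v) (+-monoʳ-≤ (suc u) (≤-trans (≤-trans (m≤n+m _ (2 * t + 4 * u + 2 * v + 3)) (≤-reflexive (e₃ t s u v))) ℓ-big)) ⟩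
        3 + v + (suc u + ℓ) ∎
    -- Multiplied by 4, because `hi` bounds only `4 * h`.
    ; hi₁ = *-cancelˡ-≤ 4 (begin
        4 * (5 * q) ≤⟨ *-monoʳ-≤ 4 (*-monoʳ-≤ 5 uq) ⟩
        4 * (5 * suc q₀) ≡⟨ f₁ s h ⟩
        5 * (4 * h) + (20 * s + 40) ≤⟨ +-monoˡ-≤ _ (*-monoʳ-≤ 5 hi) ⟩
        5 * (suc u + (3 + v) + 3) + (20 * s + 40) ≤⟨ m≤m+n _ (19 * u + 7 * v + 8 * t + 5) ⟩
        5 * (suc u + (3 + v) + 3) + (20 * s + 40) + (19 * u + 7 * v + 8 * t + 5) ≡⟨ f₂ t s u v ⟩
        4 * (3 + v + suc s + (suc u + suc u + (2 * t + 4 * s + 4 * u + 2 * v + 14))) ≤⟨ *-monoʳ-≤ 4 (+-monoʳ-≤ (3 + v + suc s) (+-monoʳ-≤ (suc u + suc u) ℓ-big)) ⟩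
        4 * (3 + v + suc s + (suc u + suc u + ℓ)) ∎) }
    where
    open ≤-Reasoning
    e₁ : ∀ s h → 4 * suc (suc s + h) ≡ 4 * h + (4 * s + 8)
    e₁ = solve-∀
    e₂ : ∀ s u v → suc u + (3 + v) + 3 + (4 * s + 8) ≡ 3 + v + (suc u + (4 * s + 11))
    e₂ = solve-∀
    e₃ : ∀ t s u v → 2 * t + 4 * u + 2 * v + 3 + (4 * s + 11) ≡ 2 * t + 4 * s + 4 * u + 2 * v + 14
    e₃ = solve-∀
    f₁ : ∀ s h → 4 * (5 * suc (suc s + h)) ≡ 5 * (4 * h) + (20 * s + 40)
    f₁ = solve-∀
    f₂ : ∀ t s u v → 5 * (suc u + (3 + v) + 3) + (20 * s + 40) + (19 * u + 7 * v + 8 * t + 5) ≡ 4 * (3 + v + suc s + (suc u + suc u + (2 * t + 4 * s + 4 * u + 2 * v + 14)))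
    f₂ = solve-∀
  q₀≥2 : 2 ≤ q₀
  q₀≥2 = +-mono-≤ (s≤s (z≤n {s})) h≥1
  fit : Dec (odd q₀ ≡ p) → ∃ λ q → Share s₁ s₂ y ℓ p q × 2 ≤ q
  fit (yes eq) = q₀ , bound q₀ ≤-refl (n≤1+n _) eq , q₀≥2
  fit (no ne) = suc q₀ , bound (suc q₀) (n≤1+n _) ≤-refl (sym (¬-not (ne ∘ sym))) , ≤-trans q₀≥2 (n≤1+n _)

module Build {n : ℕ} (c : Fin n → Bool) where

  open Bicoloured {n} c

  touch : ∀ {T u v} → Spans T → u ≢ v → 1 ≤ deg T u
  touch {T} {u} {v} sp ne = go (sp u v) ne
    where
    go : ∀ {v} → Path (_∈ T) u v → u ≢ v → 1 ≤ deg T u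
    go [] ne = ⊥-elim (ne refl)
    go (step e m j _) _ = ≤-trans (joins-pos {e} j) (sm-∈ (λ e → inc e u) m)

  touchA : ∀ {T a v} → Spans T → AB T → c a ≡ true → a ≢ v → 1 ≤ degA a T
  touchA {T} {a} sp ab ca ne = ≤-trans (touch sp ne) (≤-reflexive (trans (deg-AB T a) (trans (cong (degA a T +_) (degB-A ab ca)) (+-identityʳ _))))

  touchB : ∀ {T b v} → Spans T → AB T → c b ≡ false → b ≢ v → 1 ≤ degB b T
  touchB {T} {b} sp ab cb ne = ≤-trans (touch sp ne) (≤-reflexive (trans (deg-AB T b) (cong (_+ degB b T) (degA-B ab cb))))

  colours≢ : ∀ {u v} → c u ≡ true → c v ≡ false → u ≢ v
  colours≢ p q refl = case trans (sym p) q of λ ()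

  degA-hopsB : ∀ hs a → degA a (concatMap (hopEdges false) hs) ≡ count mid hs a + count mid hs a
  degA-hopsB hs a = trans (sm-concatMap _ (hopEdges false) hs) (trans (sm-cong (λ h → cong (δ (mid h) a +_) (+-identityʳ _)) hs) (sm-+ (λ h → δ (mid h) a) (λ h → δ (mid h) a) hs))

  degA-hopsA : ∀ hs a → degA a (concatMap (hopEdges true) hs) ≡ count src hs a + count tgt hs a
  degA-hopsA hs a = trans (sm-concatMap _ (hopEdges true) hs) (trans (sm-cong (λ h → cong (δ (src h) a +_) (+-identityʳ _)) hs) (sm-+ (λ h → δ (src h) a) (λ h → δ (tgt h) a) hs))

  degB-hopsA : ∀ hs b → degB b (concatMap (hopEdges true) hs) ≡ count mid hs b + count mid hs b
  degB-hopsA hs b = trans (sm-concatMap _ (hopEdges true) hs) (trans (sm-cong (λ h → cong (δ (mid h) b +_) (+-identityʳ _)) hs) (sm-+ (λ h → δ (mid h) b) (λ h → δ (mid h) b) hs))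

  -- The second tree provides a T-join that makes the first one even, and an Euler circuit from `r`
  -- in B is cut into hops at B. As the first tree spans, every vertex of B is an end and every
  -- vertex of A a centre. What the join leaves of the second tree is returned as `J`.
  makeWeb : ∀ {T T′ r a₀} → Spans T → Spans T′ → AB T → AB T′ → c r ≡ false → c a₀ ≡ true →
    ∃₂ λ hs J → T ++ T′ ↭ concatMap (hopEdges false) hs ++ J × Web r hs × (∀ a → c a ≡ true → 1 ≤ count mid hs a)
  makeWeb {T} {T′} {r} {a₀} sp sp′ ab ab′ cr ca₀ with tjoin T′ r (λ z → odd (deg T z)) (λ v → inj₂ (sp′ v r))
  ... | J , J′ , p , par with euler (T ++ J) even r (λ e m → path-map (λ _ → ∈-++⁺ˡ) (sp r (proj₁ e)))
    where
    even : Even (T ++ J)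
    even = even-root (T ++ J) r λ v ne → trans (odd-deg-++ {J = T} {J} refl v) (trans (cong (odd (deg T v) xor_) (par v ne)) (xor-same (odd (deg T v))))
  ... | es , wk , q with hops wk (AB-↭ q abD) refl
    where
    abD : AB (T ++ J)
    abD e m with ∈-++⁻ T m
    ... | inj₁ x = ab e x
    ... | inj₂ y = ab′ e (∈-resp-↭ (↭-sym p) (∈-++⁺ˡ y))
  ... | hs , eq , ch = hs , J′ , ↭-trans (++⁺ˡ T p) (↭-trans (↭-reflexive (sym (++-assoc T J J′))) (++⁺ʳ J′ D↭)) ,
    record { linked = linked ; ends = λ h m → case chain-colour ch h m of λ (x , y) → trans x cr , trans y cr } , centred
    where
    es≡ : es ≡ concatMap (hopEdges false) hs
    es≡ = subst (λ b → es ≡ concatMap (hopEdges b) hs) cr eq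
    D↭ : T ++ J ↭ concatMap (hopEdges false) hs
    D↭ = ↭-trans q (↭-reflexive es≡)
    linked : ∀ z → c z ≡ false → K.Path (_∈ hs) z r
    linked z cz with z ≟ r
    ... | yes refl = K.[]
    ... | no ne with sm-pos (λ e → δ (proj₂ e) z) T (touchB sp ab cz ne)
    ... | e , m , pos with find (∈-concatMap⁻ (hopEdges false) {xs = hs} (∈-resp-↭ D↭ (∈-++⁺ˡ m)))
    ... | h , h∈ , here refl = subst (λ x → K.Path (_∈ hs) x r) (δ-pos pos) (proj₁ (chain-path ch h h∈))
    ... | h , h∈ , there (here refl) = subst (λ x → K.Path (_∈ hs) x r) (δ-pos pos) (proj₂ (chain-path ch h h∈))
    centred : ∀ a → c a ≡ true → 1 ≤ count mid hs a
    centred a ca = half (≤-trans (≤-trans (touchA sp ab ca (colours≢ ca cr)) (≤-trans (m≤m+n _ (degA a J)) (≤-reflexive (sym (sm-++ _ T J)))))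
      (≤-reflexive (trans (sm-↭ _ D↭) (degA-hopsB hs a))))
      where
      half : ∀ {m} → 1 ≤ m + m → 1 ≤ m
      half {suc m} _ = s≤s z≤n

  hopList : ∀ (cs : List ClosedWalk) → (∀ k → k ∈ cs → c (proj₁ k) ≡ true) → AB (concatMap edgesOf cs) →
    ∃ λ hs → concatMap edgesOf cs ≡ concatMap (hopEdges true) hs × (∀ z → count tgt hs z ≡ count src hs z)
  hopList [] _ _ = [] , refl , λ _ → refl
  hopList ((u , es , wk) ∷ cs) st ab with hops wk (AB-left ab) refl | hopList cs (λ k m → st k (there m)) (AB-right es ab)
  ... | hs , eq , ch | hs′ , eq′ , cnt = hs ++ hs′ ,
    trans (cong₂ _++_ (subst (λ b → es ≡ concatMap (hopEdges b) hs) (st _ (here refl)) eq) eq′) (sym (concatMap-++ (hopEdges true) hs hs′)) ,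
    λ z → trans (sm-++ _ hs hs′) (trans (cong₂ _+_ (+-cancelˡ-≡ (δ u z) _ _ (trans (chain-count ch z) (+-comm _ (δ u z)))) (cnt z)) (sym (sm-++ _ hs hs′)))

  -- Hops of W paired at their common target form 4-trails; orienting these in a balanced way decides at which end the
  -- edge of P goes.
  module FromW (W P : List Edge) (abW : AB W) (even : Even W) (q : Fin n → ℕ)
    (degW : ∀ a → degA a W ≡ 4 * q a) (degP : ∀ a → degA a P ≡ q a) where

    result : ∃ λ ts → concatMap trailEdges ts ↭ W ++ P × (∀ a → sm (λ Q → δ (Trail.x4 Q) a) ts ≡ q a) ×
      (∀ b → sm (λ Q → δ (Trail.x1 Q) b + δ (Trail.x3 Q) b) ts + sm (λ Q → δ (Trail.x1 Q) b + δ (Trail.x3 Q) b) ts ≡ degB b W)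
    result with cycles W even
    ... | cs , p , st with hopList cs (λ k m → case st k m of λ (e , e∈ , eq) → trans (cong c (sym eq)) (proj₁ (abW e e∈))) (AB-↭ p abW)
    ... | hs , eq , cnt with pairUp tgt (length hs) hs ≤-refl (λ v → trans (cong odd (tgt2 v)) (odd-double (q v)))
      where
      -- Sources and targets are equally many at `a`, and together they make up the degree
      -- `4 * q a`.
      tgt2 : ∀ a → count tgt hs a ≡ q a + q a
      tgt2 a = double (trans (cong (_+ count tgt hs a) (cnt a)) (trans (sym (degA-hopsA hs a)) (trans (sm-↭ _ (↭-sym (↭-trans p (↭-reflexive eq)))) (trans (degW a) (four (q a))))))
    ... | ps , pp , keys = finish
      where
      s₀ t₀ : Hop × Hop → Fin n
      s₀ x = src (proj₁ x)
      t₀ x = src (proj₂ x)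
      module F = Multigraph {n} {Hop × Hop} s₀ t₀
      W↭ : W ↭ concatMap (hopEdges true) hs
      W↭ = ↭-trans p (↭-reflexive eq)
      src2 : ∀ a → count src hs a ≡ q a + q a
      src2 a = double (trans (cong (count src hs a +_) (sym (cnt a))) (trans (sym (degA-hopsA hs a)) (trans (sm-↭ _ (↭-sym W↭)) (trans (degW a) (four (q a))))))
      both-sum : ∀ (f : Hop → ℕ) → sm f hs ≡ sm (λ x → f (proj₁ x) + f (proj₂ x)) ps
      both-sum f = trans (sm-↭ f pp) (trans (sm-concatMap f (both tgt) ps) (sm-cong (λ x → cong (f (proj₁ x) +_) (+-identityʳ _)) ps))
      degF : ∀ a → F.deg ps a ≡ q a + q a
      degF a = trans (sym (both-sum (λ h → δ (src h) a))) (src2 a)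
      -- The 4-trails are the edges of a multigraph on A with degree `2 * q a` at `a`, so a balanced
      -- orientation has `q a` heads there, as many as `P` has edges.
      heads : ∀ ds → ps ↭ map proj₁ ds → (∀ z → sm (λ d → δ (F.head d) z) ds ≡ sm (λ d → δ (F.tail d) z) ds) → ∀ a → count F.head ds a ≡ q a
      heads ds pd bal a = double (trans (cong (_+ sm (λ d → δ (F.head d) a) ds) (bal a)) (trans (sym (sm-+ (λ d → δ (F.tail d) a) (λ d → δ (F.head d) a) ds))
        (trans (sm-cong dirs ds) (trans (sym (sm-map (λ x → F.inc x a) proj₁ ds)) (trans (sym (sm-↭ _ pd)) (degF a))))))
        where
        dirs : ∀ d → δ (F.tail d) a + δ (F.head d) a ≡ F.inc (proj₁ d) a
        dirs (x , true) = refl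
        dirs (x , false) = +-comm (δ (t₀ x) a) _
      asTrail : ((Hop × Hop) × Bool) × Edge → Trail n
      asTrail ((((u , b , a) , (v , b′ , _)) , true)  , (_ , y)) = trl u b a b′ v y
      asTrail ((((u , b , a) , (v , b′ , _)) , false) , (_ , y)) = trl v b′ a b u y
      twoHops : Hop × Hop → List Edge
      twoHops x = hopEdges true (proj₁ x) ++ hopEdges true (proj₂ x)
      asTrail-edges : ∀ z → tgt (proj₁ (proj₁ (proj₁ z))) ≡ tgt (proj₂ (proj₁ (proj₁ z))) → F.head (proj₁ z) ≡ proj₁ (proj₂ z) →
        trailEdges (asTrail z) ↭ twoHops (proj₁ (proj₁ z)) ++ proj₂ z ∷ []
      asTrail-edges ((((u , b , a) , (v , b′ , .a)) , true) , (.v , y)) refl refl =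
        Rearrange.shuffle (((u , b) ∷ []) ∷ ((a , b) ∷ []) ∷ ((a , b′) ∷ []) ∷ ((v , b′) ∷ []) ∷ ((v , y) ∷ []) ∷ []) (0 ∷ 1 ∷ 2 ∷ 3 ∷ 4 ∷ []) (0 ∷ 1 ∷ 3 ∷ 2 ∷ 4 ∷ [])
      asTrail-edges ((((u , b , a) , (v , b′ , .a)) , false) , (.u , y)) refl refl =
        Rearrange.shuffle (((v , b′) ∷ []) ∷ ((a , b′) ∷ []) ∷ ((a , b) ∷ []) ∷ ((u , b) ∷ []) ∷ ((u , y) ∷ []) ∷ []) (0 ∷ 1 ∷ 2 ∷ 3 ∷ 4 ∷ []) (3 ∷ 2 ∷ 0 ∷ 1 ∷ 4 ∷ [])
      asTrail-hang : ∀ z → Trail.x4 (asTrail z) ≡ F.head (proj₁ z)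
      asTrail-hang ((_ , true) , _) = refl
      asTrail-hang ((_ , false) , _) = refl
      asTrail-pass : ∀ z b → δ (Trail.x1 (asTrail z)) b + δ (Trail.x3 (asTrail z)) b ≡ δ (mid (proj₁ (proj₁ (proj₁ z)))) b + δ (mid (proj₂ (proj₁ (proj₁ z)))) b
      asTrail-pass ((_ , true) , _) b = refl
      asTrail-pass ((((u , m , a) , (v , m′ , _)) , false) , _) b = +-comm (δ m′ b) _
      finish : ∃ λ ts → concatMap trailEdges ts ↭ W ++ P × (∀ a → sm (λ Q → δ (Trail.x4 Q) a) ts ≡ q a) ×
        (∀ b → sm (λ Q → δ (Trail.x1 Q) b + δ (Trail.x3 Q) b) ts + sm (λ Q → δ (Trail.x1 Q) b + δ (Trail.x3 Q) b) ts ≡ degB b W)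
      finish with F.balanced ps (λ v → trans (cong odd (degF v)) (odd-double (q v)))
      ... | ds , pd , bal with matchUp F.head proj₁ ds P (λ v → trans (heads ds pd bal v) (sym (degP v)))
      ... | zs , zd , zp , same = map asTrail zs , all-edges , hang , pass
        where
        zs-ps : ps ↭ map (proj₁ ∘ proj₁) zs
        zs-ps = ↭-trans pd (↭-trans (map⁺ proj₁ zd) (↭-reflexive (sym (map-∘ zs))))
        keyed : ∀ z → z ∈ zs → tgt (proj₁ (proj₁ (proj₁ z))) ≡ tgt (proj₂ (proj₁ (proj₁ z)))
        keyed z m = keys _ (∈-resp-↭ (↭-sym zs-ps) (∈-map⁺ (proj₁ ∘ proj₁) m))
        go : ∀ ys → (∀ z → z ∈ ys → z ∈ zs) → concatMap trailEdges (map asTrail ys) ↭ concatMap twoHops (map (proj₁ ∘ proj₁) ys) ++ map proj₂ ys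
        go [] _ = refl
        go (z ∷ ys) h = ↭-trans (++⁺ (asTrail-edges z (keyed z (h z (here refl))) (same z (h z (here refl)))) (go ys (λ z m → h z (there m))))
          (interleave (twoHops (proj₁ (proj₁ z))) (proj₂ z ∷ []) _ (map proj₂ ys))
        two : ∀ xs → concatMap (hopEdges true) (concatMap (both tgt) xs) ≡ concatMap twoHops xs
        two [] = refl
        two ((h , h′) ∷ xs) = trans (cong (λ z → hopEdges true h ++ hopEdges true h′ ++ z) (two xs)) (sym (++-assoc (hopEdges true h) (hopEdges true h′) _))
        all-edges : concatMap trailEdges (map asTrail zs) ↭ W ++ P
        all-edges = ↭-trans (go zs (λ _ m → m)) (++⁺
          (↭-trans (concatMap⁺ twoHops (↭-sym zs-ps)) (↭-trans (↭-reflexive (sym (two ps))) (↭-trans (concatMap⁺ (hopEdges true) (↭-sym pp)) (↭-sym W↭)))) (↭-sym zp))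
        hang : ∀ a → sm (λ Q → δ (Trail.x4 Q) a) (map asTrail zs) ≡ q a
        hang a = trans (sm-map _ asTrail zs) (trans (sm-cong (λ z → cong (λ x → δ x a) (asTrail-hang z)) zs)
          (trans (sym (sm-map (λ d → δ (F.head d) a) proj₁ zs)) (trans (sym (sm-↭ _ zd)) (heads ds pd bal a))))
        pass : ∀ b → sm (λ Q → δ (Trail.x1 Q) b + δ (Trail.x3 Q) b) (map asTrail zs) + sm (λ Q → δ (Trail.x1 Q) b + δ (Trail.x3 Q) b) (map asTrail zs) ≡ degB b W
        pass b = trans (cong₂ _+_ one one) (trans (sym (degB-hopsA hs b)) (sm-↭ _ (↭-sym W↭)))
          where
          one : sm (λ Q → δ (Trail.x1 Q) b + δ (Trail.x3 Q) b) (map asTrail zs) ≡ count mid hs b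
          one = trans (sm-map _ asTrail zs) (trans (sm-cong (λ z → asTrail-pass z b) zs)
            (trans (sym (sm-map (λ x → δ (mid (proj₁ x)) b + δ (mid (proj₂ x)) b) (proj₁ ∘ proj₁) zs))
              (trans (sym (sm-↭ _ zs-ps)) (sym (both-sum (λ h → δ (mid h) b))))))

length-trailEdges : ∀ {n} (ts : List (Trail n)) → length (concatMap trailEdges ts) ≡ length ts * 5
length-trailEdges [] = refl
length-trailEdges (t ∷ ts) = cong (5 +_) (length-trailEdges ts)

-- Distributing the eight trees

module Assemble {n′ : ℕ} (c : Fin (suc n′) → Bool) where

  open Bicoloured c
  open Build c
  open Trees {n′} using (Packing)

  pass hang : Fin (suc n′) → List (Trail (suc n′)) → ℕ
  pass b = sm (λ Q → δ (Trail.x1 Q) b + δ (Trail.x3 Q) b)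
  hang a = sm (λ Q → δ (Trail.x4 Q) a)

  record Trails (E : List Edge) : Set where
    field
      trails : List (Trail (suc n′))
      cover  : concatMap trailEdges trails ↭ E
      hang≥2 : ∀ a → c a ≡ true → 2 ≤ hang a trails
      pass≥2 : ∀ b → c b ≡ false → 2 ≤ pass b trails

  module _ (E : List Edge) (abE : AB E) (five : 5 ∣ length E) (packed : Packing 8 E)
    (r a₀ : Fin (suc n′)) (cr : c r ≡ false) (ca₀ : c a₀ ≡ true) where

    open Packing packed

    abT : ∀ i → AB (T i)
    abT i e m = abE e (∈-resp-↭ (↭-sym partition) (∈-++⁺ˡ (∈-concatMap⁺ T (lose (∈-allFin i) m))))

    -- `T₀` will connect R and `Y` goes into W. Trees 1 and 2 form the web from which P is selected,
    -- trees 3 and 4 the one that serves to complete `Y` to W.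
    T₀ Y : List Edge
    T₀ = T 0F
    Y  = T 5F ++ T 6F ++ T 7F

    y t₀ : Fin (suc n′) → ℕ
    y a  = degA a Y
    t₀ a = degA a T₀

    module Webs (hs₁ : List Hop) (J₁ : List Edge) (p₁ : T 1F ++ T 2F ↭ concatMap (hopEdges false) hs₁ ++ J₁) (web₁ : Web r hs₁)
                (cen₁ : ∀ a → c a ≡ true → 1 ≤ count mid hs₁ a)
                (hs₂ : List Hop) (J₂ : List Edge) (p₂ : T 3F ++ T 4F ↭ concatMap (hopEdges false) hs₂ ++ J₂) (web₂ : Web r hs₂)
                (cen₂ : ∀ a → c a ≡ true → 1 ≤ count mid hs₂ a) where

      H₁ H₂ L₁ : List Edge
      H₁ = concatMap (hopEdges false) hs₁
      H₂ = concatMap (hopEdges false) hs₂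
      L₁ = J₁ ++ J₂ ++ Rest

      s₁ s₂ ℓ : Fin (suc n′) → ℕ
      s₁ a = count mid hs₁ a
      s₂ a = count mid hs₂ a
      ℓ a  = degA a L₁

      grouped : concatMap T (allFin 8) ↭ T₀ ++ (H₁ ++ J₁) ++ (H₂ ++ J₂) ++ Y
      grouped = ↭-trans (rearrange (T 0F ∷ T 1F ∷ T 2F ∷ T 3F ∷ T 4F ∷ T 5F ∷ T 6F ∷ T 7F ∷ [])
          (# 0 ⊕ # 1 ⊕ # 2 ⊕ # 3 ⊕ # 4 ⊕ # 5 ⊕ # 6 ⊕ # 7 ⊕ ∅) (# 0 ⊕ (# 1 ⊕ # 2) ⊕ (# 3 ⊕ # 4) ⊕ # 5 ⊕ # 6 ⊕ # 7))
        (++⁺ˡ T₀ (++⁺ p₁ (++⁺ʳ Y p₂)))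

      parts : E ↭ T₀ ++ H₁ ++ H₂ ++ Y ++ L₁
      parts = ↭-trans partition (↭-trans (++⁺ʳ Rest grouped) (rearrange (T₀ ∷ H₁ ∷ J₁ ∷ H₂ ∷ J₂ ∷ Y ∷ Rest ∷ [])
        ((# 0 ⊕ (# 1 ⊕ # 2) ⊕ (# 3 ⊕ # 4) ⊕ # 5) ⊕ # 6) (# 0 ⊕ # 1 ⊕ # 3 ⊕ # 5 ⊕ # 2 ⊕ # 4 ⊕ # 6)))

      degE : ∀ a → degA a E ≡ t₀ a + ((s₁ a + s₁ a) + ((s₂ a + s₂ a) + (y a + ℓ a)))
      degE a = trans (sm-↭ _ parts) (trans (sm-++ _ T₀ _) (cong (t₀ a +_) (trans (sm-++ _ H₁ _) (cong₂ _+_ (degA-hopsB hs₁ a)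
        (trans (sm-++ _ H₂ _) (cong₂ _+_ (degA-hopsB hs₂ a) (sm-++ _ Y L₁)))))))

      -- With X the degree of `a` in `T₀`, `H₁`, `H₂` and `Y`, `thin` gives `3 * X ≤ X + ℓ a + 2`.
      -- The leftovers `J₁` and `J₂` are tree edges too, but they are counted in `ℓ` and dropped on
      -- the left.
      room : ∀ a → 2 * t₀ a + 4 * s₁ a + 4 * s₂ a + 2 * y a ≤ ℓ a + 2
      room a = subst (_≤ ℓ a + 2) (eq₁ (t₀ a) (s₁ a) (s₂ a) (y a)) (+-cancelˡ-≤ X _ _ (begin
        X + 2 * X                                 ≡⟨⟩
        3 * X                                     ≤⟨ *-monoʳ-≤ 3 (m≤m+n X (j₁ + j₂)) ⟩
        3 * (X + (j₁ + j₂))                       ≡⟨ cong (3 *_) trees ⟨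
        3 * degA a (concatMap T (allFin 8))       ≤⟨ thin a ⟩
        degA a E + 2                              ≡⟨ cong (_+ 2) (degE a) ⟩
        t₀ a + ((s₁ a + s₁ a) + ((s₂ a + s₂ a) + (y a + ℓ a))) + 2 ≡⟨ eq₂ (t₀ a) (s₁ a) (s₂ a) (y a) (ℓ a) ⟩
        X + (ℓ a + 2)                             ∎))
        where
        open ≤-Reasoning
        X = t₀ a + (s₁ a + s₁ a) + (s₂ a + s₂ a) + y a
        j₁ = degA a J₁
        j₂ = degA a J₂
        eq₁ : ∀ t s u v → 2 * (t + (s + s) + (u + u) + v) ≡ 2 * t + 4 * s + 4 * u + 2 * v
        eq₁ = solve-∀
        eq₂ : ∀ t s u v w → t + ((s + s) + ((u + u) + (v + w))) + 2 ≡ t + (s + s) + (u + u) + v + (w + 2)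
        eq₂ = solve-∀
        eq₃ : ∀ t s j u k v → t + ((s + j) + ((u + k) + v)) ≡ t + s + u + v + (j + k)
        eq₃ = solve-∀
        trees : degA a (concatMap T (allFin 8)) ≡ X + (j₁ + j₂)
        trees = trans (sm-↭ _ grouped) (trans (sm-++ _ T₀ _) (trans (cong (t₀ a +_) (trans (sm-++ _ (H₁ ++ J₁) _) (cong₂ _+_
          (trans (sm-++ _ H₁ J₁) (cong (_+ j₁) (degA-hopsB hs₁ a))) (trans (sm-++ _ (H₂ ++ J₂) Y) (cong (_+ y a) (trans (sm-++ _ H₂ J₂) (cong (_+ j₂) (degA-hopsB hs₂ a))))))))
          (eq₃ (t₀ a) (s₁ a + s₁ a) j₁ (s₂ a + s₂ a) j₂ (y a))))

      sum₃ : ∀ (f : List Edge → ℕ) → (∀ xs ys → f (xs ++ ys) ≡ f xs + f ys) → 1 ≤ f (T 5F) → 1 ≤ f (T 6F) → 1 ≤ f (T 7F) → 3 ≤ f Y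
      sum₃ f add p q s = ≤-trans (+-mono-≤ p (+-mono-≤ q s)) (≤-reflexive (sym (trans (add (T 5F) _) (cong (f (T 5F) +_) (add (T 6F) (T 7F))))))

      -- The parity is that of the degree d of `a` in `E`, because R receives degree `d - 5q` at
      -- `a`, which has to be even.
      quota : ∀ a → ∃ λ q → Share (s₁ a) (s₂ a) (y a) (ℓ a) (odd (degA a E)) q × (c a ≡ true → 2 ≤ q)
      quota a with c a in ca
      ... | true = case share (t₀ a) (s₁ a) (s₂ a) (y a) (ℓ a) (odd (degA a E)) (at 0F) (cen₁ a ca) (cen₂ a ca)
              (sum₃ (degA a) (sm-++ _) (at 5F) (at 6F) (at 7F)) (room a) of λ (q , sh , two) → q , sh , λ _ → two
        where
        at : ∀ i → 1 ≤ degA a (T i)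
        at i = touchA (spans i) (abT i) ca (colours≢ ca cr)
      -- At a vertex of B no edge has its end in A, all counts vanish, and 0 meets the requirements.
      ... | false = 0 , record { parity = cong odd (sym zeroE) ; lo₁ = ≤-trans (m≤m+n _ _) small ; lo₂ = ≤-trans (m≤n+m _ (s₁ a)) small ; hi₂ = z≤n ; hi₁ = z≤n } , λ ()
        where
        zeroE : degA a E ≡ 0
        zeroE = degA-B abE ca
        eq : ∀ t s u v w → t + ((s + s) + ((u + u) + (v + w))) ≡ s + (u + v) + (t + (s + (u + w)))
        eq = solve-∀
        small : s₁ a + (s₂ a + y a) ≤ 0
        small = ≤-trans (m≤m+n _ _) (≤-reflexive (trans (sym (eq (t₀ a) (s₁ a) (s₂ a) (y a) (ℓ a))) (trans (sym (degE a)) zeroE)))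

      q : Fin (suc n′) → ℕ
      q a = proj₁ (quota a)

      module Q a = Share (proj₁ (proj₂ (quota a)))

      m₁ : Fin (suc n′) → ℕ
      m₁ a = 4 * q a ∸ y a

      y≤ : ∀ a → y a ≤ 4 * q a
      y≤ a = ≤-trans (m≤n+m (y a) (s₂ a)) (Q.lo₂ a)

      module Middle (P₁ Q₁ : List Edge) (perm₁ : H₂ ++ L₁ ↭ P₁ ++ Q₁) (deg₁ : ∀ a → degA a P₁ ≡ m₁ a)
        (par₁ : ∀ b → c b ≡ false → b ≢ r → odd (degB b P₁) ≡ odd (degB b Y)) where

        W : List Edge
        W = P₁ ++ Y

        degW : ∀ a → degA a W ≡ 4 * q a
        degW a = trans (sm-++ _ P₁ Y) (trans (cong (_+ y a) (deg₁ a)) (m∸n+n≡m (y≤ a)))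

        parts₁ : E ↭ T₀ ++ W ++ H₁ ++ Q₁
        parts₁ = ↭-trans parts (↭-trans (rearrange (T₀ ∷ H₁ ∷ H₂ ∷ Y ∷ L₁ ∷ []) (# 0 ⊕ # 1 ⊕ # 2 ⊕ # 3 ⊕ # 4) ((# 2 ⊕ # 4) ⊕ # 0 ⊕ # 1 ⊕ # 3))
          (↭-trans (++⁺ʳ (T₀ ++ H₁ ++ Y) perm₁) (rearrange (P₁ ∷ Q₁ ∷ T₀ ∷ H₁ ∷ Y ∷ []) ((# 0 ⊕ # 1) ⊕ # 2 ⊕ # 3 ⊕ # 4) (# 2 ⊕ (# 0 ⊕ # 4) ⊕ # 3 ⊕ # 1))))

        -- This is what `hi₁` is made for: after `4 * q a` edges have gone into W, one edge of each
        -- hop of `H₁` and the edges of `Q₁` must still suffice for P.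
        enough : ∀ a → q a ≤ s₁ a + degA a Q₁
        enough a = +-cancelˡ-≤ (4 * q a) _ _ (begin
          4 * q a + q a                                ≡⟨ +-comm (4 * q a) (q a) ⟩
          5 * q a                                      ≤⟨ Q.hi₁ a ⟩
          y a + s₁ a + (s₂ a + s₂ a + ℓ a)             ≡⟨ cong (y a + s₁ a +_) left₂ ⟩
          y a + s₁ a + (m₁ a + degA a Q₁)              ≡⟨ eq (y a) (s₁ a) (m₁ a) (degA a Q₁) ⟩
          m₁ a + y a + (s₁ a + degA a Q₁)              ≡⟨ cong (_+ (s₁ a + degA a Q₁)) (m∸n+n≡m (y≤ a)) ⟩
          4 * q a + (s₁ a + degA a Q₁)                 ∎)
          where
          open ≤-Reasoning
          eq : ∀ u s m d → u + s + (m + d) ≡ m + u + (s + d)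
          eq = solve-∀
          left₂ : s₂ a + s₂ a + ℓ a ≡ m₁ a + degA a Q₁
          left₂ = trans (cong (_+ ℓ a) (sym (degA-hopsB hs₂ a))) (trans (sym (sm-++ _ H₂ L₁)) (trans (sm-↭ _ perm₁) (trans (sm-++ _ P₁ Q₁) (cong (_+ degA a Q₁) (deg₁ a)))))

        abAll : AB (T₀ ++ W ++ H₁ ++ Q₁)
        abAll = AB-↭ parts₁ abE

        abW : AB W
        abW = AB-left (AB-right T₀ abAll)

        evenW : Even W
        evenW = even-root W r λ v ne → trans (cong odd (deg-AB W v)) (at v ne (c v) refl)
          where
          at : ∀ v → v ≢ r → ∀ b → c v ≡ b → odd (degA v W + degB v W) ≡ false
          at v ne true cv = trans (cong odd (trans (cong (degA v W +_) (degB-A abW cv)) (trans (+-identityʳ _) (trans (degW v) (four (q v)))))) (odd-double (q v + q v))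
          at v ne false cv = trans (cong (λ z → odd (z + degB v W)) (degA-B abW cv)) (trans (cong odd (sm-++ _ P₁ Y)) (trans (odd-+ (degB v P₁) _)
            (trans (cong (_xor odd (degB v Y)) (par₁ v cv ne)) (xor-same (odd (degB v Y))))))

        module Final (P₂ Q₂ : List Edge) (perm₂ : H₁ ++ Q₁ ↭ P₂ ++ Q₂) (deg₂ : ∀ a → degA a P₂ ≡ q a)
          (par₂ : ∀ b → c b ≡ false → b ≢ r → odd (degB b P₂) ≡ odd (degB b T₀) xor odd (degB b (H₁ ++ Q₁))) where

          R : List Edge
          R = T₀ ++ Q₂

          parts₂ : E ↭ R ++ (W ++ P₂)
          parts₂ = ↭-trans parts₁ (↭-trans (++⁺ˡ T₀ (++⁺ˡ W perm₂)) (rearrange (T₀ ∷ W ∷ P₂ ∷ Q₂ ∷ []) (# 0 ⊕ # 1 ⊕ # 2 ⊕ # 3) ((# 0 ⊕ # 3) ⊕ # 1 ⊕ # 2)))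

          abR : AB R
          abR = AB-left (AB-↭ parts₂ abE)

          evenR : Even R
          evenR = even-root R r λ v ne → trans (cong odd (deg-AB R v)) (at v ne (c v) refl)
            where
            at : ∀ v → v ≢ r → ∀ b → c v ≡ b → odd (degA v R + degB v R) ≡ false
            at v ne true cv = trans (cong odd (trans (cong (degA v R +_) (degB-A abR cv)) (+-identityʳ _))) (cancel (odd (degA v R)) (odd (q v)) (begin
              odd (q v)                                     ≡⟨ Q.parity v ⟩
              odd (degA v E)                                ≡⟨ cong odd (trans (sm-↭ _ parts₂) (sm-++ _ R (W ++ P₂))) ⟩
              odd (degA v R + degA v (W ++ P₂))             ≡⟨ odd-+ (degA v R) _ ⟩
              odd (degA v R) xor odd (degA v (W ++ P₂))     ≡⟨ cong (λ z → odd (degA v R) xor odd z) (trans (sm-++ _ W P₂) (cong₂ _+_ (trans (degW v) (four (q v))) (deg₂ v))) ⟩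
              odd (degA v R) xor odd (q v + q v + (q v + q v) + q v) ≡⟨ cong (odd (degA v R) xor_) (trans (odd-+ (q v + q v + (q v + q v)) (q v)) (cong (_xor odd (q v)) (odd-double (q v + q v)))) ⟩
              odd (degA v R) xor odd (q v)                  ∎))
              where
              open ≡-Reasoning
              cancel : ∀ x y → y ≡ x xor y → x ≡ false
              cancel true true ()
              cancel true false ()
              cancel false _ _ = refl
            at v ne false cv = trans (cong (λ z → odd (z + degB v R)) (degA-B abR cv)) (trans (cong odd (sm-++ _ T₀ Q₂)) (trans (odd-+ (degB v T₀) _)
              (cancel (odd (degB v T₀)) (odd (degB v (H₁ ++ Q₁))) (odd (degB v P₂)) (odd (degB v Q₂)) (par₂ v cv ne)
                (trans (cong odd (trans (sm-↭ _ perm₂) (sm-++ _ P₂ Q₂))) (odd-+ (degB v P₂) _)))))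
              where
              cancel : ∀ t a p k → p ≡ t xor a → a ≡ p xor k → t xor k ≡ false
              cancel true true false true refl refl = refl
              cancel true false true true refl refl = refl
              cancel false true true false refl refl = refl
              cancel false false false false refl refl = refl

          assemble : (∃ λ ts → concatMap trailEdges ts ↭ W ++ P₂ × (∀ a → hang a ts ≡ q a) × (∀ b → pass b ts + pass b ts ≡ degB b W)) →
            (∃ λ es → Walk a₀ a₀ es × R ↭ es) → Trails E
          assemble (ts , cov , hg , ps) (es , wk , pR) = close (∣m+n∣m⇒∣n (subst (5 ∣_) len five) (divides (length ts) refl))
            where
            len : length E ≡ length ts * 5 + length es
            len = trans (↭-length parts₂) (trans (length-++ R) (trans (cong₂ _+_ (↭-length pR) (trans (sym (↭-length cov)) (length-trailEdges ts))) (+-comm (length es) _)))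
            close : 5 ∣ length es → Trails E
            close (divides k eq) = case fives k wk (AB-↭ pR abR) eq of λ (us , cov′) → record
              { trails = ts ++ us
              ; cover = ↭-trans (↭-reflexive (concatMap-++ trailEdges ts us)) (↭-trans (++-comm (concatMap trailEdges ts) (concatMap trailEdges us))
                  (↭-trans (++⁺ (↭-trans cov′ (↭-sym pR)) cov) (↭-sym parts₂)))
              ; hang≥2 = λ a ca → ≤-trans (proj₂ (proj₂ (quota a)) ca) (≤-trans (≤-reflexive (sym (hg a))) (≤-trans (m≤m+n _ (hang a us)) (≤-reflexive (sym (sm-++ _ ts us)))))
              ; pass≥2 = λ b cb → ≤-trans (half (≤-trans (three b cb) (≤-reflexive (sym (ps b))))) (≤-trans (m≤m+n _ (pass b us)) (≤-reflexive (sym (sm-++ _ ts us)))) }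
              where
              -- The degree of `b` in W is twice the number of passages through `b`, so the three
              -- trees in `Y` already force two passages.
              half : ∀ {m} → 3 ≤ m + m → 2 ≤ m
              half {suc zero} (s≤s (s≤s ()))
              half {suc (suc m)} _ = s≤s (s≤s z≤n)
              three : ∀ b → c b ≡ false → 3 ≤ degB b W
              three b cb = ≤-trans (sum₃ (degB b) (sm-++ _) (at 5F) (at 6F) (at 7F)) (≤-trans (m≤n+m _ (degB b P₁)) (≤-reflexive (sym (sm-++ _ P₁ Y))))
                where
                at : ∀ i → 1 ≤ degB b (T i)
                at i = touchB (spans i) (abT i) cb (colours≢ ca₀ cb ∘ sym)

          trails : Trails E
          trails = assemble (FromW.result W P₂ abW evenW q degW deg₂)
            (euler R evenR a₀ λ e _ → path-map (λ _ → ∈-++⁺ˡ) (spans 0F a₀ (proj₁ e)))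

        trails : Trails E
        -- R consists of `T₀` and of what `P₂` leaves of `H₁ ++ Q₁`; the prescribed parity of `P₂`
        -- makes it even.
        trails = case select web₁ Q₁ q (λ b → odd (degB b T₀) xor odd (degB b (H₁ ++ Q₁))) Q.lo₁ enough of
          λ (P₂ , Q₂ , perm₂ , deg₂ , par₂) → Final.trails P₂ Q₂ perm₂ deg₂ par₂

      trails : Trails E
      -- W is `P₁ ++ Y`, so `P₁` has to agree with `Y` in parity at the vertices of B; `lo₂` and
      -- `hi₂` say that the degree `4 * q a ∸ y a` is attainable.
      trails = case select web₂ L₁ m₁ (λ b → odd (degB b Y))
          (λ a → m+n≤o⇒m≤o∸n (s₂ a) (Q.lo₂ a)) (λ a → m≤n+o⇒m∸n≤o (4 * q a) (y a) (Q.hi₂ a)) of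
        λ (P₁ , Q₁ , perm₁ , deg₁ , par₁) → Middle.trails P₁ Q₁ perm₁ deg₁ par₁

    trails : Trails E
    trails = case makeWeb {a₀ = a₀} (spans 1F) (spans 2F) (abT 1F) (abT 2F) cr ca₀ of λ (hs₁ , J₁ , p₁ , web₁ , cen₁) →
      case makeWeb {a₀ = a₀} (spans 3F) (spans 4F) (abT 3F) (abT 4F) cr ca₀ of λ (hs₂ , J₂ , p₂ , web₂ , cen₂) →
        Webs.trails hs₁ J₁ p₁ web₁ cen₁ hs₂ J₂ p₂ web₂ cen₂

-- The oriented edge list of the given graph

unique-disjoint : ∀ {A : Set} {e : A} xs {ys} → Unique (xs ++ ys) → e ∈ xs → e ∈ ys → ⊥
unique-disjoint (x ∷ xs) (h ∷ u) (here refl) m = All.lookup h (∈-++⁺ʳ xs m) refl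
unique-disjoint (x ∷ xs) (h ∷ u) (there p) m = unique-disjoint xs u p m

unique-++⁻ : ∀ {A : Set} (xs : List A) {ys} → Unique (xs ++ ys) → Unique xs × Unique ys
unique-++⁻ [] u = [] , u
unique-++⁻ (x ∷ xs) (h ∷ u) with unique-++⁻ xs u
... | v , w = (All.++⁻ˡ xs h ∷ v) , w

unique⇒simple : ∀ {A : Set} {L : List A} → Unique L → Simple L
unique⇒simple u xs ys p = unique-disjoint xs (Unique-resp-↭ (setoid _) (↭⇒↭ₛ p) u)

pairs≡product : ∀ {A B : Set} (xs : List A) (ys : List B) → concatMap (λ x → map (x ,_) ys) xs ≡ cartesianProduct xs ys
pairs≡product [] ys = refl
pairs≡product (x ∷ xs) ys = cong (map (x ,_) ys ++_) (pairs≡product xs ys)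

length-filterᵇ : ∀ {A : Set} (p : A → Bool) xs → length (filterᵇ p xs) ≡ sm (ind ∘ p) xs
length-filterᵇ p [] = refl
length-filterᵇ p (x ∷ xs) with p x
... | true  = cong suc (length-filterᵇ p xs)
... | false = length-filterᵇ p xs

norm-< : ∀ {n} {u v : Fin n} → toℕ u < toℕ v → norm (u , v) ≡ (u , v)
norm-< {u = u} {v} lt rewrite Equivalence.to T-≡ (<⇒<ᵇ lt) = refl

norm-> : ∀ {n} {u v : Fin n} → toℕ v < toℕ u → norm (u , v) ≡ (v , u)
norm-> {u = u} {v} gt rewrite ¬-not {toℕ u <ᵇ toℕ v} {true} (λ q → <-asym gt (<ᵇ⇒< (toℕ u) (toℕ v) (Equivalence.from T-≡ q))) = refl

norm-swap : ∀ {n} {u v : Fin n} → u ≢ v → norm (u , v) ≡ norm (v , u)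
norm-swap {u = u} {v} ne with <-cmp (toℕ u) (toℕ v)
... | tri< lt _ _ = trans (norm-< lt) (sym (norm-> lt))
... | tri≈ _ eq _ = ⊥-elim (ne (toℕ-injective eq))
... | tri> _ _ gt = trans (norm-> gt) (sym (norm-< gt))

module Oriented {n : ℕ} (G : Graph n) (c : Fin n → Bool) (proper : ∀ u v → Bool.T (adj G u v) → c u ≢ c v) where

  open Bicoloured c using (AB)

  orient : Fin n × Fin n → Fin n × Fin n
  orient (u , v) = if c u then (u , v) else (v , u)

  E : List (Fin n × Fin n)
  E = map orient (edges G)

  edge⁻ : ∀ {u v} → (u , v) ∈ edges G → toℕ u < toℕ v × Bool.T (adj G u v)
  edge⁻ {u} {v} m with Equivalence.to T-∧ (proj₂ (∈-filter⁻ (Bool.T? ∘ _) {xs = allPairs n} m))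
  ... | lt , a = <ᵇ⇒< (toℕ u) (toℕ v) lt , a

  edge⁺ : ∀ {u v} → toℕ u < toℕ v → Bool.T (adj G u v) → (u , v) ∈ edges G
  edge⁺ {u} {v} lt a = ∈-filter⁺ (Bool.T? ∘ _) (subst ((u , v) ∈_) (sym (pairs≡product (allFin n) (allFin n)))
    (∈-cartesianProduct⁺ (∈-allFin u) (∈-allFin v))) (Equivalence.from T-∧ (<⇒<ᵇ lt , a))

  norm-orient : ∀ e → e ∈ edges G → norm (orient e) ≡ e
  norm-orient (u , v) m with c u
  ... | true  = norm-< (proj₁ (edge⁻ m))
  ... | false = norm-> (proj₁ (edge⁻ m))

  norm-E : map norm E ≡ edges G
  norm-E = trans (sym (map-∘ (edges G))) (trans (map-cong-local (All.tabulate (λ {e} → norm-orient e))) (map-id (edges G)))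

  unique : Unique E
  unique = AllPairs.map (_∘ cong norm) (AllPairs.map⁻ (subst Unique (sym norm-E)
    (unique-filter (Bool.T? ∘ _) (subst Unique (sym (pairs≡product (allFin n) (allFin n))) (cartesianProduct⁺ (allFin⁺ n) (allFin⁺ n))))))

  abE : AB E
  abE e m with ∈-map⁻ orient m
  ... | (u , v) , uv , refl with c u in cu | c v in cv
  ... | true  | false = cu , cv
  ... | false | true  = cv , cu
  ... | true  | true  = ⊥-elim (proper u v (proj₂ (edge⁻ uv)) (trans cu (sym cv)))
  ... | false | false = ⊥-elim (proper u v (proj₂ (edge⁻ uv)) (trans cu (sym cv)))

  orient-swap : ∀ {u v} → c u ≢ c v → orient (u , v) ≡ orient (v , u)
  orient-swap {u} {v} ne with c u | c v
  ... | true  | false = refl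
  ... | false | true  = refl
  ... | true  | true  = ⊥-elim (ne refl)
  ... | false | false = ⊥-elim (ne refl)

  orient-∈ : ∀ {u v} → Bool.T (adj G u v) → orient (u , v) ∈ E
  orient-∈ {u} {v} a with <-cmp (toℕ u) (toℕ v)
  ... | tri< lt _ _ = ∈-map⁺ orient (edge⁺ lt a)
  ... | tri> _ _ gt = subst (_∈ E) (orient-swap (proper u v a ∘ sym)) (∈-map⁺ orient (edge⁺ gt (subst Bool.T (adj-sym G u v) a)))
  ... | tri≈ _ eq _ with toℕ-injective eq
  ... | refl = ⊥-elim (subst Bool.T (irrefl G u) a)

  module _ {k : ℕ} (connected : ∀ F → length F < k → Connected (AdjMinus G F)) where

    -- If there were fewer than `k` crossing edges, they could be deleted, but a walk from `u` to
    -- `v` in what remains has to cross.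
    cut-size : ∀ (S : Fin n → Bool) u v → S u ≡ true → S v ≡ false → k ≤ sm (λ e → ind (S (proj₁ e) xor S (proj₂ e))) E
    cut-size S u v Su Sv = ≮⇒≥ λ lt → escape (connected F (subst (_< k) (sym (length-filterᵇ crosses E)) lt) u v) Su
      where
      crosses : Fin n × Fin n → Bool
      crosses e = S (proj₁ e) xor S (proj₂ e)
      F = filterᵇ crosses E
      in-F : ∀ {x y} → Bool.T (adj G x y) → S x ≡ true → S y ≡ false → (x , y) ∈ F ⊎ (y , x) ∈ F
      in-F {x} {y} a Sx Sy with c x | orient-∈ a
      ... | true  | m = inj₁ (∈-filter⁺ (Bool.T? ∘ crosses) m (Equivalence.from T-≡ (cong₂ _xor_ Sx Sy)))
      ... | false | m = inj₂ (∈-filter⁺ (Bool.T? ∘ crosses) m (Equivalence.from T-≡ (cong₂ _xor_ Sy Sx)))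
      escape : ∀ {x} → Star (AdjMinus G F) x v → S x ≡ true → ⊥
      escape ε Sx = case trans (sym Sx) Sv of λ ()
      escape (_◅_ {_} {y} (a , out , out′) path) Sx = go (S y) refl
        where
        go : ∀ b → S y ≡ b → ⊥
        go true  Sy = escape path Sy
        go false Sy = Sum.[ out , out′ ] (in-F a Sx Sy)

    both-colours : 0 < k → ∀ {u v} → u ≢ v → ∃ (λ a → c a ≡ true) × ∃ (λ b → c b ≡ false)
    both-colours pos {u} {v} ne with connected [] pos u v
    ... | ε = ⊥-elim (ne refl)
    ... | _◅_ {_} {w} (a , _) _ with c u in cu | c w in cw
    ... | true  | false = (u , cu) , (w , cw)
    ... | false | true  = (w , cw) , (u , cu)
    ... | true  | true  = ⊥-elim (proper u w a (trans cu (sym cw)))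
    ... | false | false = ⊥-elim (proper u w a (trans cu (sym cw)))

  open Trail

  -- Fifteen pairs of vertices must differ: nine by their colours, four at distance two because
  -- consecutive edges differ, and the remaining two by hypothesis.
  toPath : (Q : Trail n) → (∀ {e} → e ∈ trailEdges Q → e ∈ E) → Unique (trailEdges Q) → x0 Q ≢ x4 Q → x1 Q ≢ x5 Q →
    ∃ λ P → pathEdges P ≡ map norm (trailEdges Q)
  toPath (trl u v w x y z) sub uniq u≢y v≢z =
    record { vert = lookupᵛ vs ; inj = λ {i} {j} → lookup-injective distinct i j } ,
    cong₂ _∷_ refl (cong₂ _∷_ (norm-swap (colours cw cv ∘ sym)) (cong₂ _∷_ refl (cong₂ _∷_ (norm-swap (colours cy cx ∘ sym)) refl)))
    where
    vs : Vec (Fin n) 6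
    vs = u ∷ᵛ v ∷ᵛ w ∷ᵛ x ∷ᵛ y ∷ᵛ z ∷ᵛ []ᵛ
    ab : ∀ {e} → e ∈ trailEdges (trl u v w x y z) → c (proj₁ e) ≡ true × c (proj₂ e) ≡ false
    ab m = abE _ (sub m)
    cu = proj₁ (ab (here refl))
    cv = proj₂ (ab (here refl))
    cw = proj₁ (ab (there (here refl)))
    cx = proj₂ (ab (there (there (here refl))))
    cy = proj₁ (ab (there (there (there (here refl)))))
    cz = proj₂ (ab (there (there (there (there (here refl))))))
    colours : ∀ {a b} → c a ≡ true → c b ≡ false → a ≢ b
    colours ca cb refl = case trans (sym ca) cb of λ ()
    apart : ∀ {e f} xs {ys} → trailEdges (trl u v w x y z) ≡ xs ++ ys → e ∈ xs → f ∈ ys → e ≢ f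
    apart xs eq m m′ refl = unique-disjoint xs (subst Unique eq uniq) m m′
    u≢w : u ≢ w
    u≢w eq = apart [ _ ] refl (here refl) (here refl) (cong (_, v) eq)
    v≢x : v ≢ x
    v≢x eq = apart (_ ∷ _ ∷ []) refl (there (here refl)) (here refl) (cong (w ,_) eq)
    w≢y : w ≢ y
    w≢y eq = apart (_ ∷ _ ∷ _ ∷ []) refl (there (there (here refl))) (here refl) (cong (_, x) eq)
    x≢z : x ≢ z
    x≢z eq = apart (_ ∷ _ ∷ _ ∷ _ ∷ []) refl (there (there (there (here refl)))) (here refl) (cong (y ,_) eq)
    distinct : Distinct vs
    distinct = (colours cu cv ∷ u≢w ∷ colours cu cx ∷ u≢y ∷ colours cu cz ∷ []) ∷
      (colours cw cv ∘ sym ∷ v≢x ∷ colours cy cv ∘ sym ∷ v≢z ∷ []) ∷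
      (colours cw cx ∷ w≢y ∷ colours cw cz ∷ []) ∷ (colours cy cx ∘ sym ∷ x≢z ∷ []) ∷ (colours cy cz ∷ []) ∷ [] ∷ []

  toPaths : ∀ qs → (∀ {e} → e ∈ concatMap trailEdges qs → e ∈ E) → Unique (concatMap trailEdges qs) →
    (∀ Q → Q ∈ qs → x0 Q ≢ x4 Q × x1 Q ≢ x5 Q) → ∃ λ ps → concatMap pathEdges ps ≡ map norm (concatMap trailEdges qs)
  toPaths [] sub uniq good = [] , refl
  toPaths (Q ∷ qs) sub uniq good =
    let uQ , uqs = unique-++⁻ (trailEdges Q) uniq
        x0≢x4 , x1≢x5 = good Q (here refl)
        P , eq = toPath Q (sub ∘ ∈-++⁺ˡ) uQ x0≢x4 x1≢x5
        ps , eqs = toPaths qs (sub ∘ ∈-++⁺ʳ (trailEdges Q)) uqs (λ R → good R ∘ there)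
    in P ∷ ps , trans (cong₂ _++_ eq eqs) (sym (map-++ norm (trailEdges Q) _))

  fromTrails : ∀ ts → concatMap trailEdges ts ↭ E → (∀ {a b} → (a , b) ∈ E → 2 ≤ sm (λ Q → δ (x1 Q) b + δ (x3 Q) b) ts) →
    (∀ {a b} → (a , b) ∈ E → 2 ≤ sm (λ Q → δ (x4 Q) a) ts) → P5Decomposition G
  fromTrails ts cover pass≥2 hang≥2 = case untangle ts (covers cover) pass≥2 hang≥2 of λ where
      (qs , covers cover′ , good) → case toPaths qs (∈-resp-↭ cover′) (Unique-resp-↭ (setoid _) (↭⇒↭ₛ (↭-sym cover′)) unique) good of λ
        (ps , eq) → ps , ↭-trans (↭-reflexive eq) (↭-trans (map⁺ norm cover′) (↭-reflexive norm-E))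
    where open Untangle E (unique⇒simple unique) using (untangle; covers)

decompose : ∀ {m} (G : Graph (suc (suc m))) c (proper : ∀ u v → Bool.T (adj G u v) → c u ≢ c v) →
  (∀ F → length F < 48 → Connected (AdjMinus G F)) → 5 ∣ ∣E∣ G → P5Decomposition G
-- Vertices 0 and 1 serve as two distinct vertices. The bound 48 from `cut-size` is the required
-- `8 * 6` by computation.
decompose G c proper connected five = case both-colours connected (s≤s z≤n) {fz} {fs fz} (λ ()) of λ
    ((a₀ , ca₀) , (r , cr)) → use (trails E abE (subst (5 ∣_) (sym (length-map orient (edges G))) five) (Trees.packing 8 fz E (cut-size connected)) r a₀ cr ca₀)
  where
  open Oriented G c proper
  open Assemble c
  use : Trails E → P5Decomposition G
  use t = fromTrails ts cover (λ m → pass≥2 _ (proj₂ (abE _ m))) (λ m → hang≥2 _ (proj₁ (abE _ m)))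
    where open Trails t renaming (trails to ts)

theorem4p2 : ∀ {n : ℕ} (G : Graph n) → EdgeConnected 48 G → Bipartite G → 5 ∣ ∣E∣ G → P5Decomposition G
theorem4p2 {suc zero} G (s≤s () , _)
theorem4p2 {suc (suc m)} G (_ , connected) (c , proper) five = decompose G c proper connected five
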